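{- A tree $T$ is a unit rectangle visibility graph if and only if $T$ is the union of two subdivided caterpillar forests, each with maximum degree at most $3$.
   Context: A finite simple graph $G$ is a unit rectangle visibility graph (URVG) if its vertices $v$ can be represented by closed unit squares $S_v$ in the plane with sides parallel to the coordinate axes and with pairwise disjoint interiors (squares may touch along their boundaries), in such a way that two distinct vertices $v,w$ are adjacent if and only if there is an unobstructed non-degenerate (positive width) horizontal or vertical band of visibility joining $S_v$ and $S_w$. Here a horizontal band of visibility joining $S_v$ and $S_w$ is given by an open interval $I$ of positive length such that for every $y_0\in I$ the line $y=y_0$ meets the interiors of both $S_v$ and $S_w$, and the part of this line between $S_v$ and $S_w$ (possibly a single point if the squares touch) meets the interior of no other square of the representation; vertical bands are defined analogously with the roles of $x$ and $y$ exchanged. A caterpillar is a tree in which all vertices of degree greater than $1$ lie on a single path. A subdivided caterpillar is a tree obtained from a caterpillar by replacing each edge by a path of arbitrary length (at least $1$). A subdivided caterpillar forest is a forest each of whose connected components is a subdivided caterpillar (isolated vertices are allowed). "$T$ is the union of two forests" means that $T$ has two such subgraphs whose edge sets together cover all edges of $T$. -}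

module Defs where

open import Data.Fin.Base using (Fin)
open import Data.List.Base using (List; []; _∷_; [_]; _++_; length; filter; reverse; allFin)
open import Data.List.Membership.Propositional using (_∈_; _∉_)
open import Data.List.Relation.Unary.Linked using (Linked)
open import Data.List.Relation.Unary.Unique.Propositional using (Unique)
open import Data.Nat.Base as ℕ using (ℕ)
open import Data.Product.Base using (Σ-syntax; ∃; ∃-syntax; _×_; _,_; proj₁; proj₂; swap)
open import Data.Rational.Base as ℚ using (ℚ; 1ℚ)
import Data.Rational.Properties as ℚₚ
open import Data.Sum.Base using (_⊎_)
open import Function.Base using (_∘_)
open import Function.Bundles using (_⇔_)
open import Function.Definitions using (Injective)
open import Level using (0ℓ)
open import Relation.Binary.Core using (Rel)
open import Relation.Binary.Definitions using (Symmetric; Decidable)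
open import Relation.Binary.Construct.Closure.ReflexiveTransitive using (Star)
open import Relation.Binary.PropositionalEquality using (_≡_; _≢_; refl; sym; trans; cong; subst)
open import Relation.Nullary using (¬_)

private
  variable
    k m n : ℕ

-- Real numbers as located Dedekind cuts of ℚ.
-- Lower q means "q < x", Upper q means "x < q".
record ℝ : Set₁ where
  field
    Lower Upper     : ℚ → Set
    lower-inhabited : ∃ Lower
    upper-inhabited : ∃ Upper
    lower-closed    : ∀ {q r} → q ℚ.< r → Lower r → Lower q
    upper-closed    : ∀ {q r} → q ℚ.< r → Upper q → Upper r
    lower-open      : ∀ {q} → Lower q → ∃[ r ] (q ℚ.< r × Lower r)
    upper-open      : ∀ {r} → Upper r → ∃[ q ] (q ℚ.< r × Upper q)
    disjoint        : ∀ {q} → Lower q → ¬ Upper q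
    located         : ∀ {q r} → q ℚ.< r → Lower q ⊎ Upper r

open ℝ public

infix 4 _<_ _≤_

_<_ : ℝ → ℝ → Set
x < y = ∃[ q ] (Upper x q × Lower y q)

_≤_ : ℝ → ℝ → Set
x ≤ y = ¬ (y < x)

private
  +-−-cancel : ∀ q r → (q ℚ.+ r) ℚ.- r ≡ q
  +-−-cancel q r = trans (ℚₚ.+-assoc q r (ℚ.- r))
    (trans (cong (q ℚ.+_) (ℚₚ.+-inverseʳ r)) (ℚₚ.+-identityʳ q))

  −-+-cancel : ∀ q r → (q ℚ.- r) ℚ.+ r ≡ q
  −-+-cancel q r = trans (ℚₚ.+-assoc q (ℚ.- r) r)
    (trans (cong (q ℚ.+_) (ℚₚ.+-inverseˡ r)) (ℚₚ.+-identityʳ q))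

infixl 6 _+ℚ_

-- The only addition needed is that of a rational to a real.
_+ℚ_ : ℝ → ℚ → ℝ
x +ℚ d = record
  { Lower           = λ q → Lower x (q ℚ.- d)
  ; Upper           = λ q → Upper x (q ℚ.- d)
  ; lower-inhabited = let (q , l) = lower-inhabited x in
                      q ℚ.+ d , subst (Lower x) (sym (+-−-cancel q d)) l
  ; upper-inhabited = let (q , u) = upper-inhabited x in
                      q ℚ.+ d , subst (Upper x) (sym (+-−-cancel q d)) u
  ; lower-closed    = λ q<r → lower-closed x (minus q<r)
  ; upper-closed    = λ q<r → upper-closed x (minus q<r)
  ; lower-open      = λ {q} l → let (r , q-d<r , l′) = lower-open x l in
                      r ℚ.+ d
                      , subst (ℚ._< r ℚ.+ d) (−-+-cancel q d) (ℚₚ.+-monoˡ-< d q-d<r)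
                      , subst (Lower x) (sym (+-−-cancel r d)) l′
  ; upper-open      = λ {r} u → let (q , q<r-d , u′) = upper-open x u in
                      q ℚ.+ d
                      , subst (q ℚ.+ d ℚ.<_) (−-+-cancel r d) (ℚₚ.+-monoˡ-< d q<r-d)
                      , subst (Upper x) (sym (+-−-cancel q d)) u′
  ; disjoint        = disjoint x
  ; located         = λ q<r → located x (minus q<r)
  }
  where
  minus : ∀ {q r} → q ℚ.< r → q ℚ.- d ℚ.< r ℚ.- d
  minus = ℚₚ.+-monoˡ-< (ℚ.- d)

record Graph (n : ℕ) : Set₁ where
  field
    Adj        : Rel (Fin n) 0ℓ
    adj?       : Decidable Adj
    symmetric  : Symmetric Adj
    loopless   : ∀ {v} → ¬ Adj v v

open Graph public

degree : Graph n → Fin n → ℕ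
degree {n} G v = length (filter (adj? G v) (allFin n))

MaxDegree≤ : ℕ → Graph n → Set
MaxDegree≤ d G = ∀ v → degree G v ℕ.≤ d

IsPath : Graph n → List (Fin n) → Set
IsPath G vs = Linked (Adj G) vs × Unique vs

Connected : Graph n → Set
Connected G = ∀ v w → Star (Adj G) v w

-- A cycle is a path on at least three vertices whose ends are adjacent.
IsForest : Graph n → Set
IsForest G = ∀ u v vs w → IsPath G (u ∷ v ∷ vs ++ [ w ]) → ¬ Adj G w u

IsTree : Graph n → Set
IsTree {n} G = 0 ℕ.< n × Connected G × IsForest G

-- F, a graph on its own vertex set Fin k, is identified by `embed` with a
-- (not necessarily spanning or induced) subgraph of G.
record Subgraph (F : Graph k) (G : Graph n) : Set where
  field
    embed           : Fin k → Fin n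
    embed-injective : Injective _≡_ _≡_ embed
    embed-adj       : ∀ {i j} → Adj F i j → Adj G (embed i) (embed j)

open Subgraph public

EdgeOf : {F : Graph k} {G : Graph n} → Subgraph F G → Fin n → Fin n → Set
EdgeOf {F = F} S v w = ∃[ i ] ∃[ j ] (embed S i ≡ v × embed S j ≡ w × Adj F i j)

-- H is (a copy of) the connected component of G containing v.
record IsComponent (H : Graph k) (G : Graph n) (v : Fin n) : Set where
  field
    subgraph : Subgraph H G
    induced  : ∀ {i j} → Adj G (embed subgraph i) (embed subgraph j) → Adj H i j
    vertices : ∀ w → (∃[ i ] embed subgraph i ≡ w) ⇔ Star (Adj G) v w

IsCaterpillar : Graph n → Set
IsCaterpillar G =
  IsTree G ×
  ∃[ p ] ∃[ ps ] (IsPath G (p ∷ ps) × (∀ v → 1 ℕ.< degree G v → v ∈ p ∷ ps))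

Consecutive : {A : Set} → A → A → List A → Set
Consecutive a b xs = ∃[ ys ] ∃[ zs ] xs ≡ ys ++ a ∷ b ∷ zs

-- G arises from C by replacing each edge uv by the path
--   branch u , inner u v , branch v,
-- where the new vertices `inner u v` are distinct from each other, from the old
-- vertices and from the new vertices of other edges. The values of `inner` at
-- non-adjacent pairs are irrelevant; an edge with no inner vertices is kept.
record IsSubdivision (C : Graph m) (G : Graph n) : Set where
  field
    branch           : Fin m → Fin n
    inner            : Fin m → Fin m → List (Fin n)
    branch-injective : Injective _≡_ _≡_ branch
    inner-reverse    : ∀ {u v} → Adj C u v → inner v u ≡ reverse (inner u v)
    inner-unique     : ∀ {u v} → Adj C u v → Unique (inner u v)
    inner-new        : ∀ {u v} → Adj C u v → ∀ x → branch x ∉ inner u v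
    inner-disjoint   : ∀ {u v x y} → Adj C u v → Adj C x y →
                       ∀ {a} → a ∈ inner u v → a ∈ inner x y →
                       (u ≡ x × v ≡ y) ⊎ (u ≡ y × v ≡ x)
    vertices         : ∀ a → (∃[ u ] a ≡ branch u) ⊎
                             (∃[ u ] ∃[ v ] (Adj C u v × a ∈ inner u v))
    edges            : ∀ a b → Adj G a b ⇔
                       (∃[ u ] ∃[ v ] (Adj C u v ×
                         Consecutive a b (branch u ∷ inner u v ++ [ branch v ])))

IsSubdividedCaterpillar : Graph n → Set₁
IsSubdividedCaterpillar G =
  IsTree G × ∃[ m ] Σ[ C ∈ Graph m ] (IsCaterpillar C × IsSubdivision C G)

IsSubdividedCaterpillarForest : Graph n → Set₁
IsSubdividedCaterpillarForest F =
  IsForest F ×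
  (∀ v → ∃[ k ] Σ[ H ∈ Graph k ] (IsComponent H F v × IsSubdividedCaterpillar H))

IsUnionOfTwo : (∀ {k} → Graph k → Set₁) → Graph n → Set₁
IsUnionOfTwo P G =
  ∃[ k₁ ] Σ[ F₁ ∈ Graph k₁ ] ∃[ k₂ ] Σ[ F₂ ∈ Graph k₂ ]
  Σ[ S₁ ∈ Subgraph F₁ G ] Σ[ S₂ ∈ Subgraph F₂ G ]
    (P F₁ × P F₂ × (∀ v w → Adj G v w → EdgeOf S₁ v w ⊎ EdgeOf S₂ v w))

Point : Set₁
Point = ℝ × ℝ

-- The lower left corners of the unit squares S_v.
Squares : ℕ → Set₁
Squares n = Fin n → Point

module _ (S : Squares n) where

  left right bottom top : Fin n → ℝ
  left   v = proj₁ (S v)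
  right  v = left v +ℚ 1ℚ
  bottom v = proj₂ (S v)
  top    v = bottom v +ℚ 1ℚ

  Interior : Fin n → Point → Set
  Interior v (x , y) = (left v < x × x < right v) × (bottom v < y × y < top v)

  DisjointInteriors : Set₁
  DisjointInteriors = ∀ v w → v ≢ w → ∀ p → Interior v p → ¬ Interior w p

  -- For squares v and w that meet a common horizontal line, the points of that
  -- line with these abscissae form its (closed) part between the two squares.
  Between : Fin n → Fin n → ℝ → Set
  Between v w x = (right v ≤ x × x ≤ left w) ⊎ (right w ≤ x × x ≤ left v)

  HorizontalBand : Fin n → Fin n → Set₁
  HorizontalBand v w =
    ∃[ a ] ∃[ b ] (a < b × (∀ y → a < y → y < b →
      (∃[ x ] Interior v (x , y)) ×
      (∃[ x ] Interior w (x , y)) ×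
      (∀ u → u ≢ v → u ≢ w → ∀ x → Between v w x → ¬ Interior u (x , y))))

VerticalBand : Squares n → Fin n → Fin n → Set₁
VerticalBand S = HorizontalBand (swap ∘ S)

IsURVG : Graph n → Set₁
IsURVG {n} G =
  Σ[ S ∈ Squares n ] (DisjointInteriors S ×
    (∀ v w → v ≢ w → Adj G v w ⇔ (HorizontalBand S v w ⊎ VerticalBand S v w)))

{-# OPTIONS --safe #-}
-- Both properties of T amount to covering its edges by two forests G₁, G₂ in which every vertex has at most
-- three neighbours and every vertex of degree three begins a bare branch, i.e. a branch that is a path.
--
-- From squares: in the horizontal visibility graph a vertex has at most one neighbour above and at most one below
-- its own level, since the squares on a common line are joined by a walk and a second such neighbour closes a
-- cycle. Likewise a level neighbour is the only neighbour on its side. So a vertex of degree three has one level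
-- branch, which never leaves its level.
--
-- To squares: rooting each component of G₁ at a vertex of degree three, if any, exhibits it as a comb, a spine
-- with one tail at each vertex. It is drawn with the spine rising by half a unit per step and zigzagging between
-- two columns, tails pointing outwards at constant height. Distinct components get disjoint ranges of heights,
-- numbered so that the order within the components of G₂ is respected, which is possible because T is a tree.
module Submission where

open import Defs
open import Data.Bool.Base using (Bool; true; false; T; not; if_then_else_)
open import Data.Bool.Properties using (T?)
open import Data.Empty using (⊥; ⊥-elim)
open import Data.Fin.Base using (Fin; zero; suc; toℕ; fromℕ<; combine; remQuot)
open import Data.Fin.Properties using (_≟_; all?; any?; suc-injective; toℕ-injective; toℕ<n; remQuot-combine)
open import Data.Fin.Subset using (Subset)
open import Data.Fin.Subset.Properties using (anySubset?)
import Data.Integer.Base as ℤ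
open import Data.List.Base as List using (List; []; _∷_; [_]; _++_; length; filter; reverse; allFin)
import Data.List.Membership.DecPropositional as DecMembership
open import Data.List.Membership.Propositional using (_∈_; _∉_)
import Data.List.Membership.Propositional.Properties as Mem
import Data.List.Properties as Listₚ
open import Data.List.Relation.Unary.All as All using (All; []; _∷_)
import Data.List.Relation.Unary.All.Properties as All
open import Data.List.Relation.Unary.AllPairs using ([]; _∷_)
open import Data.List.Relation.Unary.Any as Any using (here; there)
import Data.List.Relation.Unary.Any.Properties as Any
open import Data.List.Relation.Unary.Linked using (Linked; []; [-]; _∷_)
import Data.List.Relation.Unary.Linked.Properties as Linkedₚ
open import Data.List.Relation.Unary.Unique.Propositional using (Unique)
import Data.List.Relation.Unary.Unique.Propositional.Properties as Unique
open import Data.Nat.Base as ℕ using (ℕ; zero; suc; z≤n; s≤s)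
import Data.Nat.Properties as ℕₚ
open import Data.Product.Base using (Σ-syntax; ∃-syntax; _×_; _,_; proj₁; proj₂; swap)
open import Data.Rational.Base as ℚ using (ℚ; 1ℚ)
import Data.Rational.Properties as ℚₚ
open import Data.Sum.Base as Sum using (_⊎_; inj₁; inj₂; [_,_]′)
open import Data.Unit.Base using (tt)
open import Data.Vec.Base using (lookup; tabulate)
open import Data.Vec.Properties using (lookup∘tabulate)
open import Function.Base using (_∘_; id; case_of_; flip)
open import Function.Bundles using (_⇔_; mk⇔; Equivalence)
open import Function.Definitions using (Injective)
open import Level using (0ℓ)
open import Relation.Binary.Construct.Closure.ReflexiveTransitive as Star using (Star; ε; _◅_; _◅◅_)
open import Relation.Binary.Core using (Rel)
open import Relation.Binary.Definitions using (Symmetric; Decidable; tri<; tri≈; tri>)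
open import Relation.Binary.PropositionalEquality using (_≡_; _≢_; refl; sym; trans; cong; cong₂; subst; ≢-sym)
open import Relation.Nullary using (¬_; Dec; yes; no; contradiction)
open import Relation.Nullary.Decidable using (_×-dec_; _⊎-dec_; _→-dec_; ¬?; decidable-stable; does; dec-true; dec-false; map′; True; isYes; toWitness; fromWitness; ¬¬-excluded-middle)
open import Data.List.Extrema ℕₚ.≤-totalOrder using (argmin; argmax; argmin-all; argmax-all; f[argmin]≤f[xs]; f[xs]≤f[argmax])

-- Simple paths

-- The descriptions of the forests are matched through `Cert`, where bareness is an arbitrary
-- relation with two closure properties. This form passes to subgraphs and images, and for decidable
-- relations it can be checked by finite search. The search matters because reals are Dedekind cuts,
-- so that squares yield walks and splittings only under double negation. A comb serves twice: it is
-- drawn in the plane, and contracting its tails shows that it is a subdivided caterpillar.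
--
-- In the drawing a vertex takes its height from its place in `G₁` and its abscissa from its place
-- in `G₂`; the two drawings interact only through the order of components. Opposite tails are
-- forced: consecutive spine squares overlap in height, so two tails on one side would get into each
-- other's way. Edges common to both forests are first removed from `G₂`. Every component of `G₁`
-- except the one at the root of `T` is then entered from the root along exactly one edge, an edge
-- of `G₂`, and this edge alone prescribes its side, so that no conflict can arise.

data Path {n : ℕ} (R : Rel (Fin n) 0ℓ) : Fin n → Fin n → List (Fin n) → Set where
  [] : ∀ {v} → Path R v v (v ∷ [])
  _∷⟨_⟩_ : ∀ {v u w xs} → R v u → v ∉ xs → Path R u w xs → Path R v w (v ∷ xs)

module _ {n : ℕ} {R : Rel (Fin n) 0ℓ} where

  path-suffix : ∀ {u v w xs} → v ∈ xs → Path R u w xs → ∃[ ys ] Path R v w ys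
  path-suffix (here refl) []            = _ , []
  path-suffix (here refl) (e ∷⟨ v∉ ⟩ p) = _ , (e ∷⟨ v∉ ⟩ p)
  path-suffix (there ∈xs) (e ∷⟨ _ ⟩ p)  = path-suffix ∈xs p

  path-head : ∀ {v w xs} → Path R v w xs → ∃[ ys ] xs ≡ v ∷ ys
  path-head []            = _ , refl
  path-head (_ ∷⟨ _ ⟩ _)  = _ , refl

  path-last : ∀ {v w xs} → Path R v w xs → ∃[ ys ] xs ≡ ys ++ [ w ]
  path-last [] = [] , refl
  path-last (_ ∷⟨ _ ⟩ p) with path-last p
  ... | ys , refl = _ ∷ ys , refl

  target∈path : ∀ {v w xs} → Path R v w xs → w ∈ xs
  target∈path []           = here refl
  target∈path (_ ∷⟨ _ ⟩ p) = there (target∈path p)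

  walk⇒path : ∀ {v w} → Star R v w → ∃[ xs ] Path R v w xs
  walk⇒path ε = _ , []
  walk⇒path {v} (e ◅ es) with walk⇒path es
  ... | xs , p with DecMembership._∈?_ _≟_ v xs
  ...   | yes v∈xs = path-suffix v∈xs p
  ...   | no  v∉xs = _ , (e ∷⟨ v∉xs ⟩ p)

  path⇒walk : ∀ {v w xs} → Path R v w xs → Star (λ a b → R a b × a ∈ xs × b ∈ xs) v w
  path⇒walk [] = ε
  path⇒walk (e ∷⟨ _ ⟩ p) with path-head p
  ... | ys , refl = (e , here refl , there (here refl)) ◅
    Star.map (λ (r , a , b) → r , there a , there b) (path⇒walk p)

  path⇒linked : ∀ {v w xs} → Path R v w xs → Linked R xs
  path⇒linked [] = [-]
  path⇒linked (e ∷⟨ _ ⟩ p) with path-head p | path⇒linked p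
  ... | ys , refl | l = e ∷ l

  path⇒unique : ∀ {v w xs} → Path R v w xs → Unique xs
  path⇒unique [] = [] ∷ []
  path⇒unique (_ ∷⟨ v∉xs ⟩ p) = All.¬Any⇒All¬ _ v∉xs ∷ path⇒unique p

linked-map : ∀ {A : Set} {R S : Rel A 0ℓ} → (∀ {a b} → R a b → S a b) → ∀ {xs} → Linked R xs → Linked S xs
linked-map f []      = []
linked-map f [-]     = [-]
linked-map f (e ∷ l) = f e ∷ linked-map f l

module _ {n : ℕ} (G : Graph n) where

  Avoid : Fin n → Fin n → Rel (Fin n) 0ℓ
  Avoid v w a b = Adj G a b × ¬ (a ≡ v × b ≡ w) × ¬ (a ≡ w × b ≡ v)

  adj⇒≢ : ∀ {v w} → Adj G v w → v ≢ w
  adj⇒≢ e refl = loopless G e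

  avoid-sym : ∀ {v w} → Symmetric (Avoid v w)
  avoid-sym (e , p , q) = symmetric G e , (λ (a , b) → q (b , a)) , (λ (a , b) → p (b , a))

  -- A walk around the edge shortens to a path; this path is not the edge itself, so the edge closes
  -- it to a cycle.
  edge-is-bridge : IsForest G → ∀ {v w} → Adj G v w → ¬ Star (Avoid v w) v w
  edge-is-bridge forest {v} {w} v~w walk with walk⇒path walk
  ... | _ , [] = loopless G v~w
  ... | _ , ((_ , v↛w , _) ∷⟨ _ ⟩ []) = v↛w (refl , refl)
  ... | _ , p@(_ ∷⟨ _ ⟩ q@(_ ∷⟨ _ ⟩ r)) with path-last r
  ...   | ys , refl = forest v _ ys w (linked-map proj₁ (path⇒linked p) , path⇒unique p) (symmetric G v~w)

  avoiding-walk : ∀ {v a w xs} → v ∉ xs → Path (Adj G) a w xs → ∀ z → Star (Avoid v z) a w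
  avoiding-walk v∉xs p z = Star.map
    (λ (e , a∈ , b∈) → e , (λ { (refl , _) → v∉xs a∈ }) , (λ { (_ , refl) → v∉xs b∈ })) (path⇒walk p)

  -- If the first steps to `a` and `b` differ, then stepping to `b`, following one path and
  -- returning along the other reaches `a` without the edge to `a`: neither remainder visits `v`
  -- again.
  path-unique : IsForest G → ∀ {v w xs ys} → Path (Adj G) v w xs → Path (Adj G) v w ys → xs ≡ ys
  path-unique _ [] [] = refl
  path-unique _ [] (_ ∷⟨ v∉p ⟩ q) = contradiction (target∈path q) v∉p
  path-unique _ (_ ∷⟨ v∉p ⟩ p) [] = contradiction (target∈path p) v∉p
  path-unique forest {v} (_∷⟨_⟩_ {u = a} e v∉p p) (_∷⟨_⟩_ {u = b} e′ v∉q q) with a ≟ b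
  ... | yes refl = cong (v ∷_) (path-unique forest p q)
  ... | no a≢b = ⊥-elim (edge-is-bridge forest e
          ((e′ , (λ { (_ , refl) → a≢b refl }) , (λ { (refl , _) → loopless G e })) ◅
           avoiding-walk v∉q q a ◅◅ Star.reverse avoid-sym (avoiding-walk v∉p p a)))

-- Rooted forests

-- Membership in a component becomes an equation between values of `rep` and thereby decidable.
record Representatives {n : ℕ} (G : Graph n) : Set where
  field
    rep      : Fin n → Fin n
    rep-adj  : ∀ {v w} → Adj G v w → rep v ≡ rep w
    rep-walk : ∀ v → Star (Adj G) v (rep v)

  rep-star : ∀ {v w} → Star (Adj G) v w → rep v ≡ rep w
  rep-star ε        = refl
  rep-star (e ◅ es) = trans (rep-adj e) (rep-star es)

  same-rep⇒walk : ∀ {v w} → rep v ≡ rep w → Star (Adj G) v w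
  same-rep⇒walk {v} {w} eq =
    rep-walk v ◅◅ subst (λ r → Star (Adj G) r w) (sym eq) (Star.reverse (symmetric G) (rep-walk w))

record Rooting {n : ℕ} (G : Graph n) : Set where
  field
    reps    : Representatives G
    parent  : Fin n → Fin n
    depth   : Fin n → ℕ

  open Representatives reps public

  field
    adj-parent  : ∀ {v w} → Adj G v w → (parent w ≡ v × depth w ≡ suc (depth v)) ⊎
                                        (parent v ≡ w × depth v ≡ suc (depth w))
    parent-adj  : ∀ {v k} → depth v ≡ suc k → Adj G (parent v) v × depth (parent v) ≡ k
    depth-zero  : ∀ {v} → depth v ≡ 0 → rep v ≡ v

  parent-rep : ∀ {v k} → depth v ≡ suc k → rep (parent v) ≡ rep v
  parent-rep eq = rep-adj (proj₁ (parent-adj eq))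

module _ {n : ℕ} {G : Graph n} (forest : IsForest G) (reps : Representatives G) where

  open Representatives reps

  private
    route : Fin n → List (Fin n)
    route v = proj₁ (walk⇒path (rep-walk v))

    route-path : ∀ v → Path (Adj G) v (rep v) (route v)
    route-path v = proj₂ (walk⇒path (rep-walk v))

    second : Fin n → List (Fin n) → Fin n
    second v (_ ∷ x ∷ _) = x
    -- A representative becomes its own parent; only depth 0 tells it apart.
    second v _           = v

    par : Fin n → Fin n
    par v = second v (route v)

    dep : Fin n → ℕ
    dep v = ℕ.pred (length (route v))

    route-unique : ∀ {v xs} → Path (Adj G) v (rep v) xs → route v ≡ xs
    route-unique = path-unique G forest (route-path _)

    extend : ∀ {v w} → Adj G v w → route w ≡ w ∷ route v → par w ≡ v × dep w ≡ suc (dep v)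
    extend {v} {w} e eq rewrite eq with route v | path-head (route-path v)
    ... | _ | _ , refl = refl , refl

    suffix-route : ∀ {v w r xs} → Path (Adj G) v r xs → w ∈ xs → v ≢ w →
                   ∃[ ys ] (Path (Adj G) w r ys × v ∉ ys)
    suffix-route [] (here refl) v≢w = contradiction refl v≢w
    suffix-route (_ ∷⟨ _ ⟩ _) (here refl) v≢w = contradiction refl v≢w
    suffix-route {v} {w} (_ ∷⟨ v∉ ⟩ p) (there w∈) _ = go v∉ p w∈
      where
      go : ∀ {u r xs} → v ∉ xs → Path (Adj G) u r xs → w ∈ xs → ∃[ ys ] (Path (Adj G) w r ys × v ∉ ys)
      go v∉ [] (here refl) = _ , [] , v∉
      go v∉ p@(_ ∷⟨ _ ⟩ _) (here refl) = _ , p , v∉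
      go v∉ (_ ∷⟨ _ ⟩ p) (there w∈) = go (v∉ ∘ there) p w∈

    -- Either `w` is off the route of `v` and can be put in front of it, or the part of that route
    -- from `w` on misses `v`, which can be put in front of that part. Uniqueness of paths
    -- identifies the result with the chosen route.
    adj-route : ∀ {v w} → Adj G v w → route w ≡ w ∷ route v ⊎ route v ≡ v ∷ route w
    adj-route {v} {w} e with DecMembership._∈?_ _≟_ w (route v)
    ... | no w∉ = inj₁ (route-unique (symmetric G e ∷⟨ w∉ ⟩
                    subst (λ r → Path (Adj G) v r (route v)) (rep-adj e) (route-path v)))
    ... | yes w∈ with suffix-route (route-path v) w∈ (adj⇒≢ G e)
    ...   | ys , p , v∉ = inj₂ (trans (route-unique (e ∷⟨ v∉ ⟩ p))
              (cong (v ∷_) (sym (route-unique (subst (λ r → Path (Adj G) w r ys) (rep-adj e) p)))))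

    adj-par : ∀ {v w} → Adj G v w → (par w ≡ v × dep w ≡ suc (dep v)) ⊎ (par v ≡ w × dep v ≡ suc (dep w))
    adj-par e with adj-route e
    ... | inj₁ eq = inj₁ (extend e eq)
    ... | inj₂ eq = inj₂ (extend (symmetric G e) eq)

    par-edge : ∀ {v r xs} → Path (Adj G) v r xs → ∀ {k} → ℕ.pred (length xs) ≡ suc k →
               Adj G (second v xs) v
    par-edge (e ∷⟨ _ ⟩ p) eq with path-head p
    ... | _ , refl = symmetric G e

    second-repeats : ∀ {v r xs k} → ℕ.pred (length xs) ≡ suc k → Path (Adj G) v r xs →
                     ¬ Unique (second v xs ∷ xs)
    second-repeats eq (_ ∷⟨ _ ⟩ p) u with path-head p
    second-repeats eq (_ ∷⟨ _ ⟩ p) ((_ ∷ h ∷ _) ∷ _) | _ , refl = h refl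

    par-adj : ∀ {v k} → dep v ≡ suc k → Adj G (par v) v × dep (par v) ≡ k
    par-adj {v} {k} eq with par-edge (route-path v) eq
    ... | e with adj-route e
    ...   | inj₁ r = e , ℕₚ.suc-injective (trans (sym (proj₂ (extend e r))) eq)
    -- Here the route of the parent would run through `v` and hence meet the parent twice.
    ...   | inj₂ r = contradiction (subst Unique r (path⇒unique (route-path _)))
                       (second-repeats eq (route-path v))

    dep-zero : ∀ {v r xs} → Path (Adj G) v r xs → ℕ.pred (length xs) ≡ 0 → r ≡ v
    dep-zero [] _ = refl
    dep-zero (_ ∷⟨ _ ⟩ q) eq with path-head q
    dep-zero (_ ∷⟨ _ ⟩ q) () | _ , refl

  rooting : Rooting G
  rooting = record
    { reps = reps ; parent = par ; depth = dep ; adj-parent = adj-par ; parent-adj = par-adj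
    ; depth-zero = λ {v} → dep-zero (route-path v) }

-- Combs

0≢suc : ∀ {i j} → i ≡ 0 → i ≢ suc j
0≢suc refl ()

-- Bare v w stands for the statement that the branch at v through w is a path; only these properties are used.
record Cert {n : ℕ} (G : Graph n) (Bare : Rel (Fin n) 0ℓ) : Set where
  field
    no-four     : ∀ {v a b c d} → Adj G v a → Adj G v b → Adj G v c → Adj G v d →
                  a ≢ b → a ≢ c → a ≢ d → b ≢ c → b ≢ d → c ≢ d → ⊥
    bare-branch : ∀ {v a b c} → Adj G v a → Adj G v b → Adj G v c → a ≢ b → a ≢ c → b ≢ c →
                  Bare v a ⊎ Bare v b ⊎ Bare v c
    bare-next   : ∀ {v w z} → Bare v w → Adj G w z → z ≢ v → Bare w z
    bare-unique : ∀ {v w z z′} → Bare v w → Adj G w z → Adj G w z′ → z ≢ v → z′ ≢ v → z ≡ z′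

-- A vertex has coordinates: its position along the spine and its distance dep from the spine along a tail.
data Step {n : ℕ} (pos dep : Fin n → ℕ) (v w : Fin n) : Set where
  forth : dep v ≡ 0 → dep w ≡ 0 → pos w ≡ suc (pos v) → Step pos dep v w
  back  : dep v ≡ 0 → dep w ≡ 0 → pos v ≡ suc (pos w) → Step pos dep v w
  rise  : pos w ≡ pos v → dep w ≡ suc (dep v) → Step pos dep v w
  fall  : pos w ≡ pos v → dep v ≡ suc (dep w) → Step pos dep v w

-- A homomorphism to the infinite comb on pairs of naturals, injective around each vertex. By
-- `lower` tails reach down to the spine, so that every component contains spine vertices.
record Comb {n : ℕ} (G : Graph n) : Set where
  field
    pos dep           : Fin n → ℕ
    step              : ∀ {v w} → Adj G v w → Step pos dep v w
    locally-injective : ∀ {v w w′} → Adj G v w → Adj G v w′ → pos w ≡ pos w′ → dep w ≡ dep w′ → w ≡ w′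
    lower             : ∀ {v e} → dep v ≡ suc e → ∃[ w ] (Adj G v w × pos w ≡ pos v × dep w ≡ e)

step-sym : ∀ {n} {pos dep : Fin n → ℕ} {v w} → Step pos dep v w → Step pos dep w v
step-sym (forth a b c) = back b a c
step-sym (back a b c)  = forth b a c
step-sym (rise a b)    = fall (sym a) b
step-sym (fall a b)    = rise (sym a) b

upper-bound : ∀ {n} (f : Fin n → ℕ) → ∃[ N ] (∀ v → f v ℕ.≤ N)
upper-bound {zero}  f = 0 , λ ()
upper-bound {suc n} f with upper-bound (f ∘ suc)
... | N , bound = f zero ℕ.⊔ N ,
  λ { zero → ℕₚ.m≤m⊔n (f zero) N ; (suc v) → ℕₚ.≤-trans (bound v) (ℕₚ.m≤n⊔m (f zero) N) }

Branching : ∀ {n} → Graph n → Fin n → Set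
Branching G v = ∃[ a ] ∃[ b ] ∃[ c ] (Adj G v a × Adj G v b × Adj G v c × a ≢ b × a ≢ c × b ≢ c)

branching? : ∀ {n} (G : Graph n) v → Dec (Branching G v)
branching? G v = any? λ a → any? λ b → any? λ c →
  adj? G v a ×-dec adj? G v b ×-dec adj? G v c ×-dec ¬? (a ≟ b) ×-dec ¬? (a ≟ c) ×-dec ¬? (b ≟ c)

module _ {n : ℕ} {G : Graph n} (reps : Representatives G) where

  open Representatives reps

  private
    preferred : Fin n → Fin n
    preferred r with any? (λ z → rep z ≟ r ×-dec branching? G z)
    ... | yes (z , _) = z
    ... | no _        = r

    preferred-walk : ∀ v → Star (Adj G) v (preferred (rep v))
    preferred-walk v with any? (λ z → rep z ≟ rep v ×-dec branching? G z)
    ... | yes (z , eq , _) = same-rep⇒walk (sym eq)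
    ... | no _             = rep-walk v

    preferred-branching : ∀ v → Branching G v → Branching G (preferred (rep v))
    preferred-branching v br with any? (λ z → rep z ≟ rep v ×-dec branching? G z)
    ... | yes (_ , _ , br′) = br′
    ... | no ¬br            = contradiction (v , refl , br) ¬br

  -- Such a root orients the bare branches: at any other branching vertex the branch towards the
  -- root runs into a branching vertex and so is not bare, whence the tail always leads to a child.
  branching-representatives : Σ[ R ∈ Representatives G ]
                              (∀ v → Branching G v → Branching G (Representatives.rep R v))
  branching-representatives = record
    { rep = preferred ∘ rep ; rep-adj = cong preferred ∘ rep-adj ; rep-walk = preferred-walk } ,
    preferred-branching

module _ {n : ℕ} {G : Graph n} {Bare : Rel (Fin n) 0ℓ} (cert : Cert G Bare) where

  open Cert cert

  bare⇒¬branching : ∀ {v w} → Bare v w → ¬ Branching G w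
  bare⇒¬branching {v} vw (a , b , c , ~a , ~b , ~c , a≢b , a≢c , b≢c) with a ≟ v | b ≟ v
  ... | yes refl | _        = b≢c (bare-unique vw ~b ~c (≢-sym a≢b) (≢-sym a≢c))
  ... | no a≢v   | yes refl = a≢c (bare-unique vw ~a ~c a≢v (≢-sym b≢c))
  ... | no a≢v   | no b≢v   = a≢b (bare-unique vw ~a ~b a≢v b≢v)

  private
    bare-nbr : ∀ {v} → Branching G v → ∃[ w ] (Adj G v w × Bare v w)
    bare-nbr (a , b , c , ~a , ~b , ~c , a≢b , a≢c , b≢c) with bare-branch ~a ~b ~c a≢b a≢c b≢c
    ... | inj₁ B        = a , ~a , B
    ... | inj₂ (inj₁ B) = b , ~b , B
    ... | inj₂ (inj₂ B) = c , ~c , B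

    -- v itself serves as a default, as it is not its own neighbour
    tail-child : Fin n → Fin n
    tail-child v with branching? G v
    ... | yes br = proj₁ (bare-nbr br)
    ... | no _   = v

    tail-child-bare : ∀ {v} → Adj G v (tail-child v) → Bare v (tail-child v)
    tail-child-bare {v} e with branching? G v
    ... | yes br = proj₂ (proj₂ (bare-nbr br))
    ... | no _   = contradiction e (loopless G)

    tail-child-adj : ∀ {v} → Branching G v → Adj G v (tail-child v)
    tail-child-adj {v} br with branching? G v
    ... | yes br′ = proj₁ (proj₂ (bare-nbr br′))
    ... | no ¬br  = contradiction br ¬br

    -- Three neighbours make `v` branching, so its tail exists and would be a fourth neighbour.
    three-others : ∀ {v a b c} → Adj G v a → Adj G v b → Adj G v c → a ≢ b → a ≢ c → b ≢ c →
                   tail-child v ≢ a → tail-child v ≢ b → tail-child v ≢ c → ⊥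
    three-others ~a ~b ~c a≢b a≢c b≢c ≢a ≢b ≢c =
      no-four (tail-child-adj (_ , _ , _ , ~a , ~b , ~c , a≢b , a≢c , b≢c)) ~a ~b ~c ≢a ≢b ≢c a≢b a≢c b≢c

  -- The spine passes through a root in both directions: among the children
  -- of the root other than the tail, the least one goes forward, the other backward.
  module _ (R : Rooting G) (branching-root : ∀ v → Branching G v → Branching G (Rooting.rep R v)) where

    open Rooting R

    private
      -- The root is put at position `N`, beyond every depth, so that no spine running backward is
      -- stopped by `pred` at zero.
      N : ℕ
      N = suc (proj₁ (upper-bound depth))

      depth<N : ∀ v → depth v ℕ.< N
      depth<N v = s≤s (proj₂ (upper-bound depth) v)

      -- Neighbours stand for children here, since only the root consults this relation.
      Later : Fin n → Fin n → Set
      Later p v = ∃[ y ] (Adj G p y × tail-child p ≢ y × toℕ y ℕ.< toℕ v)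

      later? : ∀ p v → Dec (Later p v)
      later? p v = any? λ y → adj? G p y ×-dec ¬? (tail-child p ≟ y) ×-dec (toℕ y ℕₚ.<? toℕ v)

      data Direction : Set where
        fwd bwd : Direction

      shift : Direction → ℕ → ℕ
      shift fwd i = suc i
      shift bwd i = ℕ.pred i

      turn : ℕ → Fin n → Fin n → Direction → Direction
      turn (suc _) p v s = s
      turn zero    p v s with later? p v
      ... | yes _ = bwd
      ... | no _  = fwd

      next : ℕ → Fin n → Fin n → ℕ × ℕ × Direction → ℕ × ℕ × Direction
      next k p v (i , suc e , s) = i , suc (suc e) , s
      next k p v (i , zero , s) with tail-child p ≟ v
      ... | yes _ = i , 1 , s
      ... | no _  = shift (turn k p v s) i , 0 , turn k p v s

      label : ℕ → Fin n → ℕ × ℕ × Direction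
      label zero    v = N , 0 , fwd
      label (suc k) v = next k (parent v) v (label k (parent v))

      pos′ dep′ : Fin n → ℕ
      pos′ v = proj₁ (label (depth v) v)
      dep′ v = proj₁ (proj₂ (label (depth v) v))

      dir : Fin n → Direction
      dir v = proj₂ (proj₂ (label (depth v) v))

      -- The label of a vertex relative to that of its parent. The two implications keep the root,
      -- which compares its children, and the later spine vertices, which inherit their direction,
      -- in one constructor.
      data Child (p v : Fin n) : Set where
        tail⁺    : ∀ {e} → dep′ p ≡ suc e → pos′ v ≡ pos′ p → dep′ v ≡ suc (dep′ p) → Child p v
        tail₁    : dep′ p ≡ 0 → tail-child p ≡ v → pos′ v ≡ pos′ p → dep′ v ≡ 1 → Child p v
        forward  : dep′ p ≡ 0 → tail-child p ≢ v → dep′ v ≡ 0 → pos′ v ≡ suc (pos′ p) →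
                   (depth p ≡ 0 → ¬ Later p v) → (∀ {k} → depth p ≡ suc k → dir p ≡ fwd) → dir v ≡ fwd → Child p v
        backward : dep′ p ≡ 0 → tail-child p ≢ v → dep′ v ≡ 0 → pos′ p ≡ suc (pos′ v) →
                   (depth p ≡ 0 → Later p v) → (∀ {k} → depth p ≡ suc k → dir p ≡ bwd) → dir v ≡ bwd → Child p v

      label-suc : ∀ {v k} → depth v ≡ suc k →
                  label (depth v) v ≡ next k (parent v) v (label (depth (parent v)) (parent v))
      label-suc {v} eq rewrite eq | proj₂ (parent-adj eq) = refl

      -- Each generation lowers the position by at most one. As depths stay below `N`, positions
      -- stay positive and `pred` is exact.
      pos-bound : ∀ k {v} → depth v ≡ k → N ℕ.≤ k ℕ.+ pos′ v
      pos-bound zero eq rewrite eq = ℕₚ.≤-refl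
      pos-bound (suc k) {v} eq rewrite label-suc eq with pos-bound k (proj₂ (parent-adj eq))
      ... | ih with label (depth (parent v)) (parent v)
      ...   | i , suc e , s = ℕₚ.m≤n⇒m≤1+n ih
      ...   | i , zero , s with tail-child (parent v) ≟ v
      ...     | yes _ = ℕₚ.m≤n⇒m≤1+n ih
      ...     | no _ with turn k (parent v) v s
      ...       | fwd = ℕₚ.≤-trans ih (ℕₚ.≤-trans (ℕₚ.+-monoʳ-≤ k (ℕₚ.n≤1+n i)) (ℕₚ.n≤1+n _))
      ...       | bwd = ℕₚ.≤-trans ih (ℕₚ.≤-trans (ℕₚ.+-monoʳ-≤ k (pred-bound i)) (ℕₚ.≤-reflexive (ℕₚ.+-suc k _)))
        where
        pred-bound : ∀ i → i ℕ.≤ suc (ℕ.pred i)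
        pred-bound zero    = z≤n
        pred-bound (suc i) = ℕₚ.≤-refl

      pos-positive : ∀ v → ∃[ i ] pos′ v ≡ suc i
      pos-positive v with pos′ v in eq | pos-bound (depth v) {v} refl
      ... | suc i | _ = i , refl
      ... | zero  | b = contradiction (ℕₚ.<-≤-trans (depth<N v)
                          (ℕₚ.≤-trans b (ℕₚ.≤-reflexive (ℕₚ.+-identityʳ _)))) (ℕₚ.<-irrefl refl)

      turn-suc : ∀ {k m p v s} → k ≡ suc m → turn k p v s ≡ s
      turn-suc refl = refl

      turn-fwd : ∀ {k p v s} → turn k p v s ≡ fwd → k ≡ 0 → ¬ Later p v
      turn-fwd {p = p} {v} eq refl l with later? p v
      turn-fwd {p = p} {v} () refl l | yes _
      ... | no ¬l = ¬l l

      turn-bwd : ∀ {k p v s} → turn k p v s ≡ bwd → k ≡ 0 → Later p v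
      turn-bwd {p = p} {v} eq refl with later? p v
      ... | yes l = l
      turn-bwd {p = p} {v} () refl | no _

      child : ∀ {v k} → depth v ≡ suc k → Child (parent v) v
      child {v} {k} eq with label-suc eq | pos-positive (parent v) | proj₂ (parent-adj eq)
      ... | ls | pp | dk with label (depth (parent v)) (parent v) in lp
      ...   | i , suc e , s = tail⁺ (cong (proj₁ ∘ proj₂) lp)
                (trans (cong proj₁ ls) (sym (cong proj₁ lp)))
                (trans (cong (proj₁ ∘ proj₂) ls) (cong suc (sym (cong (proj₁ ∘ proj₂) lp))))
      ...   | i , zero , s with tail-child (parent v) ≟ v
      ...     | yes t = tail₁ (cong (proj₁ ∘ proj₂) lp) t (trans (cong proj₁ ls) (sym (cong proj₁ lp)))
                          (cong (proj₁ ∘ proj₂) ls)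
      ...     | no ¬t with turn k (parent v) v s in tk
      ...       | fwd = forward (cong (proj₁ ∘ proj₂) lp) ¬t (cong (proj₁ ∘ proj₂) ls)
                          (trans (cong proj₁ ls) (cong suc (sym (cong proj₁ lp))))
                          (turn-fwd {k} {s = s} tk ∘ trans (sym dk))
                          (λ d → trans (cong (proj₂ ∘ proj₂) lp) (trans (sym (turn-suc (trans (sym dk) d))) tk))
                          (cong (proj₂ ∘ proj₂) ls)
      ...       | bwd = backward (cong (proj₁ ∘ proj₂) lp) ¬t (cong (proj₁ ∘ proj₂) ls)
                          (trans (cong proj₁ lp) (trans (suc-pred (proj₂ pp)) (cong suc (sym (cong proj₁ ls)))))
                          (turn-bwd {k} {s = s} tk ∘ trans (sym dk))
                          (λ d → trans (cong (proj₂ ∘ proj₂) lp) (trans (sym (turn-suc (trans (sym dk) d))) tk))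
                          (cong (proj₂ ∘ proj₂) ls)
        where
        suc-pred : ∀ {i j} → i ≡ suc j → i ≡ suc (ℕ.pred i)
        suc-pred refl = refl

      dep⇒depth : ∀ {v e} → dep′ v ≡ suc e → ∃[ k ] depth v ≡ suc k
      dep⇒depth {v} eq with depth v
      dep⇒depth () | zero
      ... | suc k = k , refl

      grandparent≢ : ∀ {v k m} → depth v ≡ suc k → depth (parent v) ≡ suc m → v ≢ parent (parent v)
      grandparent≢ {v} eq eq′ v≡ = ℕₚ.<⇒≢ (ℕₚ.≤-trans (ℕₚ.≤-reflexive (cong suc (proj₂ (parent-adj eq′))))
        (ℕₚ.≤-trans (ℕₚ.n≤1+n _) (ℕₚ.≤-reflexive (trans (cong suc (trans (sym eq′) (proj₂ (parent-adj eq)))) (sym eq)))))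
        (cong depth (sym v≡))

      tail-bare : ∀ k {v e} → depth v ≡ suc k → dep′ v ≡ suc e → Bare (parent v) v
      tail-bare k eq de with child eq
      ... | tail₁ _ t _ _ = subst (Bare _) t (tail-child-bare (subst (Adj G _) (sym t) (proj₁ (parent-adj eq))))
      ... | forward _ _ d _ _ _ _ = contradiction (trans (sym de) d) λ ()
      ... | backward _ _ d _ _ _ _ = contradiction (trans (sym de) d) λ ()
      tail-bare zero eq de | tail⁺ dp _ _ =
        contradiction (trans (sym (proj₂ (dep⇒depth dp))) (proj₂ (parent-adj eq))) λ ()
      tail-bare (suc k) eq de | tail⁺ dp _ _ = bare-next (tail-bare k (proj₂ (parent-adj eq)) dp)
        (proj₁ (parent-adj eq)) (grandparent≢ eq (proj₂ (parent-adj eq)))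

      -- A bare branch towards the root would make the component free of branching vertices.
      parent-not-bare : ∀ k {v} → depth v ≡ suc k → Branching G (rep v) → ¬ Bare v (parent v)
      parent-not-bare zero eq br B = bare⇒¬branching B
        (subst (Branching G) (trans (sym (parent-rep eq)) (depth-zero (proj₂ (parent-adj eq)))) br)
      parent-not-bare (suc k) eq br B = parent-not-bare k (proj₂ (parent-adj eq))
        (subst (Branching G) (sym (parent-rep eq)) br)
        (bare-next B (symmetric G (proj₁ (parent-adj (proj₂ (parent-adj eq)))))
           (≢-sym (grandparent≢ eq (proj₂ (parent-adj eq)))))

      tail-child≢parent : ∀ {v k} → depth v ≡ suc k → Branching G v → tail-child v ≢ parent v
      tail-child≢parent {v} eq br t = parent-not-bare _ eq (branching-root v br)
        (subst (Bare v) t (tail-child-bare (tail-child-adj br)))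

      -- Two distinct spine children together with the parent, which is never the tail of a
      -- branching vertex, would be three neighbours off the tail.
      one-spine-child : ∀ {v w w′ k} → depth v ≡ suc k → Adj G v w → Adj G v w′ → parent w ≡ v → parent w′ ≡ v →
                        depth w ≡ suc (depth v) → depth w′ ≡ suc (depth v) →
                        tail-child v ≢ w → tail-child v ≢ w′ → w ≡ w′
      one-spine-child {v} {w} {w′} eq ~w ~w′ pw pw′ dw dw′ tw tw′ with w ≟ w′
      ... | yes w≡w′ = w≡w′
      ... | no w≢w′ = ⊥-elim (three-others ~p ~w ~w′ p≢w p≢w′ w≢w′
               (tail-child≢parent eq (_ , _ , _ , ~p , ~w , ~w′ , p≢w , p≢w′ , w≢w′)) tw tw′)
        where
        ~p = symmetric G (proj₁ (parent-adj eq))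
        ≢child : ∀ {x} → parent x ≡ v → depth x ≡ suc (depth v) → parent v ≢ x
        ≢child refl dx ≡x = grandparent≢ dx eq (sym ≡x)
        p≢w = ≢child pw dw
        p≢w′ = ≢child pw′ dw′

      least-unique : ∀ {v w w′} → Adj G v w → Adj G v w′ → tail-child v ≢ w → tail-child v ≢ w′ →
                     ¬ Later v w → ¬ Later v w′ → w ≡ w′
      least-unique {v} {w} {w′} ~w ~w′ tw tw′ ¬l ¬l′ with ℕₚ.<-cmp (toℕ w) (toℕ w′)
      ... | tri< lt _ _ = contradiction (w , ~w , tw , lt) ¬l′
      ... | tri≈ _ eq _ = toℕ-injective eq
      ... | tri> _ _ gt = contradiction (w′ , ~w′ , tw′ , gt) ¬l

      -- The witness `y` below the smaller of `w` and `w′` is a third neighbour off the tail.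
      later-unique : ∀ {v w w′} → Adj G v w → Adj G v w′ → tail-child v ≢ w → tail-child v ≢ w′ →
                     Later v w → Later v w′ → w ≡ w′
      later-unique {v} {w} {w′} ~w ~w′ tw tw′ (y , ~y , ty , y<w) (y′ , ~y′ , ty′ , y′<w′) with ℕₚ.<-cmp (toℕ w) (toℕ w′)
      ... | tri≈ _ eq _ = toℕ-injective eq
      ... | tri< lt _ _ = ⊥-elim (three-others ~y ~w ~w′ (λ { refl → ℕₚ.<-irrefl refl y<w })
              (λ { refl → ℕₚ.<-asym y<w lt }) (λ { refl → ℕₚ.<-irrefl refl lt }) ty tw tw′)
      ... | tri> _ _ gt = ⊥-elim (three-others ~y′ ~w ~w′ (λ { refl → ℕₚ.<-asym y′<w′ gt })
              (λ { refl → ℕₚ.<-irrefl refl y′<w′ }) (λ { refl → ℕₚ.<-irrefl refl gt }) ty′ tw tw′)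

      children-injective : ∀ {v w w′} → Adj G v w → Adj G v w′ → parent w ≡ v → parent w′ ≡ v →
                           depth w ≡ suc (depth v) → depth w′ ≡ suc (depth v) → Child v w → Child v w′ →
                           pos′ w ≡ pos′ w′ → dep′ w ≡ dep′ w′ → w ≡ w′
      children-injective {v} ~w ~w′ pw pw′ dw dw′ cw cw′ pos≡ dep≡ = go cw cw′
        where
        go : Child v _ → Child v _ → _
        go (tail⁺ dv _ _) (tail⁺ _ _ _) with dep⇒depth dv
        ... | k , dk = bare-unique (tail-bare k dk dv) ~w ~w′ (≢p pw dw) (≢p pw′ dw′)
          where
          ≢p : ∀ {x} → parent x ≡ v → depth x ≡ suc (depth v) → x ≢ parent v
          ≢p refl dx = grandparent≢ dx dk
        go (tail₁ _ t _ _) (tail₁ _ t′ _ _) = trans (sym t) t′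
        go (forward _ t _ _ l _ _) (forward _ t′ _ _ l′ _ _) with depth v in dv
        ... | zero = least-unique ~w ~w′ t t′ (l refl) (l′ refl)
        ... | suc k = one-spine-child dv ~w ~w′ pw pw′ (trans dw (cong suc (sym dv))) (trans dw′ (cong suc (sym dv))) t t′
        go (backward _ t _ _ l _ _) (backward _ t′ _ _ l′ _ _) with depth v in dv
        ... | zero = later-unique ~w ~w′ t t′ (l refl) (l′ refl)
        ... | suc k = one-spine-child dv ~w ~w′ pw pw′ (trans dw (cong suc (sym dv))) (trans dw′ (cong suc (sym dv))) t t′
        go (forward _ _ _ p _ _ _) (backward _ _ _ p′ _ _ _) =
          contradiction (trans p′ (cong suc (trans (sym pos≡) p))) (ℕₚ.<⇒≢ (ℕₚ.m<n⇒m<1+n (ℕₚ.n<1+n _)))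
        go (backward _ _ _ p _ _ _) (forward _ _ _ p′ _ _ _) =
          contradiction (trans p (cong suc (trans pos≡ p′))) (ℕₚ.<⇒≢ (ℕₚ.m<n⇒m<1+n (ℕₚ.n<1+n _)))
        go (tail⁺ dv _ _) (tail₁ dv′ _ _ _)            = contradiction dv (0≢suc dv′)
        go (tail⁺ dv _ _) (forward dv′ _ _ _ _ _ _)    = contradiction dv (0≢suc dv′)
        go (tail⁺ dv _ _) (backward dv′ _ _ _ _ _ _)   = contradiction dv (0≢suc dv′)
        go (tail₁ dv′ _ _ _) (tail⁺ dv _ _)            = contradiction dv (0≢suc dv′)
        go (forward dv′ _ _ _ _ _ _) (tail⁺ dv _ _)    = contradiction dv (0≢suc dv′)
        go (backward dv′ _ _ _ _ _ _) (tail⁺ dv _ _)   = contradiction dv (0≢suc dv′)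
        go (tail₁ _ _ _ d) (forward _ _ d′ _ _ _ _)    = contradiction (trans dep≡ d′) (λ e → 0≢suc e d)
        go (tail₁ _ _ _ d) (backward _ _ d′ _ _ _ _)   = contradiction (trans dep≡ d′) (λ e → 0≢suc e d)
        go (forward _ _ d′ _ _ _ _) (tail₁ _ _ _ d)    = contradiction (trans (sym dep≡) d′) (λ e → 0≢suc e d)
        go (backward _ _ d′ _ _ _ _) (tail₁ _ _ _ d)   = contradiction (trans (sym dep≡) d′) (λ e → 0≢suc e d)

      -- Labels do not fold back: heights along a tail only increase, and the direction along the
      -- spine is inherited everywhere below the root.
      child≢parent : ∀ {v w k} → depth v ≡ suc k → Child (parent v) v → Child v w →
                     pos′ w ≡ pos′ (parent v) → dep′ w ≢ dep′ (parent v)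
      child≢parent dv (tail⁺ _ _ d) (tail⁺ _ _ d′) _ eq =
        ℕₚ.<⇒≢ (ℕₚ.m<n⇒m<1+n (ℕₚ.n<1+n _)) (trans (sym eq) (trans d′ (cong suc d)))
      child≢parent dv (tail₁ dp _ _ d) (tail⁺ _ _ d′) _ eq = 0≢suc (trans eq dp) d′
      child≢parent dv (forward dp _ d _ _ _ _) (tail⁺ d′ _ _) _ eq = 0≢suc d d′
      child≢parent dv (backward dp _ d _ _ _ _) (tail⁺ d′ _ _) _ eq = 0≢suc d d′
      child≢parent dv (tail⁺ _ _ d) (tail₁ d′ _ _ _) _ eq = 0≢suc d′ d
      child≢parent dv (tail⁺ _ _ d) (forward d′ _ _ _ _ _ _) _ eq = 0≢suc d′ d
      child≢parent dv (tail⁺ _ _ d) (backward d′ _ _ _ _ _ _) _ eq = 0≢suc d′ d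
      child≢parent dv (tail₁ _ _ _ d) (tail₁ d′ _ _ _) _ eq = 0≢suc d′ d
      child≢parent dv (tail₁ _ _ _ d) (forward d′ _ _ _ _ _ _) _ eq = 0≢suc d′ d
      child≢parent dv (tail₁ _ _ _ d) (backward d′ _ _ _ _ _ _) _ eq = 0≢suc d′ d
      child≢parent dv (forward dp _ _ _ _ _ _) (tail₁ _ _ _ d) _ eq = 0≢suc (trans eq dp) d
      child≢parent dv (backward dp _ _ _ _ _ _) (tail₁ _ _ _ d) _ eq = 0≢suc (trans eq dp) d
      child≢parent dv (forward _ _ _ p _ _ _) (forward _ _ _ p′ _ _ _) eq _ =
        ℕₚ.<⇒≢ (ℕₚ.m<n⇒m<1+n (ℕₚ.n<1+n _)) (trans (sym eq) (trans p′ (cong suc p)))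
      child≢parent dv (backward _ _ _ p _ _ _) (backward _ _ _ p′ _ _ _) eq _ =
        ℕₚ.<⇒≢ (ℕₚ.m<n⇒m<1+n (ℕₚ.n<1+n _)) (trans eq (trans p (cong suc p′)))
      child≢parent dv (forward _ _ _ _ _ _ s) (backward _ _ _ _ _ s′ _) _ _ = contradiction (trans (sym s) (s′ dv)) λ ()
      child≢parent dv (backward _ _ _ _ _ _ s) (forward _ _ _ _ _ s′ _) _ _ = contradiction (trans (sym s) (s′ dv)) λ ()

      child-of : ∀ {v w} → parent w ≡ v → depth w ≡ suc (depth v) → Child v w
      child-of refl dw = child dw

      child-step : ∀ {v w} → Child v w → Step pos′ dep′ v w
      child-step (tail⁺ _ p d)              = rise p d
      child-step (tail₁ d₀ _ p d)           = rise p (trans d (cong suc (sym d₀)))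
      child-step (forward d₀ _ d p _ _ _)   = forth d₀ d p
      child-step (backward d₀ _ d p _ _ _)  = back d₀ d p

      comb-step : ∀ {v w} → Adj G v w → Step pos′ dep′ v w
      comb-step e with adj-parent e
      ... | inj₁ (p , d) = child-step (child-of p d)
      ... | inj₂ (p , d) = step-sym (child-step (child-of p d))

      comb-injective : ∀ {v w w′} → Adj G v w → Adj G v w′ → pos′ w ≡ pos′ w′ → dep′ w ≡ dep′ w′ → w ≡ w′
      comb-injective e e′ p d with adj-parent e | adj-parent e′
      ... | inj₁ (pw , dw) | inj₁ (pw′ , dw′) =
        children-injective e e′ pw pw′ dw dw′ (child-of pw dw) (child-of pw′ dw′) p d
      ... | inj₁ (pw , dw) | inj₂ (refl , dv) =
        contradiction d (child≢parent dv (child dv) (child-of pw dw) p)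
      ... | inj₂ (refl , dv) | inj₁ (pw , dw) =
        contradiction (sym d) (child≢parent dv (child dv) (child-of pw dw) (sym p))
      ... | inj₂ (pv , _) | inj₂ (pv′ , _) = trans (sym pv) pv′

      comb-lower : ∀ {v e} → dep′ v ≡ suc e → ∃[ w ] (Adj G v w × pos′ w ≡ pos′ v × dep′ w ≡ e)
      comb-lower {v} de with dep⇒depth de
      ... | k , dk with child dk
      ...   | tail⁺ _ p d = parent v , symmetric G (proj₁ (parent-adj dk)) , sym p ,
                            ℕₚ.suc-injective (trans (sym d) de)
      ...   | tail₁ d₀ _ p d = parent v , symmetric G (proj₁ (parent-adj dk)) , sym p ,
                               trans d₀ (ℕₚ.suc-injective (trans (sym d) de))
      ...   | forward _ _ d _ _ _ _ = contradiction de (0≢suc d)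
      ...   | backward _ _ d _ _ _ _ = contradiction de (0≢suc d)

    rooted-comb : Comb G
    rooted-comb = record
      { pos = pos′ ; dep = dep′ ; step = comb-step ; locally-injective = comb-injective ; lower = comb-lower }

comb : ∀ {n} {G : Graph n} {Bare} → IsForest G → Representatives G → Cert G Bare → Comb G
comb forest reps cert with branching-representatives reps
... | reps′ , branching-root = rooted-comb cert (rooting forest reps′) branching-root

-- Layouts of combs

-- Measured in half units, unit intervals starting at `i` and `j` have overlapping interiors exactly
-- in these cases.
Near : ℕ → ℕ → Set
Near i j = i ≡ j ⊎ i ≡ suc j ⊎ j ≡ suc i

near-sym : ∀ {i j} → Near i j → Near j i
near-sym (inj₁ e)        = inj₁ (sym e)
near-sym (inj₂ (inj₁ e)) = inj₂ (inj₂ e)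
near-sym (inj₂ (inj₂ e)) = inj₂ (inj₁ e)

odd : ℕ → Bool
odd zero    = false
odd (suc n) = not (odd n)

true-or-false : ∀ b → b ≡ true ⊎ b ≡ false
true-or-false true  = inj₁ refl
true-or-false false = inj₂ refl

∸-suc : ∀ {m n} → m ℕ.< n → n ℕ.∸ m ≡ suc (n ℕ.∸ suc m)
∸-suc {zero}  (s≤s _)   = refl
∸-suc {suc m} (s≤s m<n) = ∸-suc m<n

infixl 6 _▷_

_▷_ : ∀ {A : Set} {R : Rel A 0ℓ} {x y z} → Star R x y → R y z → Star R x z
es ▷ e = es ◅◅ e ◅ ε

unsnoc : ∀ {A : Set} {R : Rel A 0ℓ} {x y} → Star R x y → x ≡ y ⊎ ∃[ z ] (Star R x z × R z y)
unsnoc ε = inj₁ refl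
unsnoc (e ◅ es) with unsnoc es
... | inj₁ refl          = inj₂ (_ , ε , e)
... | inj₂ (z , es′ , f) = inj₂ (z , e ◅ es′ , f)

module CombProperties {n : ℕ} {G : Graph n} (C : Comb G) where

  open Comb C public

  -- The foot of a tail, as a relation: derivations follow the tail upwards from the spine, which
  -- makes induction from the foot possible.
  data Base : Fin n → Fin n → Set where
    floor : ∀ {v} → dep v ≡ 0 → Base v v
    climb : ∀ {v w b} → Base v b → Adj G v w → pos w ≡ pos v → dep w ≡ suc (dep v) → Base w b

  base-dep : ∀ {v b} → Base v b → dep b ≡ 0
  base-dep (floor d)       = d
  base-dep (climb B _ _ _) = base-dep B

  base-pos : ∀ {v b} → Base v b → pos b ≡ pos v
  base-pos (floor d)       = refl
  base-pos (climb B _ p _) = trans (base-pos B) (sym p)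

  base-exists : ∀ e {v} → dep v ≡ e → ∃[ b ] Base v b
  base-exists zero    d = _ , floor d
  base-exists (suc e) d with lower d
  ... | w , v~w , p , d′ with base-exists e d′
  ...   | b , B = b , climb B (symmetric G v~w) (sym p) (trans d (cong suc (sym d′)))

  lower-unique : ∀ {v v′ w} → Adj G v w → Adj G v′ w → pos w ≡ pos v → pos w ≡ pos v′ →
                 dep w ≡ suc (dep v) → dep w ≡ suc (dep v′) → v ≡ v′
  lower-unique e e′ p p′ d d′ = locally-injective (symmetric G e) (symmetric G e′) (trans (sym p) p′)
    (ℕₚ.suc-injective (trans (sym d) d′))

  base-functional : ∀ {v b b′} → Base v b → Base v b′ → b ≡ b′
  base-functional (floor _) (floor _) = refl
  base-functional (floor d) (climb _ _ _ d′) = contradiction d′ (0≢suc d)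
  base-functional (climb _ _ _ d′) (floor d) = contradiction d′ (0≢suc d)
  base-functional (climb B e p d) (climb B′ e′ p′ d′) with lower-unique e e′ p p′ d d′
  ... | refl = base-functional B B′

  -- Both vertices are climbed to from the same foot, and by local injectivity equal heights leave
  -- no choice at any step.
  base-injective : ∀ {v w b} → Base v b → Base w b → dep v ≡ dep w → v ≡ w
  base-injective (floor _) (floor _) _ = refl
  base-injective (floor d) (climb _ _ _ d′) eq = contradiction (trans eq d′) (0≢suc d)
  base-injective (climb _ _ _ d′) (floor d) eq = contradiction (trans (sym eq) d′) (0≢suc d)
  base-injective (climb B e p d) (climb B′ e′ p′ d′) eq
    with base-injective B B′ (ℕₚ.suc-injective (trans (sym d) (trans eq d′)))
  ... | refl = locally-injective e e′ (trans p (sym p′)) eq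

  Next : Rel (Fin n) 0ℓ
  Next v w = Adj G v w × dep v ≡ 0 × dep w ≡ 0 × pos w ≡ suc (pos v)

  next-functional : ∀ {v w w′} → Next v w → Next v w′ → w ≡ w′
  next-functional (e , _ , d , p) (e′ , _ , d′ , p′) = locally-injective e e′ (trans p (sym p′)) (trans d (sym d′))

  prev-functional : ∀ {v v′ w} → Next v w → Next v′ w → v ≡ v′
  prev-functional (e , d , _ , p) (e′ , d′ , _ , p′) = locally-injective (symmetric G e) (symmetric G e′)
    (ℕₚ.suc-injective (trans (sym p) p′)) (trans d (sym d′))

  -- A walk is projected to the spine. Since a spine vertex has at most one successor and one
  -- predecessor, a turn of the projected walk cancels and what remains is monotone. As `pos`
  -- increases along it, local injectivity becomes global on a component.
  bases-connected : ∀ {v w b b′} → Star (Adj G) v w → Base v b → Base w b′ → Star Next b b′ ⊎ Star Next b′ b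
  bases-connected ε B B′ with base-functional B B′
  ... | refl = inj₁ ε
  bases-connected (_◅_ {j = u} e es) B B′ with base-exists _ {u} refl
  ... | b″ , B″ with step e | bases-connected es B″ B′
  ...   | rise p d | ih with base-functional (climb B e p d) B″
  ...     | refl = ih
  bases-connected (e ◅ es) B B′ | b″ , B″ | fall p d | ih
    with base-functional (climb B″ (symmetric G e) (sym p) d) B
  ...     | refl = ih
  bases-connected (e ◅ es) B B′ | b″ , B″ | forth d d′ p | ih
    with base-functional B (floor d) | base-functional B″ (floor d′)
  ... | refl | refl with ih
  ...   | inj₁ es′ = inj₁ ((e , d , d′ , p) ◅ es′)
  ...   | inj₂ es′ with unsnoc es′
  ...     | inj₁ refl = inj₁ ((e , d , d′ , p) ◅ ε)
  ...     | inj₂ (z , es″ , f) with prev-functional (e , d , d′ , p) f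
  ...       | refl = inj₂ es″
  bases-connected (e ◅ es) B B′ | b″ , B″ | back d d′ p | ih
    with base-functional B (floor d) | base-functional B″ (floor d′)
  ... | refl | refl with ih
  ...   | inj₂ es′ = inj₂ (es′ ▷ (symmetric G e , d′ , d , p))
  ...   | inj₁ ε   = inj₂ ((symmetric G e , d′ , d , p) ◅ ε)
  ...   | inj₁ (f ◅ es″) with next-functional (symmetric G e , d′ , d , p) f
  ...     | refl = inj₁ es″

  next-pos-≤ : ∀ {b b′} → Star Next b b′ → pos b ℕ.≤ pos b′
  next-pos-≤ ε = ℕₚ.≤-refl
  next-pos-≤ ((_ , _ , _ , p) ◅ es) =
    ℕₚ.≤-trans (ℕₚ.n≤1+n _) (ℕₚ.≤-trans (ℕₚ.≤-reflexive (sym p)) (next-pos-≤ es))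

  next-pos-< : ∀ {b c b′} → Next b c → Star Next c b′ → pos b ℕ.< pos b′
  next-pos-< (_ , _ , _ , p) es = ℕₚ.≤-trans (ℕₚ.≤-reflexive (sym p)) (next-pos-≤ es)

  next-pos-≡ : ∀ {b b′} → Star Next b b′ → pos b ≡ pos b′ → b ≡ b′
  next-pos-≡ ε _ = refl
  next-pos-≡ (e ◅ es) eq = contradiction eq (ℕₚ.<⇒≢ (next-pos-< e es))

  next-pos-suc : ∀ {b b′} → Star Next b b′ → pos b′ ≡ suc (pos b) → Next b b′
  next-pos-suc ε eq = contradiction eq (ℕₚ.<⇒≢ (ℕₚ.n<1+n _))
  next-pos-suc (e@(_ , _ , _ , p) ◅ es) eq with next-pos-≡ es (trans p (sym eq))
  ... | refl = e

  same-base : ∀ {v w b b′} → Star (Adj G) v w → pos v ≡ pos w → Base v b → Base w b′ → b ≡ b′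
  same-base es eq B B′ with bases-connected es B B′ | trans (base-pos B) (trans eq (sym (base-pos B′)))
  ... | inj₁ ns | q = next-pos-≡ ns q
  ... | inj₂ ns | q = sym (next-pos-≡ ns (sym q))

  next-base : ∀ {v w b b′} → Star (Adj G) v w → pos w ≡ suc (pos v) → Base v b → Base w b′ → Next b b′
  next-base es eq B B′ with bases-connected es B B′
  ... | inj₁ ns = next-pos-suc ns (trans (base-pos B′) (trans eq (cong suc (sym (base-pos B)))))
  ... | inj₂ ns = contradiction (ℕₚ.≤-trans (ℕₚ.≤-reflexive (sym (trans (base-pos B′) eq)))
                    (ℕₚ.≤-trans (next-pos-≤ ns) (ℕₚ.≤-reflexive (base-pos B)))) (ℕₚ.<-irrefl refl)

  Up : Rel (Fin n) 0ℓ
  Up v w = Adj G v w × pos w ≡ pos v × dep w ≡ suc (dep v)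

  upwards : ∀ {v w b} → Base v b → Base w b → dep v ℕ.≤ dep w → Star Up v w
  upwards B B′@(floor d) le with base-injective B B′
                                   (trans (ℕₚ.n≤0⇒n≡0 (ℕₚ.≤-trans le (ℕₚ.≤-reflexive d))) (sym d))
  ... | refl = ε
  upwards {v} {w} B B′@(climb B″ e p d) le with dep v ℕₚ.≟ dep w
  ... | yes eq with base-injective B B′ eq
  ...   | refl = ε
  upwards {v} {w} B B′@(climb B″ e p d) le | no neq =
    upwards B B″ (ℕₚ.≤-pred (ℕₚ.<-≤-trans (ℕₚ.≤∧≢⇒< le neq) (ℕₚ.≤-reflexive d))) ▷ (e , p , d)

  -- The squares of even position have their tails on the left, those of odd position on the right,
  -- so that a line meeting two neighbouring positions meets a path, along which the key increases by one.
  D : ℕ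
  D = proj₁ (upper-bound dep)

  key : Fin n → ℕ
  key v with odd (pos v)
  -- Feet get the adjacent keys `D` and `suc D`. Since `D` bounds all heights, the truncated
  -- subtraction below is exact.
  ... | true  = suc (D ℕ.+ dep v)
  ... | false = D ℕ.∸ dep v

  private
    key-odd : ∀ {v} → odd (pos v) ≡ true → key v ≡ suc (D ℕ.+ dep v)
    key-odd eq rewrite eq = refl

    key-even : ∀ {v} → odd (pos v) ≡ false → key v ≡ D ℕ.∸ dep v
    key-even eq rewrite eq = refl

  Right : Rel (Fin n) 0ℓ
  Right v w = Adj G v w × key w ≡ suc (key v)

  private
    up-odd : ∀ {v w} → odd (pos v) ≡ true → Up v w → Right v w
    up-odd o (e , p , d) = e , trans (key-odd (trans (cong odd p) o))
      (cong suc (trans (cong (D ℕ.+_) d) (trans (ℕₚ.+-suc D _) (sym (key-odd o)))))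

    up-even : ∀ {v w} → odd (pos v) ≡ false → Up v w → Right w v
    up-even {v} {w} o (e , p , d) = symmetric G e , trans (key-even o)
      (trans (∸-suc (ℕₚ.≤-trans (ℕₚ.≤-reflexive (sym d)) (proj₂ (upper-bound dep) w)))
        (cong suc (trans (cong (D ℕ.∸_) (sym d)) (sym (key-even (trans (cong odd p) o))))))

    cross : ∀ {v w} → Adj G v w → dep v ≡ 0 → dep w ≡ 0 → odd (pos v) ≡ false → odd (pos w) ≡ true → Right v w
    cross e d d′ o o′ = e , trans (key-odd o′) (cong suc (trans (cong (D ℕ.+_) d′)
      (trans (ℕₚ.+-identityʳ D) (sym (trans (key-even o) (cong (D ℕ.∸_) d))))))

    odd-suc : ∀ {i j b} → j ≡ suc i → odd i ≡ b → odd j ≡ not b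
    odd-suc refl refl = refl

    up-right : ∀ {v w} → Up v w → Right v w ⊎ Right w v
    up-right {v} u with true-or-false (odd (pos v))
    ... | inj₁ o = inj₁ (up-odd o u)
    ... | inj₂ o = inj₂ (up-even o u)

    next-right : ∀ {v w} → Next v w → Right v w ⊎ Right w v
    next-right {v} (e , d , d′ , p) with true-or-false (odd (pos v))
    ... | inj₁ o = inj₂ (cross (symmetric G e) d′ d (odd-suc p o) o)
    ... | inj₂ o = inj₁ (cross e d d′ o (odd-suc p o))

  adj-right : ∀ {v w} → Adj G v w → Right v w ⊎ Right w v
  adj-right e with step e
  ... | forth d d′ p = next-right (e , d , d′ , p)
  ... | back d d′ p  = Sum.swap (next-right (symmetric G e , d′ , d , p))
  ... | rise p d       = up-right (e , p , d)
  ... | fall p d     = Sum.swap (up-right (symmetric G e , sym p , d))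

  adj-near : ∀ {v w} → Adj G v w → Near (pos v) (pos w)
  adj-near e with step e
  ... | forth d d′ p = inj₂ (inj₂ p)
  ... | back d d′ p  = inj₂ (inj₁ p)
  ... | rise p d       = inj₁ (sym p)
  ... | fall p d     = inj₁ (sym p)

  OneOf : ℕ → ℕ → ℕ → Set
  OneOf p q i = i ≡ p ⊎ i ≡ q

  RightIn : ℕ → ℕ → Rel (Fin n) 0ℓ
  RightIn p q v w = Right v w × OneOf p q (pos v) × OneOf p q (pos w)

  private
    odd-chain : ∀ {p q v w} → odd (pos v) ≡ true → OneOf p q (pos v) → Star Up v w → Star (RightIn p q) v w
    odd-chain o i ε = ε
    odd-chain {p} {q} o i (u@(_ , eq , _) ◅ us) = (up-odd o u , i , i′) ◅ odd-chain (trans (cong odd eq) o) i′ us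
      where i′ = subst (OneOf p q) (sym eq) i

    even-chain : ∀ {p q v w} → odd (pos v) ≡ false → OneOf p q (pos v) → Star Up v w → Star (RightIn p q) w v
    even-chain o i ε = ε
    even-chain {p} {q} o i (u@(_ , eq , _) ◅ us) = even-chain (trans (cong odd eq) o) i′ us ▷ (up-even o u , i′ , i)
      where i′ = subst (OneOf p q) (sym eq) i

    tail-chain : ∀ {p q v w} → OneOf p q (pos v) → Star Up v w → Star (RightIn p q) v w ⊎ Star (RightIn p q) w v
    tail-chain {v = v} i us with true-or-false (odd (pos v))
    ... | inj₁ o = inj₁ (odd-chain o i us)
    ... | inj₂ o = inj₂ (even-chain o i us)

    cross-chain : ∀ {p q v w b b′} → OneOf p q (pos v) → OneOf p q (pos w) → Base v b → Base w b′ → Next b b′ →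
                  Star (RightIn p q) v w ⊎ Star (RightIn p q) w v
    cross-chain {p} {q} {v} {w} {b} {b′} i j B B′ (e , d , d′ , s) with true-or-false (odd (pos b))
    ... | inj₂ o = inj₁ (even-chain o i′ b⇑v ◅◅ (cross e d d′ o o′ , i′ , j′) ◅ odd-chain o′ j′ b⇑w)
      where
      o′ = odd-suc s o
      i′ = subst (OneOf p q) (sym (base-pos B)) i
      j′ = subst (OneOf p q) (sym (base-pos B′)) j
      b⇑v = upwards (floor d) B (ℕₚ.≤-trans (ℕₚ.≤-reflexive d) z≤n)
      b⇑w = upwards (floor d′) B′ (ℕₚ.≤-trans (ℕₚ.≤-reflexive d′) z≤n)
    ... | inj₁ o = inj₂ (even-chain o′ j′ b⇑w ◅◅ (cross (symmetric G e) d′ d o′ o , j′ , i′) ◅ odd-chain o i′ b⇑v)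
      where
      o′ = odd-suc s o
      i′ = subst (OneOf p q) (sym (base-pos B)) i
      j′ = subst (OneOf p q) (sym (base-pos B′)) j
      b⇑v = upwards (floor d) B (ℕₚ.≤-trans (ℕₚ.≤-reflexive d) z≤n)
      b⇑w = upwards (floor d′) B′ (ℕₚ.≤-trans (ℕₚ.≤-reflexive d′) z≤n)

  -- The tails at the two positions line up from left to right: inwards along one, across the spine
  -- edge if the positions differ, outwards along the other. The walk records that it keeps to these
  -- two positions because its squares will serve as blockers.
  chain : ∀ {v w} → Star (Adj G) v w → Near (pos v) (pos w) →
          Star (RightIn (pos v) (pos w)) v w ⊎ Star (RightIn (pos v) (pos w)) w v
  chain {v} {w} es near with base-exists _ {v} refl | base-exists _ {w} refl
  ... | b , B | b′ , B′ with near
  ...   | inj₂ (inj₁ eq) = Sum.swap (cross-chain (inj₂ refl) (inj₁ refl) B′ B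
                             (next-base (Star.reverse (symmetric G) es) eq B′ B))
  ...   | inj₂ (inj₂ eq) = cross-chain (inj₁ refl) (inj₂ refl) B B′ (next-base es eq B B′)
  ...   | inj₁ eq with same-base es eq B B′ | ℕₚ.≤-total (dep v) (dep w)
  ...     | refl | inj₁ le = tail-chain (inj₁ refl) (upwards B B′ le)
  ...     | refl | inj₂ ge = Sum.swap (tail-chain (inj₂ refl) (upwards B′ B ge))

  chain-key : ∀ {p q v w} → Star (RightIn p q) v w → key v ℕ.≤ key w
  chain-key ε = ℕₚ.≤-refl
  chain-key (((_ , k) , _) ◅ es) = ℕₚ.≤-trans (ℕₚ.n≤1+n _) (ℕₚ.≤-trans (ℕₚ.≤-reflexive (sym k)) (chain-key es))

-- Visibility of the squares with lower left corners (`X v` / 2, `Y v` / 2), reduced to integer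
-- inequalities; a difference of 2 is a full side. In `blocked` the square `u` has the height of `v`
-- or of `w`, so every horizontal line through the interiors of both passes through it.
record Visible {n : ℕ} (G : Graph n) (X Y : Fin n → ℕ) : Set where
  field
    near    : ∀ {v w} → Adj G v w → Near (Y v) (Y w)
    apart   : ∀ {v w} → v ≢ w → Near (Y v) (Y w) → 2 ℕ.+ X v ℕ.≤ X w ⊎ 2 ℕ.+ X w ℕ.≤ X v
    clear   : ∀ {v w u} → Adj G v w → Near (Y v) (Y u) → Near (Y u) (Y w) → X v ℕ.< X u → ¬ X u ℕ.< X w
    blocked : ∀ {v w} → v ≢ w → ¬ Adj G v w → Near (Y v) (Y w) →
              ∃[ u ] ((Y u ≡ Y v ⊎ Y u ≡ Y w) × ((2 ℕ.+ X v ℕ.≤ X u × 2 ℕ.+ X u ℕ.≤ X w) ⊎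
                                                 (2 ℕ.+ X w ℕ.≤ X u × 2 ℕ.+ X u ℕ.≤ X v)))

near-bound : ∀ {i j} → Near i j → j ℕ.≤ suc i
near-bound (inj₁ refl)        = ℕₚ.n≤1+n _
near-bound (inj₂ (inj₁ refl)) = ℕₚ.m≤n⇒m≤1+n (ℕₚ.n≤1+n _)
near-bound (inj₂ (inj₂ refl)) = ℕₚ.≤-refl

-- A block of `2 + B` half units holds starting points from 0 to `B`, so its last square ends no
-- later than the next block begins.
separated : ∀ B {c c′ p} p′ → c ℕ.< c′ → p ℕ.≤ B → 2 ℕ.+ (c ℕ.* (2 ℕ.+ B) ℕ.+ p) ℕ.≤ c′ ℕ.* (2 ℕ.+ B) ℕ.+ p′
separated B {c} {c′} {p} p′ c<c′ p≤B = begin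
  2 ℕ.+ (c ℕ.* K ℕ.+ p)  ≡⟨ cong (2 ℕ.+_) (ℕₚ.+-comm (c ℕ.* K) p) ⟩
  2 ℕ.+ p ℕ.+ c ℕ.* K    ≤⟨ ℕₚ.+-monoˡ-≤ (c ℕ.* K) (ℕₚ.+-monoʳ-≤ 2 p≤B) ⟩
  suc c ℕ.* K            ≤⟨ ℕₚ.*-monoˡ-≤ K c<c′ ⟩
  c′ ℕ.* K               ≤⟨ ℕₚ.m≤m+n _ p′ ⟩
  c′ ℕ.* K ℕ.+ p′        ∎
  where
  open ℕₚ.≤-Reasoning
  K = 2 ℕ.+ B

near⇒same-cell : ∀ B {c c′ p p′} → p ℕ.≤ B → p′ ℕ.≤ B →
                 Near (c ℕ.* (2 ℕ.+ B) ℕ.+ p) (c′ ℕ.* (2 ℕ.+ B) ℕ.+ p′) → c ≡ c′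
near⇒same-cell B {c} {c′} {p} {p′} p≤B p′≤B near with ℕₚ.<-cmp c c′
... | tri≈ _ eq _ = eq
... | tri< lt _ _ = contradiction (ℕₚ.≤-trans (separated B p′ lt p≤B) (near-bound near)) (ℕₚ.<-irrefl refl)
... | tri> _ _ gt = contradiction (ℕₚ.≤-trans (separated B p gt p′≤B) (near-bound (near-sym near))) (ℕₚ.<-irrefl refl)

near-cancel : ∀ k {p p′} → Near (k ℕ.+ p) (k ℕ.+ p′) → Near p p′
near-cancel k (inj₁ e)        = inj₁ (ℕₚ.+-cancelˡ-≡ k _ _ e)
near-cancel k (inj₂ (inj₁ e)) = inj₂ (inj₁ (ℕₚ.+-cancelˡ-≡ k _ _ (trans e (sym (ℕₚ.+-suc k _)))))
near-cancel k (inj₂ (inj₂ e)) = inj₂ (inj₂ (ℕₚ.+-cancelˡ-≡ k _ _ (trans e (sym (ℕₚ.+-suc k _)))))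

near-shift : ∀ k {p p′} → Near p p′ → Near (k ℕ.+ p) (k ℕ.+ p′)
near-shift k (inj₁ e)        = inj₁ (cong (k ℕ.+_) e)
near-shift k (inj₂ (inj₁ e)) = inj₂ (inj₁ (trans (cong (k ℕ.+_) e) (ℕₚ.+-suc k _)))
near-shift k (inj₂ (inj₂ e)) = inj₂ (inj₂ (trans (cong (k ℕ.+_) e) (ℕₚ.+-suc k _)))

-- `c` numbers the components of `G`, while `c′` and `pos′` come from the other forest. Abscissae
-- thus do not use `key`; all that is asked of them is to move to a later block along `Right`.
module _ {n : ℕ} {G : Graph n} (C : Comb G)
         (c c′ pos′ : Fin n → ℕ) (B : ℕ) (pos≤B : ∀ v → Comb.pos C v ℕ.≤ B) (pos′≤B : ∀ v → pos′ v ℕ.≤ B)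
         (c-adj : ∀ {v w} → Adj G v w → c v ≡ c w) (c-walk : ∀ {v w} → c v ≡ c w → Star (Adj G) v w)
         (c′-mono : ∀ {v w} → CombProperties.Right C v w → c′ v ℕ.< c′ w) where

  open CombProperties C

  private
    X Y : Fin n → ℕ
    X v = c′ v ℕ.* (2 ℕ.+ B) ℕ.+ pos′ v
    Y v = c v ℕ.* (2 ℕ.+ B) ℕ.+ pos v

    X-mono : ∀ {v w} → c′ v ℕ.< c′ w → 2 ℕ.+ X v ℕ.≤ X w
    X-mono {v} {w} lt = separated B (pos′ w) lt (pos′≤B v)

    near⇒c≡ : ∀ {v w} → Near (Y v) (Y w) → c v ≡ c w
    near⇒c≡ {v} {w} = near⇒same-cell B (pos≤B v) (pos≤B w)

    near⇒pos : ∀ {v w} → Near (Y v) (Y w) → Near (pos v) (pos w)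
    near⇒pos {v} {w} near = near-cancel (c v ℕ.* (2 ℕ.+ B))
      (subst (λ k → Near (Y v) (k ℕ.* (2 ℕ.+ B) ℕ.+ pos w)) (sym (near⇒c≡ {v} {w} near)) near)

    near-chain : ∀ {v w} → Near (Y v) (Y w) → Star (RightIn (pos v) (pos w)) v w ⊎ Star (RightIn (pos v) (pos w)) w v
    near-chain {v} {w} near = chain (c-walk (near⇒c≡ {v} {w} near)) (near⇒pos {v} {w} near)

    chain-mono : ∀ {p q v w} → Star (RightIn p q) v w → v ≡ w ⊎ c′ v ℕ.< c′ w
    chain-mono ε = inj₁ refl
    chain-mono ((r , _) ◅ es) with chain-mono es
    ... | inj₁ refl = inj₂ (c′-mono r)
    ... | inj₂ lt   = inj₂ (ℕₚ.<-trans (c′-mono r) lt)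

    -- The chain runs one way or the other, and both `key` and `X` increase along it. Adjacent
    -- squares have consecutive keys, so nothing on their lines fits between them.
    key-mono : ∀ {v w} → Near (Y v) (Y w) → X v ℕ.< X w → key v ℕ.< key w
    key-mono {v} {w} near lt with near-chain {v} {w} near
    ... | inj₁ ε = contradiction lt (ℕₚ.<-irrefl refl)
    ... | inj₁ (((_ , k) , _) ◅ es) = ℕₚ.≤-trans (ℕₚ.≤-reflexive (sym k)) (chain-key es)
    ... | inj₂ es with chain-mono es
    ...   | inj₁ refl = contradiction lt (ℕₚ.<-irrefl refl)
    ...   | inj₂ gt   = contradiction (ℕₚ.<-trans lt (ℕₚ.≤-trans (ℕₚ.n≤1+n _) (X-mono gt))) (ℕₚ.<-irrefl refl)

    -- The second square of the chain already blocks, because a chain of a single step is an edge.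
    inside : ∀ {v w} p q → c v ≡ c w → ¬ Adj G v w → v ≢ w → Star (RightIn p q) v w →
             ∃[ u ] ((pos u ≡ p ⊎ pos u ≡ q) × c u ≡ c v × 2 ℕ.+ X v ℕ.≤ X u × 2 ℕ.+ X u ℕ.≤ X w)
    inside p q _ _ v≢w ε = contradiction refl v≢w
    inside p q eq ¬e v≢w ((r , _ , i) ◅ es) with chain-mono es
    ... | inj₁ refl = contradiction (proj₁ r) ¬e
    ... | inj₂ lt   = _ , i , sym (c-adj (proj₁ r)) , X-mono (c′-mono r) , X-mono lt

    Y-cong : ∀ {u v} → pos u ≡ pos v → c u ≡ c v → Y u ≡ Y v
    Y-cong p e = cong₂ (λ a b → a ℕ.* (2 ℕ.+ B) ℕ.+ b) e p

  comb-visible : Visible G X Y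
  comb-visible = record { near = near ; apart = apart ; clear = clear ; blocked = blocked }
    where
    near : ∀ {v w} → Adj G v w → Near (Y v) (Y w)
    near {v} {w} e = subst (λ k → Near (Y v) (k ℕ.* (2 ℕ.+ B) ℕ.+ pos w)) (c-adj e)
      (near-shift (c v ℕ.* (2 ℕ.+ B)) (adj-near e))

    apart : ∀ {v w} → v ≢ w → Near (Y v) (Y w) → 2 ℕ.+ X v ℕ.≤ X w ⊎ 2 ℕ.+ X w ℕ.≤ X v
    apart {v} {w} v≢w near with near-chain {v} {w} near
    ... | inj₁ es with chain-mono es
    ...   | inj₁ eq = contradiction eq v≢w
    ...   | inj₂ lt = inj₁ (X-mono lt)
    apart v≢w near | inj₂ es with chain-mono es
    ...   | inj₁ eq = contradiction (sym eq) v≢w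
    ...   | inj₂ lt = inj₂ (X-mono lt)

    clear : ∀ {v w u} → Adj G v w → Near (Y v) (Y u) → Near (Y u) (Y w) → X v ℕ.< X u → ¬ X u ℕ.< X w
    clear {v} {w} {u} e vu uw v<u u<w with adj-right e | key-mono {v} {u} vu v<u | key-mono {u} {w} uw u<w
    ... | inj₁ (_ , k) | lt | lt′ = ℕₚ.<-irrefl refl
      (ℕₚ.<-≤-trans lt (ℕₚ.≤-pred (ℕₚ.≤-trans lt′ (ℕₚ.≤-reflexive k))))
    ... | inj₂ (_ , k) | lt | lt′ = ℕₚ.<-asym (ℕₚ.<-trans lt lt′) (ℕₚ.≤-reflexive (sym k))

    blocked : ∀ {v w} → v ≢ w → ¬ Adj G v w → Near (Y v) (Y w) →
              ∃[ u ] ((Y u ≡ Y v ⊎ Y u ≡ Y w) × ((2 ℕ.+ X v ℕ.≤ X u × 2 ℕ.+ X u ℕ.≤ X w) ⊎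
                                                 (2 ℕ.+ X w ℕ.≤ X u × 2 ℕ.+ X u ℕ.≤ X v)))
    blocked {v} {w} v≢w ¬e near with near-chain {v} {w} near | near⇒c≡ {v} {w} near
    ... | inj₁ es | eq with inside _ _ eq ¬e v≢w es
    ...   | u , inj₁ p , q , l = u , inj₁ (Y-cong p q) , inj₁ l
    ...   | u , inj₂ p , q , l = u , inj₂ (Y-cong p (trans q eq)) , inj₁ l
    blocked {v} {w} v≢w ¬e near | inj₂ es | eq with inside _ _ (sym eq) (¬e ∘ symmetric G) (≢-sym v≢w) es
    ...   | u , inj₁ p , q , l = u , inj₁ (Y-cong p (trans q (sym eq))) , inj₂ l
    ...   | u , inj₂ p , q , l = u , inj₂ (Y-cong p q) , inj₂ l

-- Ordering the components of a subforest of a rooted tree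

infix 4 _⊑_

_⊑_ : ∀ {n} → Graph n → Graph n → Set
G ⊑ T = ∀ {v w} → Adj G v w → Adj T v w

module SubRooting {n : ℕ} {T : Graph n} (R : Rooting T) {G : Graph n} (G⊑T : G ⊑ T) where

  open Rooting R using (parent; depth; adj-parent; parent-adj)

  private
    -- The climb in `T` uses edges of `G` only; with the depth as fuel it stops at the vertex of the
    -- component nearest to the root of `T`.
    ascend : ℕ → Fin n → Fin n
    ascend zero    v = v
    ascend (suc k) v with adj? G (parent v) v
    ... | yes _ = ascend k (parent v)
    ... | no _  = v

    ascend-yes : ∀ {v w k} → Adj G v w → parent w ≡ v → ascend (suc k) w ≡ ascend k v
    ascend-yes {w = w} e refl with adj? G (parent w) w
    ... | yes _ = refl
    ... | no ¬e = contradiction e ¬e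

    ascend-walk : ∀ k v → Star (Adj G) v (ascend k v)
    ascend-walk zero    v = ε
    ascend-walk (suc k) v with adj? G (parent v) v
    ... | yes e = symmetric G e ◅ ascend-walk k (parent v)
    ... | no _  = ε

    apex : Fin n → Fin n
    apex v = ascend (depth v) v

    apex-adj : ∀ {v w} → Adj G v w → apex v ≡ apex w
    apex-adj {v} {w} e with adj-parent (G⊑T e)
    ... | inj₁ (p , d) rewrite d = sym (ascend-yes e p)
    ... | inj₂ (p , d) rewrite d = ascend-yes (symmetric G e) p

  sub-representatives : Representatives G
  sub-representatives = record { rep = apex ; rep-adj = apex-adj ; rep-walk = λ v → ascend-walk (depth v) v }

  open Representatives sub-representatives public

  -- A vertex cut off from its parent is the top of its component, so an edge of `T` outside `G`
  -- enters a component at its representative.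
  rep-fixed : ∀ {v w} → ¬ Adj G v w → parent w ≡ v → rep w ≡ w
  rep-fixed {w = w} ¬e refl with depth w
  ... | zero = refl
  ... | suc k with adj? G (parent w) w
  ...   | yes e = contradiction e ¬e
  ...   | no _  = refl

  -- Traversed from the root outwards, components of G are put at the extreme right or the extreme left
  -- of those met before, as prescribed by the orientation of the edge along which they are entered.
  module Cells (o : Fin n → Fin n → Bool) where

    -- Depth decides and the index breaks ties, so that distinct vertices have distinct ranks.
    rank : Fin n → ℕ
    rank v = depth v ℕ.* n ℕ.+ toℕ v

    private
      M : ℕ
      M = proj₁ (upper-bound rank)

      rank≤M : ∀ v → rank v ℕ.≤ M
      rank≤M = proj₂ (upper-bound rank)

      rank-mono : ∀ {v w} → depth v ℕ.< depth w → rank v ℕ.< rank w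
      rank-mono {v} {w} lt = begin-strict
        depth v ℕ.* n ℕ.+ toℕ v  <⟨ ℕₚ.+-monoʳ-< (depth v ℕ.* n) (toℕ<n v) ⟩
        depth v ℕ.* n ℕ.+ n      ≡⟨ ℕₚ.+-comm (depth v ℕ.* n) n ⟩
        suc (depth v) ℕ.* n      ≤⟨ ℕₚ.*-monoˡ-≤ n lt ⟩
        depth w ℕ.* n            ≤⟨ ℕₚ.m≤m+n _ (toℕ w) ⟩
        rank w                   ∎
        where open ℕₚ.≤-Reasoning

      rank-injective : ∀ {v w} → rank v ≡ rank w → v ≡ w
      rank-injective {v} {w} eq with ℕₚ.<-cmp (depth v) (depth w)
      ... | tri< lt _ _ = contradiction eq (ℕₚ.<⇒≢ (rank-mono lt))
      ... | tri> _ _ gt = contradiction (sym eq) (ℕₚ.<⇒≢ (rank-mono gt))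
      ... | tri≈ _ d _ rewrite d = toℕ-injective (ℕₚ.+-cancelˡ-≡ (depth w ℕ.* n) _ _ eq)

      rank-ascend : ∀ k {v} → depth v ≡ k → rank (ascend k v) ℕ.≤ rank v
      rank-ascend zero    _ = ℕₚ.≤-refl
      rank-ascend (suc k) {v} d with adj? G (parent v) v
      ... | no _  = ℕₚ.≤-refl
      ... | yes _ = ℕₚ.≤-trans (rank-ascend k (proj₂ (parent-adj d)))
        (ℕₚ.<⇒≤ (rank-mono (ℕₚ.≤-reflexive (trans (cong suc (proj₂ (parent-adj d))) (sym d)))))

      -- The distance from the middle `M` is the rank whichever side is taken. This makes places
      -- injective and puts deeper representatives outside all shallower ones.
      place : Fin n → ℕ
      place r = if o (parent r) r then M ℕ.+ rank r else M ℕ.∸ rank r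

      place-distance : ∀ r → ℕ.∣ place r - M ∣ ≡ rank r
      place-distance r with o (parent r) r
      ... | true  = trans (cong ℕ.∣ M ℕ.+ rank r -_∣ (sym (ℕₚ.+-identityʳ M)))
                      (trans (ℕₚ.∣m+n-m+o∣≡∣n-o∣ M (rank r) 0) (ℕₚ.∣-∣-identityʳ (rank r)))
      ... | false = trans (ℕₚ.m≤n⇒∣m-n∣≡n∸m (ℕₚ.m∸n≤m M (rank r))) (ℕₚ.m∸[m∸n]≡n (rank≤M r))

      place-≤ : ∀ r → place r ℕ.≤ M ℕ.+ rank r
      place-≤ r with o (parent r) r
      ... | true  = ℕₚ.≤-refl
      ... | false = ℕₚ.≤-trans (ℕₚ.m∸n≤m M (rank r)) (ℕₚ.m≤m+n M (rank r))

      place-≥ : ∀ r → M ℕ.∸ rank r ℕ.≤ place r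
      place-≥ r with o (parent r) r
      ... | true  = ℕₚ.≤-trans (ℕₚ.m∸n≤m M (rank r)) (ℕₚ.m≤m+n M (rank r))
      ... | false = ℕₚ.≤-refl

    cell : Fin n → ℕ
    cell v = place (rep v)

    cell-adj : ∀ {v w} → Adj G v w → cell v ≡ cell w
    cell-adj e = cong place (rep-adj e)

    cell-walk : ∀ {v w} → cell v ≡ cell w → Star (Adj G) v w
    cell-walk {v} {w} eq = same-rep⇒walk (rank-injective
      (trans (sym (place-distance (rep v))) (trans (cong ℕ.∣_- M ∣ eq) (place-distance (rep w)))))

    -- The deeper end is its own representative and outranks the representative of the other end.
    -- Its place is therefore farther out, on the side that the orientation prescribes; both
    -- orientations are given because either end may be the deeper one.
    cell-mono : ∀ {v w} → Adj T v w → ¬ Adj G v w → o v w ≡ true → o w v ≡ false → cell v ℕ.< cell w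
    cell-mono {v} {w} e ¬e vw wv with adj-parent e
    ... | inj₁ (refl , d) rewrite rep-fixed {w = w} ¬e refl | vw = begin-strict
      cell v                ≤⟨ place-≤ (rep v) ⟩
      M ℕ.+ rank (rep v)    ≤⟨ ℕₚ.+-monoʳ-≤ M (rank-ascend (depth v) refl) ⟩
      M ℕ.+ rank v          <⟨ ℕₚ.+-monoʳ-< M (rank-mono (ℕₚ.≤-reflexive (sym d))) ⟩
      M ℕ.+ rank w          ∎
      where open ℕₚ.≤-Reasoning
    ... | inj₂ (refl , d) rewrite rep-fixed {w = v} (¬e ∘ symmetric G) refl | wv = begin-strict
      M ℕ.∸ rank v          <⟨ ℕₚ.∸-monoʳ-< (rank-mono (ℕₚ.≤-reflexive (sym d))) (rank≤M v) ⟩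
      M ℕ.∸ rank w          ≤⟨ ℕₚ.∸-monoʳ-≤ M (rank-ascend (depth w) refl) ⟩
      M ℕ.∸ rank (rep w)    ≤⟨ place-≥ (rep w) ⟩
      cell w                ∎
      where open ℕₚ.≤-Reasoning

module _ {n : ℕ} {T G₁ G₂ : Graph n} (R : Rooting T) (G₁⊑T : G₁ ⊑ T) (G₂⊑T : G₂ ⊑ T)
         (disjoint-edges : ∀ {v w} → Adj G₁ v w → ¬ Adj G₂ v w) (C₁ : Comb G₁) (C₂ : Comb G₂) where

  private
    module C₁ = CombProperties C₁
    module C₂ = CombProperties C₂

    o₁ o₂ : Fin n → Fin n → Bool
    o₁ v w = does (C₁.key w ℕₚ.≟ suc (C₁.key v))
    o₂ v w = does (C₂.key w ℕₚ.≟ suc (C₂.key v))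

    key≢ : ∀ {i j : ℕ} → j ≡ suc i → i ≢ suc j
    key≢ refl eq = ℕₚ.<⇒≢ (ℕₚ.m<n⇒m<1+n (ℕₚ.n<1+n _)) eq

    module Cells₁ = SubRooting.Cells R {G₁} G₁⊑T o₂
    module Cells₂ = SubRooting.Cells R {G₂} G₂⊑T o₁

    mono₁ : ∀ {v w} → C₂.Right v w → Cells₁.cell v ℕ.< Cells₁.cell w
    mono₁ {v} {w} (e , k) = Cells₁.cell-mono (G₂⊑T e) (λ e′ → disjoint-edges e′ e)
      (dec-true (C₂.key w ℕₚ.≟ suc (C₂.key v)) k) (dec-false (C₂.key v ℕₚ.≟ suc (C₂.key w)) (key≢ k))

    mono₂ : ∀ {v w} → C₁.Right v w → Cells₂.cell v ℕ.< Cells₂.cell w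
    mono₂ {v} {w} (e , k) = Cells₂.cell-mono (G₁⊑T e) (disjoint-edges e)
      (dec-true (C₁.key w ℕₚ.≟ suc (C₁.key v)) k) (dec-false (C₁.key v ℕₚ.≟ suc (C₁.key w)) (key≢ k))

    B₁ B₂ : ℕ
    B₁ = proj₁ (upper-bound C₁.pos)
    B₂ = proj₁ (upper-bound C₂.pos)

    bound₁ : ∀ v → C₁.pos v ℕ.≤ B₁ ℕ.⊔ B₂
    bound₁ v = ℕₚ.≤-trans (proj₂ (upper-bound C₁.pos) v) (ℕₚ.m≤m⊔n B₁ B₂)

    bound₂ : ∀ v → C₂.pos v ℕ.≤ B₁ ℕ.⊔ B₂
    bound₂ v = ℕₚ.≤-trans (proj₂ (upper-bound C₂.pos) v) (ℕₚ.m≤n⊔m B₁ B₂)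

  -- Each forest orders its cells by the keys of the other. The edge sets being disjoint, an edge of
  -- one forest always leads to a new cell of the other. The common bound makes both calls produce
  -- the same two coordinate functions.
  layout : ∃[ X ] ∃[ Y ] (Visible G₁ X Y × Visible G₂ Y X)
  layout = _ , _ ,
    comb-visible C₁ Cells₁.cell Cells₂.cell C₂.pos (B₁ ℕ.⊔ B₂) bound₁ bound₂ Cells₁.cell-adj Cells₁.cell-walk mono₂ ,
    comb-visible C₂ Cells₂.cell Cells₁.cell C₁.pos (B₁ ℕ.⊔ B₂) bound₂ bound₁ Cells₂.cell-adj Cells₂.cell-walk mono₁

-- Unit squares with half-integral corners

ι : ℚ → ℝ
ι p = record
  { Lower = ℚ._< p ; Upper = p ℚ.<_
  ; lower-inhabited = p ℚ.- 1ℚ , subst (p ℚ.- 1ℚ ℚ.<_) (ℚₚ.+-identityʳ p) (ℚₚ.+-monoʳ-< p (ℚ.*<* ℤ.-<+))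
  ; upper-inhabited = p ℚ.+ 1ℚ , subst (ℚ._< p ℚ.+ 1ℚ) (ℚₚ.+-identityʳ p) (ℚₚ.+-monoʳ-< p (ℚ.*<* (ℤ.+<+ (s≤s z≤n))))
  ; lower-closed = ℚₚ.<-trans ; upper-closed = λ q<r p<q → ℚₚ.<-trans p<q q<r
  ; lower-open = λ q<p → let (r , q<r , r<p) = ℚₚ.<-dense q<p in r , q<r , r<p
  ; upper-open = λ p<r → let (q , p<q , q<r) = ℚₚ.<-dense p<r in q , q<r , p<q
  ; disjoint = ℚₚ.<-asym
  ; located = located-ι
  }
  where
  located-ι : ∀ {q r} → q ℚ.< r → q ℚ.< p ⊎ p ℚ.< r
  located-ι {q} q<r with q ℚₚ.<? p
  ... | yes q<p = inj₁ q<p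
  ... | no q≮p  = inj₂ (ℚₚ.≤-<-trans (ℚₚ.≮⇒≥ q≮p) q<r)

lower-<-upper : ∀ x {q r} → Lower x q → Upper x r → q ℚ.< r
lower-<-upper x {q} {r} l u with ℚₚ.<-cmp q r
... | tri< q<r _ _ = q<r
... | tri≈ _ refl _ = contradiction u (disjoint x l)
... | tri> _ _ r<q = contradiction u (disjoint x (lower-closed x r<q l))

ι<⇒lower : ∀ {p} x → ι p < x → Lower x p
ι<⇒lower x (q , p<q , l) = lower-closed x p<q l

lower⇒ι< : ∀ {p} x → Lower x p → ι p < x
lower⇒ι< x l = let (r , p<r , l′) = lower-open x l in r , p<r , l′

<ι⇒upper : ∀ {p} x → x < ι p → Upper x p
<ι⇒upper x (q , u , q<p) = upper-closed x q<p u

upper⇒<ι : ∀ {p} x → Upper x p → x < ι p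
upper⇒<ι x u = let (r , r<p , u′) = upper-open x u in r , u′ , r<p

q-1<p⇒q<p+1 : ∀ {p q} → q ℚ.- 1ℚ ℚ.< p → q ℚ.< p ℚ.+ 1ℚ
q-1<p⇒q<p+1 {p} {q} lt = subst (ℚ._< p ℚ.+ 1ℚ)
  (trans (ℚₚ.+-assoc q (ℚ.- 1ℚ) 1ℚ) (trans (cong (q ℚ.+_) (ℚₚ.+-inverseˡ 1ℚ)) (ℚₚ.+-identityʳ q)))
  (ℚₚ.+-monoˡ-< 1ℚ lt)

q<p+1⇒q-1<p : ∀ {p q} → q ℚ.< p ℚ.+ 1ℚ → q ℚ.- 1ℚ ℚ.< p
q<p+1⇒q-1<p {p} {q} lt = subst (q ℚ.- 1ℚ ℚ.<_)
  (trans (ℚₚ.+-assoc p 1ℚ (ℚ.- 1ℚ)) (trans (cong (p ℚ.+_) (ℚₚ.+-inverseʳ 1ℚ)) (ℚₚ.+-identityʳ p)))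
  (ℚₚ.+-monoˡ-< (ℚ.- 1ℚ) lt)

half : ℕ → ℚ
half zero    = ℚ.0ℚ
half (suc m) = half m ℚ.+ ℚ.½

half-+2 : ∀ m → half (2 ℕ.+ m) ≡ half m ℚ.+ 1ℚ
half-+2 m = ℚₚ.+-assoc (half m) ℚ.½ ℚ.½

half-suc : ∀ m → half m ℚ.< half (suc m)
half-suc m = subst (ℚ._< half (suc m)) (ℚₚ.+-identityʳ (half m)) (ℚₚ.+-monoʳ-< (half m) (ℚ.*<* (ℤ.+<+ (s≤s z≤n))))

half-mono-≤ : ∀ {m k} → m ℕ.≤ k → half m ℚ.≤ half k
half-mono-≤ {m} {k} m≤k with ℕₚ.m≤n⇒m<n∨m≡n m≤k
... | inj₂ refl = ℚₚ.≤-refl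
half-mono-≤ {m} {suc k} _ | inj₁ (s≤s m≤k) = ℚₚ.≤-trans (half-mono-≤ m≤k) (ℚₚ.<⇒≤ (half-suc k))

half-cancel-< : ∀ {m k} → half m ℚ.< half k → m ℕ.< k
half-cancel-< lt = ℕₚ.≰⇒> λ k≤m → ℚₚ.<-irrefl refl (ℚₚ.<-≤-trans lt (half-mono-≤ k≤m))

lower-half : ∀ x {m k} → m ℕ.≤ k → Lower x (half k) → Lower x (half m)
lower-half x {m} {k} m≤k l with ℚₚ.<-cmp (half m) (half k)
... | tri< lt _ _ = lower-closed x lt l
... | tri≈ _ eq _ = subst (Lower x) (sym eq) l
... | tri> _ _ gt = contradiction (ℚₚ.<-≤-trans gt (half-mono-≤ m≤k)) (ℚₚ.<-irrefl refl)

upper-half : ∀ x {m k} → m ℕ.≤ k → Upper x (half m) → Upper x (half k)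
upper-half x {m} {k} m≤k u with ℚₚ.<-cmp (half m) (half k)
... | tri< lt _ _ = upper-closed x lt u
... | tri≈ _ eq _ = subst (Upper x) eq u
... | tri> _ _ gt = contradiction (ℚₚ.<-≤-trans gt (half-mono-≤ m≤k)) (ℚₚ.<-irrefl refl)

<+1⇒upper : ∀ {m} x → x < ι (half m) +ℚ 1ℚ → Upper x (half (2 ℕ.+ m))
<+1⇒upper {m} x (q , u , l) = subst (Upper x) (sym (half-+2 m)) (upper-closed x (q-1<p⇒q<p+1 l) u)

upper⇒<+1 : ∀ {m} x → Upper x (half (2 ℕ.+ m)) → x < ι (half m) +ℚ 1ℚ
upper⇒<+1 {m} x u =
  let (q , q<h , u′) = upper-open x u in q , u′ , q<p+1⇒q-1<p (subst (q ℚ.<_) (half-+2 m) q<h)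

near-from-≤ : ∀ {i j} → i ℕ.≤ suc j → j ℕ.≤ suc i → Near i j
near-from-≤ {i} {j} i≤ j≤ with ℕₚ.<-cmp i j
... | tri≈ _ eq _ = inj₁ eq
... | tri< lt _ _ = inj₂ (inj₂ (ℕₚ.≤-antisym j≤ lt))
... | tri> _ _ gt = inj₂ (inj₁ (ℕₚ.≤-antisym i≤ gt))

module _ {n : ℕ} {G : Graph n} {X Y : Fin n → ℕ} (V : Visible G X Y) where

  open Visible V

  private
    S : Squares n
    S v = ι (half (X v)) , ι (half (Y v))

    InCell : ℕ → ℝ → Set
    InCell m x = Lower x (half m) × Upper x (half (2 ℕ.+ m))

    interior⇒cells : ∀ {v} x y → Interior S v (x , y) → InCell (X v) x × InCell (Y v) y
    interior⇒cells {v} x y ((l , r) , (b , t)) =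
      (ι<⇒lower x l , <+1⇒upper {X v} x r) , (ι<⇒lower y b , <+1⇒upper {Y v} y t)

    cells⇒interior : ∀ {v} x y → InCell (X v) x → InCell (Y v) y → Interior S v (x , y)
    cells⇒interior {v} x y (l , r) (b , t) =
      (lower⇒ι< x l , upper⇒<+1 {X v} x r) , (lower⇒ι< y b , upper⇒<+1 {Y v} y t)

    common⇒near : ∀ y {i j} → InCell i y → InCell j y → Near i j
    common⇒near y (l , u) (l′ , u′) = near-from-≤
      (ℕₚ.≤-pred (half-cancel-< (lower-<-upper y l u′))) (ℕₚ.≤-pred (half-cancel-< (lower-<-upper y l′ u)))

    centre : Fin n → ℝ
    centre v = ι (half (suc (X v)))

    centre-cell : ∀ v → InCell (X v) (centre v)
    centre-cell v = half-suc (X v) , half-suc (suc (X v))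

    strictly-between : ∀ {v w u} x → InCell (X u) x → right S v ≤ x → x ≤ left S w → X v ℕ.< X u × X u ℕ.< X w
    strictly-between {v} x (l , r) v≤x x≤w =
      ℕₚ.≰⇒> (λ u≤v → v≤x (upper⇒<+1 {X v} x (upper-half x (s≤s (s≤s u≤v)) r))) ,
      ℕₚ.≰⇒> (λ w≤u → x≤w (lower⇒ι< x (lower-half x w≤u l)))

    centre-between : ∀ {v w u} → 2 ℕ.+ X v ℕ.≤ X u → 2 ℕ.+ X u ℕ.≤ X w →
                     right S v ≤ centre u × centre u ≤ left S w
    centre-between {v} {w} {u} vu uw =
      (λ lt → ℕₚ.<-asym vu (ℕₚ.≤-pred (half-cancel-< (<+1⇒upper {X v} (centre u) lt)))) ,
      (λ lt → ℕₚ.<-irrefl refl (ℕₚ.<-≤-trans (half-cancel-< (ι<⇒lower {half (X w)} (centre u) lt)) (ℕₚ.≤-trans (ℕₚ.n≤1+n _) uw)))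

  visible-disjoint : DisjointInteriors S
  visible-disjoint v w v≢w (x , y) in-v in-w with interior⇒cells {v} x y in-v | interior⇒cells {w} x y in-w
  ... | (l , r) , cv | (l′ , r′) , cw with apart v≢w (common⇒near y cv cw)
  ...   | inj₁ le = ℕₚ.<-irrefl refl (ℕₚ.<-≤-trans (half-cancel-< (lower-<-upper x l′ r)) le)
  ...   | inj₂ le = ℕₚ.<-irrefl refl (ℕₚ.<-≤-trans (half-cancel-< (lower-<-upper x l r′)) le)

  adj⇒band : ∀ {v w} → Adj G v w → HorizontalBand S v w
  -- The strip is the half unit above the higher of the two bottoms; by `Near` both squares cover
  -- it.
  adj⇒band {v} {w} e = ι (half t) , ι (half (suc t)) ,
    lower⇒ι< (ι (half (suc t))) (half-suc t) ,
    λ y a<y y<b → let l = ι<⇒lower y a<y ; u = <ι⇒upper y y<b in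
      (centre v , cells⇒interior {v} (centre v) y (centre-cell v) (in-cell y l u (ℕₚ.m≤m⊔n _ _) t≤v)) ,
      (centre w , cells⇒interior {w} (centre w) y (centre-cell w) (in-cell y l u (ℕₚ.m≤n⊔m (Y v) _) t≤w)) ,
      λ z _ _ x between in-z → unobstructed z x y l u between (interior⇒cells {z} x y in-z)
    where
    t = Y v ℕ.⊔ Y w
    t≤v : t ℕ.≤ suc (Y v)
    t≤v = ℕₚ.⊔-lub (ℕₚ.n≤1+n _) (near-bound (near e))
    t≤w : t ℕ.≤ suc (Y w)
    t≤w = ℕₚ.⊔-lub (near-bound (near-sym (near e))) (ℕₚ.n≤1+n _)
    in-cell : ∀ y {m} → Lower y (half t) → Upper y (half (suc t)) → m ℕ.≤ t → t ℕ.≤ suc m → InCell m y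
    in-cell y l u m≤t t≤m = lower-half y m≤t l , upper-half y (s≤s t≤m) u
    unobstructed : ∀ z x y → Lower y (half t) → Upper y (half (suc t)) → Between S v w x →
                   ¬ (InCell (X z) x × InCell (Y z) y)
    unobstructed z x y l u between (cx , cy@(l′ , u′)) = go between
      where
      near-z : ∀ {m} → m ℕ.≤ t → t ℕ.≤ suc m → Near m (Y z)
      near-z m≤t t≤m = common⇒near y (in-cell y l u m≤t t≤m) cy
      vz = near-z (ℕₚ.m≤m⊔n _ _) t≤v
      wz = near-z (ℕₚ.m≤n⊔m (Y v) _) t≤w
      go : Between S v w x → ⊥
      go (inj₁ (p , q)) with strictly-between {v} {w} {z} x cx p q
      ... | v<z , z<w = clear e vz (near-sym wz) v<z z<w
      go (inj₂ (p , q)) with strictly-between {w} {v} {z} x cx p q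
      ... | w<z , z<v = clear (symmetric G e) wz (near-sym vz) w<z z<v

  band⇒adj : ∀ {v w} → v ≢ w → HorizontalBand S v w → Adj G v w
  band⇒adj {v} {w} v≢w (a , b , (q , a<q , q<b) , free) with adj? G v w
  ... | yes e = e
  -- The rational that separates the ends of the band serves as height. At this height the centre
  -- column of the blocking square contradicts the band.
  ... | no ¬e with free (ι q) (upper⇒<ι a a<q) (lower⇒ι< b q<b)
  ...   | (x , in-v) , (x′ , in-w) , ¬u
        with proj₂ (interior⇒cells {v} x (ι q) in-v) | proj₂ (interior⇒cells {w} x′ (ι q) in-w)
  ...     | cv | cw with blocked v≢w ¬e (common⇒near (ι q) cv cw)
  ...       | u , level , ordered = ⊥-elim (¬u u (proj₁ (distinct ordered)) (proj₂ (distinct ordered)) (centre u)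
                (between ordered) (cells⇒interior {u} (centre u) (ι q) (centre-cell u) (cu level)))
    where
    Ordered = (2 ℕ.+ X v ℕ.≤ X u × 2 ℕ.+ X u ℕ.≤ X w) ⊎ (2 ℕ.+ X w ℕ.≤ X u × 2 ℕ.+ X u ℕ.≤ X v)
    far : ∀ {i} → ¬ (2 ℕ.+ i ℕ.≤ i)
    far le = ℕₚ.<-irrefl refl (ℕₚ.<-trans (ℕₚ.n<1+n _) le)
    distinct : Ordered → u ≢ v × u ≢ w
    distinct (inj₁ (p , p′)) = (λ { refl → far p }) , (λ { refl → far p′ })
    distinct (inj₂ (p , p′)) = (λ { refl → far p′ }) , (λ { refl → far p })
    between : Ordered → Between S v w (centre u)
    between (inj₁ (p , p′)) = inj₁ (centre-between {v} {w} {u} p p′)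
    between (inj₂ (p , p′)) = inj₂ (centre-between {w} {v} {u} p p′)
    cu : Y u ≡ Y v ⊎ Y u ≡ Y w → InCell (Y u) (ι q)
    cu (inj₁ eq) = subst (λ m → InCell m (ι q)) (sym eq) cv
    cu (inj₂ eq) = subst (λ m → InCell m (ι q)) (sym eq) cw

visible⇒URVG : ∀ {n} {T G₁ G₂ : Graph n} {X Y} → G₁ ⊑ T → G₂ ⊑ T →
               (∀ {v w} → Adj T v w → Adj G₁ v w ⊎ Adj G₂ v w) → Visible G₁ X Y → Visible G₂ Y X → IsURVG T
visible⇒URVG {X = X} {Y} G₁⊑T G₂⊑T cover V₁ V₂ =
  (λ v → ι (half (X v)) , ι (half (Y v))) , visible-disjoint V₁ , λ v w v≢w →
    mk⇔ (λ e → [ (λ e₁ → inj₁ (adj⇒band V₁ e₁)) , (λ e₂ → inj₂ (adj⇒band V₂ e₂)) ]′ (cover e))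
        [ (λ h → G₁⊑T (band⇒adj V₁ v≢w h)) , (λ h → G₂⊑T (band⇒adj V₂ v≢w h)) ]′

-- Combs are subdivided caterpillars

record Enumeration {n : ℕ} (P : Fin n → Set) : Set where
  field
    size             : ℕ
    element          : Fin size → Fin n
    element-injective : Injective _≡_ _≡_ element
    element-holds    : ∀ i → P (element i)
    index            : ∀ {v} → P v → ∃[ i ] element i ≡ v

enumerate : ∀ {n} {P : Fin n → Set} → (∀ v → Dec (P v)) → Enumeration P
enumerate {zero} P? = record
  { size = 0 ; element = λ () ; element-injective = λ {} ; element-holds = λ () ; index = λ { {()} } }
enumerate {suc n} {P} P? with enumerate (P? ∘ suc) | P? zero
... | E | no ¬p = record
  { size = size ; element = suc ∘ element ; element-injective = element-injective ∘ suc-injective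
  ; element-holds = element-holds
  ; index = λ { {zero} p → contradiction p ¬p ; {suc v} p → let (i , eq) = index p in i , cong suc eq } }
  where open Enumeration E
... | E | yes p = record
  { size = suc size ; element = element′
  ; element-injective = λ { {zero} {zero} _ → refl ; {suc i} {suc j} eq → cong suc (element-injective (suc-injective eq)) }
  ; element-holds = λ { zero → p ; (suc i) → element-holds i }
  ; index = λ { {zero} _ → zero , refl ; {suc v} q → let (i , eq) = index q in suc i , cong suc eq } }
  where
  open Enumeration E
  element′ : Fin (suc size) → Fin (suc n)
  element′ zero    = zero
  element′ (suc i) = suc (element i)

module _ {n : ℕ} (G : Graph n) where

  neighbours : Fin n → List (Fin n)
  neighbours v = filter (adj? G v) (allFin n)

  neighbours-unique : ∀ v → Unique (neighbours v)
  neighbours-unique v = Unique.filter⁺ (adj? G v) (Unique.allFin⁺ n)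

  neighbours-adj : ∀ v → All (Adj G v) (neighbours v)
  neighbours-adj v = All.all-filter (adj? G v) (allFin n)

  ∈-neighbours : ∀ {v w} → Adj G v w → w ∈ neighbours v
  ∈-neighbours {v} {w} e = Mem.∈-filter⁺ (adj? G v) (Mem.∈-allFin w) e

cert⇒degree≤3 : ∀ {n} {G : Graph n} {Bare} → Cert G Bare → MaxDegree≤ 3 G
cert⇒degree≤3 {G = G} cert v = at-most-3 (neighbours G v) (neighbours-unique G v) (neighbours-adj G v)
  where
  at-most-3 : ∀ xs → Unique xs → All (Adj G v) xs → length xs ℕ.≤ 3
  at-most-3 [] _ _ = z≤n
  at-most-3 (_ ∷ []) _ _ = s≤s z≤n
  at-most-3 (_ ∷ _ ∷ []) _ _ = s≤s (s≤s z≤n)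
  at-most-3 (_ ∷ _ ∷ _ ∷ []) _ _ = s≤s (s≤s (s≤s z≤n))
  at-most-3 (_ ∷ _ ∷ _ ∷ _ ∷ _) ((ab ∷ ac ∷ ad ∷ _) ∷ (bc ∷ bd ∷ _) ∷ (cd ∷ _) ∷ _) (a ∷ b ∷ c ∷ d ∷ _) =
    ⊥-elim (Cert.no-four cert a b c d ab ac ad bc bd cd)

-- Forests from rankings with at most one lower neighbour

module _ {n : ℕ} (G : Graph n) (rank : Fin n → ℕ) (rank≢ : ∀ {v w} → Adj G v w → rank v ≢ rank w)
         (one-lower : ∀ {v w w′} → Adj G v w → Adj G v w′ → rank w ℕ.< rank v → rank w′ ℕ.< rank v → w ≡ w′) where

  private
    -- A path that has risen to `y` cannot fall next, as `y` would have two lower neighbours.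
    rises : ∀ x y zs w → IsPath G (x ∷ y ∷ zs ++ [ w ]) → rank x ℕ.< rank y → rank x ℕ.< rank w
    rises x y zs w ((e ∷ es) , ((x≢y ∷ x≢zs) ∷ u)) x<y with zs | es | x≢zs | u
    rises x y _ w ((e ∷ _) , _) x<y | [] | f ∷ _ | x≢w ∷ _ | u with ℕₚ.<-cmp (rank y) (rank w)
    ... | tri< y<w _ _ = ℕₚ.<-trans x<y y<w
    ... | tri≈ _ eq _  = contradiction eq (rank≢ f)
    ... | tri> _ _ w<y = contradiction (one-lower (symmetric G e) f x<y w<y) x≢w
    rises x y _ w ((e ∷ _) , _) x<y | z ∷ zs | fs@(f ∷ _) | x≢z ∷ _ | u with ℕₚ.<-cmp (rank y) (rank z)
    ... | tri< y<z _ _ = ℕₚ.<-trans x<y (rises y z zs w (fs , u) y<z)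
    ... | tri≈ _ eq _  = contradiction eq (rank≢ f)
    ... | tri> _ _ z<y = contradiction (one-lower (symmetric G e) f x<y z<y) x≢z

    -- Since falling after rising is impossible, a path that does not fall throughout rises in its
    -- last step.
    falls-or-rises-last : ∀ x y zs w → IsPath G (x ∷ y ∷ zs ++ [ w ]) →
      (rank y ℕ.< rank x × rank w ℕ.< rank x) ⊎ ∃[ p ] (p ∈ y ∷ zs × Adj G p w × rank p ℕ.< rank w)
    falls-or-rises-last x y [] w ((e ∷ f ∷ _) , ((_ ∷ x≢w ∷ _) ∷ _)) with ℕₚ.<-cmp (rank y) (rank w)
    ... | tri< y<w _ _ = inj₂ (y , here refl , f , y<w)
    ... | tri≈ _ eq _  = contradiction eq (rank≢ f)
    ... | tri> _ _ w<y with ℕₚ.<-cmp (rank x) (rank y)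
    ...   | tri< x<y _ _ = contradiction (one-lower (symmetric G e) f x<y w<y) x≢w
    ...   | tri≈ _ eq _  = contradiction eq (rank≢ e)
    ...   | tri> _ _ y<x = inj₁ (y<x , ℕₚ.<-trans w<y y<x)
    falls-or-rises-last x y (z ∷ zs) w ((e ∷ f ∷ fs) , ((_ ∷ x≢z ∷ _) ∷ u))
      with falls-or-rises-last y z zs w (f ∷ fs , u)
    ... | inj₂ (p , p∈ , r) = inj₂ (p , there p∈ , r)
    ... | inj₁ (z<y , w<y) with ℕₚ.<-cmp (rank x) (rank y)
    ...   | tri< x<y _ _ = contradiction (one-lower (symmetric G e) f x<y z<y) x≢z
    ...   | tri≈ _ eq _  = contradiction eq (rank≢ e)
    ...   | tri> _ _ y<x = inj₁ (y<x , ℕₚ.<-trans w<y y<x)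

  -- On a cycle the higher of the two ends `u` and `w` has two lower neighbours: the other end, and
  -- its neighbour on the path.
  ranked⇒forest : IsForest G
  ranked⇒forest u v vs w path@((e ∷ _) , ((u≢v ∷ u≢vs) ∷ (v≢ ∷ _))) wu with ℕₚ.<-cmp (rank u) (rank v)
  ... | tri≈ _ eq _ = rank≢ e eq
  ... | tri> _ _ v<u with ℕₚ.<-cmp (rank w) (rank u)
  ...   | tri≈ _ eq _ = rank≢ wu eq
  ...   | tri< w<u _ _ = All.lookup v≢ (Mem.∈-++⁺ʳ vs (here refl)) (one-lower e (symmetric G wu) v<u w<u)
  ...   | tri> _ _ u<w with falls-or-rises-last u v vs w path
  ...     | inj₁ (_ , w<u) = ℕₚ.<-asym u<w w<u
  ...     | inj₂ (p , here refl , pw , p<w) = u≢v (one-lower wu (symmetric G pw) u<w p<w)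
  ...     | inj₂ (p , there p∈ , pw , p<w) =
    All.lookup u≢vs (Mem.∈-++⁺ˡ p∈) (one-lower wu (symmetric G pw) u<w p<w)
  ranked⇒forest u v vs w path@((e ∷ _) , ((u≢v ∷ u≢vs) ∷ _)) wu | tri< u<v _ _
    with falls-or-rises-last u v vs w path | rises u v vs w path u<v
  ... | inj₁ (v<u , _) | _ = ℕₚ.<-asym u<v v<u
  ... | inj₂ (p , here refl , pw , p<w) | u<w = u≢v (one-lower wu (symmetric G pw) u<w p<w)
  ... | inj₂ (p , there p∈ , pw , p<w) | u<w =
    All.lookup u≢vs (Mem.∈-++⁺ˡ p∈) (one-lower wu (symmetric G pw) u<w p<w)

module _ {A : Set} where

  linked-consecutive : ∀ {R : Rel A 0ℓ} {a b xs} → Linked R xs → Consecutive a b xs → R a b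
  linked-consecutive (e ∷ _) ([] , _ , refl)            = e
  linked-consecutive (_ ∷ es) (_ ∷ y ∷ ys , zs , refl)  = linked-consecutive es (y ∷ ys , zs , refl)
  linked-consecutive (_ ∷ es) (_ ∷ [] , zs , refl)      = linked-consecutive es ([] , zs , refl)

  consecutive-∷ : ∀ {a b x : A} {xs} → Consecutive a b xs → Consecutive a b (x ∷ xs)
  consecutive-∷ (ys , zs , refl) = _ ∷ ys , zs , refl

  consecutive-reverse : ∀ {a b : A} {xs} → Consecutive a b xs → Consecutive b a (reverse xs)
  consecutive-reverse {a} {b} (ys , zs , refl) = reverse zs , reverse ys ,
    trans (Listₚ.reverse-++ ys (a ∷ b ∷ zs)) (trans (cong (_++ reverse ys)
      (trans (Listₚ.unfold-reverse a (b ∷ zs)) (trans (cong (_++ [ a ]) (Listₚ.unfold-reverse b zs))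
        (Listₚ.++-assoc (reverse zs) [ b ] [ a ])))) (Listₚ.++-assoc (reverse zs) (b ∷ a ∷ []) (reverse ys)))

  reverse-ends : ∀ (x : A) xs z → reverse (x ∷ xs ++ [ z ]) ≡ z ∷ reverse xs ++ [ x ]
  reverse-ends x xs z = trans (Listₚ.unfold-reverse x (xs ++ [ z ])) (cong (_++ [ x ]) (Listₚ.reverse-++ xs [ z ]))

  unique-reverse : ∀ {xs : List A} → Unique xs → Unique (reverse xs)
  unique-reverse [] = []
  unique-reverse {x ∷ xs} (x∉ ∷ u) = subst Unique (sym (Listₚ.unfold-reverse x xs))
    (Unique.++⁺ (unique-reverse u) ([] ∷ [])
      λ { (y∈ , here refl) → All.All¬⇒¬Any x∉ (Any.reverse⁻ y∈) })

-- The tails of a comb and their contraction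

module Contraction {n : ℕ} {G : Graph n} (C : Comb G) where

  open CombProperties C

  base : Fin n → Fin n
  base v = proj₁ (base-exists (dep v) {v} refl)

  isBase : ∀ v → Base v (base v)
  isBase v = proj₂ (base-exists (dep v) {v} refl)

  base≡ : ∀ {v b} → Base v b → base v ≡ b
  base≡ = base-functional (isBase _)

  base-zero : ∀ {v} → dep v ≡ 0 → base v ≡ v
  base-zero d = base≡ (floor d)

  dep-base : ∀ v → dep (base v) ≡ 0
  dep-base v = base-dep (isBase v)

  base-up : ∀ {v w} → Up v w → base w ≡ base v
  base-up {v} (e , p , d) = base≡ (climb (isBase v) e p d)

  same-base-dep : ∀ {v w} → base v ≡ base w → dep v ≡ dep w → v ≡ w
  same-base-dep {v} {w} eq = base-injective (subst (Base v) eq (isBase v)) (isBase w)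

  private
    low-of : ∀ {v} e → dep v ≡ e → Fin n
    low-of {v} zero    _  = v
    low-of     (suc e) eq = proj₁ (lower eq)

  low : Fin n → Fin n
  low v = low-of {v} (dep v) refl

  low-up : ∀ {v e} → dep v ≡ suc e → Up (low v) v × dep (low v) ≡ e
  low-up {v} {e} = go (dep v) refl
    where
    go : ∀ m (eq : dep v ≡ m) → m ≡ suc e → Up (low-of m eq) v × dep (low-of m eq) ≡ e
    go (suc m) eq refl with lower eq
    ... | w , v~w , p , d = (symmetric G v~w , sym p , trans eq (cong suc (sym d))) , d

  base-level : ∀ d {x k} → dep x ≡ d → k ℕ.≤ d → ∃[ u ] (base u ≡ base x × dep u ≡ k)
  base-level zero    eq z≤n = _ , refl , eq
  base-level (suc d) {x} {k} eq le with k ℕₚ.≟ suc d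
  ... | yes refl = _ , refl , eq
  ... | no k≢ with low-up eq
  ...   | up , dl with base-level d dl (ℕₚ.≤-pred (ℕₚ.≤∧≢⇒< le k≢))
  ...     | u , b , du = u , trans b (sym (base-up up)) , du

  Topmost : Fin n → Set
  Topmost y = ¬ (∃[ w ] Up y w)

  up? : ∀ v → Dec (∃[ w ] Up v w)
  up? v = any? λ w → adj? G v w ×-dec (pos w ℕₚ.≟ pos v) ×-dec (dep w ℕₚ.≟ suc (dep v))

  topmost-max : ∀ {x y} → Topmost y → base x ≡ base y → dep x ℕ.≤ dep y
  topmost-max {x} {y} top eq with dep x ℕₚ.≤? dep y
  ... | yes le = le
  ... | no ¬le with base-level (dep x) refl (ℕₚ.≰⇒> ¬le)
  ...   | u , bu , du with low-up du
  ...     | up , dl with same-base-dep (trans (sym (base-up up)) (trans bu eq)) dl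
  ...       | refl = contradiction (u , up) top

  topmost-unique : ∀ {x y} → Topmost x → Topmost y → base x ≡ base y → x ≡ y
  topmost-unique tx ty eq = same-base-dep eq (ℕₚ.≤-antisym (topmost-max ty eq) (topmost-max tx (sym eq)))

  -- Heights never exceed `D`, so `f` bounds the number of upward steps that remain.
  topmost-exists : ∀ f v → D ℕ.≤ f ℕ.+ dep v → ∃[ y ] (base y ≡ base v × dep v ℕ.≤ dep y × Topmost y)
  topmost-exists f v le with up? v
  ... | no top = v , refl , ℕₚ.≤-refl , top
  topmost-exists zero v le | yes (w , _ , _ , d) =
    contradiction (ℕₚ.≤-trans (ℕₚ.≤-reflexive (sym d)) (ℕₚ.≤-trans (proj₂ (upper-bound dep) w) le)) (ℕₚ.<-irrefl refl)
  topmost-exists (suc f) v le | yes (w , up@(_ , _ , d))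
    with topmost-exists f w (ℕₚ.≤-trans le (ℕₚ.≤-reflexive (trans (sym (ℕₚ.+-suc f _)) (cong (f ℕ.+_) (sym d)))))
  ... | y , b , le′ , top = y , trans b (base-up up) ,
        ℕₚ.≤-trans (ℕₚ.n≤1+n _) (ℕₚ.≤-trans (ℕₚ.≤-reflexive (sym d)) le′) , top

  -- Called with `dep v ≡ suc k`, it lists downwards the vertices of the tail strictly between `v`
  -- and its foot.
  lows : ℕ → Fin n → List (Fin n)
  lows zero    v = []
  lows (suc k) v = low v ∷ lows k (low v)

  ∈-lows⁻ : ∀ k {v x} → dep v ≡ suc k → x ∈ lows k v → base x ≡ base v × dep x ≢ 0 × dep x ℕ.< dep v
  ∈-lows⁻ (suc k) eq (here refl) with low-up eq
  ... | up , d = sym (base-up up) , (λ z → 0≢suc z d) , ℕₚ.≤-reflexive (sym (proj₂ (proj₂ up)))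
  ∈-lows⁻ (suc k) eq (there x∈) with low-up eq
  ... | up , d with ∈-lows⁻ k d x∈
  ...   | b , p , lt = trans b (sym (base-up up)) , p ,
                       ℕₚ.<-trans lt (ℕₚ.≤-reflexive (sym (proj₂ (proj₂ up))))

  ∈-lows⁺ : ∀ k {v x} → dep v ≡ suc k → base x ≡ base v → dep x ≢ 0 → dep x ℕ.< dep v → x ∈ lows k v
  ∈-lows⁺ zero eq b p lt = contradiction (ℕₚ.n≤0⇒n≡0 (ℕₚ.≤-pred (ℕₚ.≤-trans lt (ℕₚ.≤-reflexive eq)))) p
  ∈-lows⁺ (suc k) {v} {x} eq b p lt with low-up eq
  ... | up , d with dep x ℕₚ.≟ dep (low v)
  ...   | yes eq′ = here (same-base-dep (trans b (base-up up)) eq′)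
  ...   | no neq = there (∈-lows⁺ k d (trans b (base-up up)) p
            (ℕₚ.≤∧≢⇒< (ℕₚ.≤-pred (ℕₚ.≤-trans lt (ℕₚ.≤-reflexive (proj₂ (proj₂ up))))) neq))

  lows-unique : ∀ k {v} → dep v ≡ suc k → Unique (lows k v)
  lows-unique zero _ = []
  lows-unique (suc k) eq with low-up eq
  ... | _ , d = All.¬Any⇒All¬ _ (λ x∈ → ℕₚ.<-irrefl refl (proj₂ (proj₂ (∈-lows⁻ k d x∈)))) ∷ lows-unique k d

  tail-linked : ∀ k {v} → dep v ≡ suc k → Linked (Adj G) (v ∷ lows k v ++ [ base v ])
  tail-linked zero {v} eq with low-up eq
  ... | up , d = symmetric G (subst (λ b → Adj G b v) (trans (sym (base-zero d)) (sym (base-up up))) (proj₁ up)) ∷ [-]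
  tail-linked (suc k) {v} eq with low-up eq
  ... | up , d = symmetric G (proj₁ up) ∷
                 subst (λ b → Linked (Adj G) (low v ∷ lows k (low v) ++ [ b ])) (sym (base-up up)) (tail-linked k d)

  tail-consecutive : ∀ k {y a b} → dep y ≡ suc k → Up a b → base b ≡ base y → dep b ℕ.≤ dep y →
                     Consecutive b a (y ∷ lows k y ++ [ base y ])
  tail-consecutive k {y} {a} {b} eq up eqb le with dep b ℕₚ.≟ dep y
  tail-consecutive k {y} {a} eq up eqb le | yes d with same-base-dep eqb d
  tail-consecutive k {y} {a} eq up eqb le | yes d | refl
    with low-up eq | lower-unique (proj₁ up) (proj₁ (proj₁ (low-up eq))) (proj₁ (proj₂ up))
                       (proj₁ (proj₂ (proj₁ (low-up eq)))) (proj₂ (proj₂ up)) (proj₂ (proj₂ (proj₁ (low-up eq))))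
  tail-consecutive zero {y} {a} eq up eqb le | yes d | refl | up′ , dl | refl =
    [] , [] , cong (λ z → y ∷ z ∷ []) (trans (base-up up) (base-zero dl))
  tail-consecutive (suc k) {y} {a} eq up eqb le | yes d | refl | up′ , dl | refl = [] , _ , refl
  tail-consecutive zero {y} eq up eqb le | no neq =
    contradiction (proj₂ (proj₂ up)) (0≢suc (ℕₚ.n≤0⇒n≡0 (ℕₚ.≤-pred (ℕₚ.<-≤-trans (ℕₚ.≤∧≢⇒< le neq) (ℕₚ.≤-reflexive eq)))))
  tail-consecutive (suc k) {y} {a} {b} eq up eqb le | no neq with low-up eq
  ... | up′ , dl = consecutive-∷ (subst (λ z → Consecutive b a (low y ∷ lows k (low y) ++ [ z ])) (sym (base-up up′))
        (tail-consecutive k dl up (trans eqb (base-up up′))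
          (ℕₚ.≤-pred (ℕₚ.<-≤-trans (ℕₚ.≤∧≢⇒< le neq) (ℕₚ.≤-reflexive (proj₂ (proj₂ up′)))))))

module ContractedComb {n : ℕ} {G : Graph n} (C : Comb G) (tree : IsTree G) where

  open CombProperties C
  open Contraction C

  private
    connected : Connected G
    connected = proj₁ (proj₂ tree)

    positive : ∀ {i} → i ≢ 0 → ∃[ j ] i ≡ suc j
    positive {zero}  i≢0 = contradiction refl i≢0
    positive {suc i} _   = i , refl

    Kept : Fin n → Set
    Kept v = dep v ≡ 0 ⊎ Topmost v

    kept : Enumeration Kept
    kept = enumerate λ v → (dep v ℕₚ.≟ 0) ⊎-dec ¬? (up? v)

    open Enumeration kept

    Tail : Rel (Fin n) 0ℓ
    Tail x y = base y ≡ x × dep y ≢ 0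

    -- Spine edges are kept, and each tail becomes one edge between its foot and its end; a kept
    -- vertex off the spine is always the end of its tail.
    Link : Rel (Fin n) 0ℓ
    Link x y = (Adj G x y × dep x ≡ 0 × dep y ≡ 0) ⊎ Tail x y ⊎ Tail y x

    tail? : ∀ x y → Dec (Tail x y)
    tail? x y = (base y ≟ x) ×-dec ¬? (dep y ℕₚ.≟ 0)

    tail-dep : ∀ {x y} → Tail x y → dep x ≡ 0
    tail-dep {y = y} (refl , _) = dep-base y

    link-sym : Symmetric Link
    link-sym (inj₁ (e , d , d′)) = inj₁ (symmetric G e , d′ , d)
    link-sym (inj₂ (inj₁ t))     = inj₂ (inj₂ t)
    link-sym (inj₂ (inj₂ t))     = inj₂ (inj₁ t)

    link-loopless : ∀ {x} → ¬ Link x x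
    link-loopless (inj₁ (e , _))           = loopless G e
    link-loopless (inj₂ (inj₁ t@(_ , d)))  = d (tail-dep t)
    link-loopless (inj₂ (inj₂ t@(_ , d)))  = d (tail-dep t)

    K : Graph size
    K = record
      { Adj = λ a b → Link (element a) (element b)
      ; adj? = λ a b → let x = element a ; y = element b in
          (adj? G x y ×-dec (dep x ℕₚ.≟ 0) ×-dec (dep y ℕₚ.≟ 0)) ⊎-dec (tail? x y ⊎-dec tail? y x)
      ; symmetric = link-sym ; loopless = link-loopless }

    idx : ∀ {v} → dep v ≡ 0 → Fin size
    idx d = proj₁ (index (inj₁ d))

    element-idx : ∀ {v} (d : dep v ≡ 0) → element (idx d) ≡ v
    element-idx d = proj₂ (index (inj₁ d))

    tail-topmost : ∀ {x} a → Tail x (element a) → Topmost (element a)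
    tail-topmost a (_ , d≢0) with element-holds a
    ... | inj₁ d   = contradiction d d≢0
    ... | inj₂ top = top

    rank : Fin n → ℕ
    rank v = pos v ℕ.+ dep v

    -- The link towards the low end of the spine: from a spine vertex to its predecessor, from the
    -- end of a tail to its foot. Its uniqueness is what excludes cycles.
    LowerEnd : Rel (Fin n) 0ℓ
    LowerEnd y x = Next y x ⊎ Tail y x

    next-rank : ∀ {x y} → Next x y → rank x ℕ.< rank y
    next-rank (_ , d , d′ , p) rewrite d | d′ | p = ℕₚ.n<1+n _

    tail-rank : ∀ {x y} → Tail x y → rank x ℕ.< rank y
    tail-rank {y = y} (refl , d) rewrite dep-base y | base-pos (isBase y) = ℕₚ.+-monoʳ-< (pos y) (ℕₚ.n≢0⇒n>0 d)

    spine-next : ∀ {x y} → Adj G x y → dep x ≡ 0 → dep y ≡ 0 → Next x y ⊎ Next y x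
    spine-next e d d′ with step e
    ... | forth _ _ p = inj₁ (e , d , d′ , p)
    ... | back _ _ p  = inj₂ (symmetric G e , d′ , d , p)
    ... | rise _ u    = contradiction u (0≢suc d′)
    ... | fall _ u    = contradiction u (0≢suc d)

    link-ends : ∀ {x y} → Link x y → LowerEnd x y ⊎ LowerEnd y x
    link-ends (inj₂ (inj₁ t)) = inj₁ (inj₂ t)
    link-ends (inj₂ (inj₂ t)) = inj₂ (inj₂ t)
    link-ends (inj₁ (e , d , d′)) with spine-next e d d′
    ... | inj₁ s = inj₁ (inj₁ s)
    ... | inj₂ s = inj₂ (inj₁ s)

    end-rank : ∀ {x y} → LowerEnd x y → rank x ℕ.< rank y
    end-rank (inj₁ s) = next-rank s
    end-rank (inj₂ t) = tail-rank t

    lower-end : ∀ {x y} → Link x y → rank y ℕ.< rank x → LowerEnd y x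
    lower-end l lt with link-ends l
    ... | inj₂ e = e
    ... | inj₁ e = contradiction (end-rank e) (ℕₚ.<-asym lt)

    lower-end-unique : ∀ {x y y′} → LowerEnd y x → LowerEnd y′ x → y ≡ y′
    lower-end-unique (inj₁ s) (inj₁ s′) = prev-functional s s′
    lower-end-unique (inj₂ (b , _)) (inj₂ (b′ , _)) = trans (sym b) b′
    lower-end-unique (inj₁ (_ , _ , d , _)) (inj₂ (_ , d≢0)) = contradiction d d≢0
    lower-end-unique (inj₂ (_ , d≢0)) (inj₁ (_ , _ , d , _)) = contradiction d d≢0

    link-rank≢ : ∀ {x y} → Link x y → rank x ≢ rank y
    link-rank≢ l eq with link-ends l
    ... | inj₁ e = ℕₚ.<⇒≢ (end-rank e) eq
    ... | inj₂ e = ℕₚ.<⇒≢ (end-rank e) (sym eq)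

    K-forest : IsForest K
    K-forest = ranked⇒forest K (rank ∘ element) link-rank≢
      λ l l′ lt lt′ → element-injective (lower-end-unique (lower-end l lt) (lower-end l′ lt′))

    next-link : ∀ {a x y} → element a ≡ x → (s : Next x y) → Adj K a (idx (proj₁ (proj₂ (proj₂ s))))
    next-link refl (e , d , d′ , _) = inj₁ (subst (Adj G _) (sym (element-idx d′)) e , d , trans (cong dep (element-idx d′)) d′)

    nexts-walk : ∀ {a b x y} → element a ≡ x → element b ≡ y → Star Next x y → Star (Adj K) a b
    nexts-walk p q ε with element-injective (trans p (sym q))
    ... | refl = ε
    nexts-walk p q (s ◅ ss) = next-link p s ◅ nexts-walk (element-idx _) q ss

    base-index : Fin size → Fin size
    base-index a = idx (dep-base (element a))

    base-walk : ∀ a → Star (Adj K) a (base-index a)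
    base-walk a with dep (element a) ℕₚ.≟ 0
    ... | yes d with element-injective (trans (element-idx (dep-base (element a))) (base-zero d))
    ...   | eq = subst (Star (Adj K) a) (sym eq) ε
    base-walk a | no d = inj₂ (inj₂ (sym (element-idx _) , d)) ◅ ε

    K-connected : Connected K
    K-connected a b with bases-connected (connected (element a) (element b)) (isBase _) (isBase _)
    ... | inj₁ ss = base-walk a ◅◅ nexts-walk (element-idx _) (element-idx _) ss ◅◅
                    Star.reverse link-sym (base-walk b)
    ... | inj₂ ss = base-walk a ◅◅ Star.reverse link-sym (nexts-walk (element-idx _) (element-idx _) ss) ◅◅
                    Star.reverse link-sym (base-walk b)

    vertex : Fin n
    vertex = fromℕ< (proj₁ tree)

    K-tree : IsTree K
    K-tree = ℕₚ.≤-<-trans z≤n (toℕ<n (idx (dep-base vertex))) , K-connected , K-forest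

    spine-list : List (Fin n)
    spine-list = filter (λ v → dep v ℕₚ.≟ 0) (allFin n)

    lowest highest : Fin n
    lowest  = argmin pos (base vertex) spine-list
    highest = argmax pos (base vertex) spine-list

    lowest-dep : dep lowest ≡ 0
    lowest-dep = argmin-all pos (dep-base vertex) (All.all-filter (λ v → dep v ℕₚ.≟ 0) (allFin n))

    highest-dep : dep highest ≡ 0
    highest-dep = argmax-all pos (dep-base vertex) (All.all-filter (λ v → dep v ℕₚ.≟ 0) (allFin n))

    ∈-spine-list : ∀ {v} → dep v ≡ 0 → v ∈ spine-list
    ∈-spine-list d = Mem.∈-filter⁺ (λ v → dep v ℕₚ.≟ 0) (Mem.∈-allFin _) d

    -- Connectedness gives a monotone spine walk in one of two directions; minimality of the
    -- position leaves only the trivial walk in the wrong one.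
    from-lowest : ∀ {v} → dep v ≡ 0 → Star Next lowest v
    from-lowest {v} d with bases-connected (connected lowest v) (floor lowest-dep) (floor d)
    ... | inj₁ ss = ss
    ... | inj₂ ss with next-pos-≡ ss (ℕₚ.≤-antisym (next-pos-≤ ss)
                         (All.lookup (f[argmin]≤f[xs] (base vertex) spine-list) (∈-spine-list d)))
    ...   | refl = ε

    to-highest : ∀ {v} → dep v ≡ 0 → Star Next v highest
    to-highest {v} d with bases-connected (connected v highest) (floor d) (floor highest-dep)
    ... | inj₁ ss = ss
    ... | inj₂ ss with next-pos-≡ ss (ℕₚ.≤-antisym (next-pos-≤ ss)
                         (All.lookup (f[xs]≤f[argmax] (base vertex) spine-list) (∈-spine-list d)))
    ...   | refl = ε

    ladder : ∀ {x y} → Star Next x y → List (Fin size)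
    ladder ε = []
    ladder ((_ , _ , d , _) ◅ ss) = idx d ∷ ladder ss

    ladder-linked : ∀ {x y} a → element a ≡ x → (ss : Star Next x y) → Linked (Adj K) (a ∷ ladder ss)
    ladder-linked a eq ε = [-]
    ladder-linked a eq (s@(_ , _ , d , _) ◅ ss) = next-link eq s ∷ ladder-linked (idx d) (element-idx d) ss

    ladder-above : ∀ {x y} (ss : Star Next x y) → All (λ b → pos x ℕ.< pos (element b)) (ladder ss)
    ladder-above ε = []
    ladder-above {x} ((_ , _ , d , p) ◅ ss) =
      ℕₚ.≤-reflexive (sym (trans (cong pos (element-idx d)) p)) ∷
      All.map (ℕₚ.<-trans (ℕₚ.≤-reflexive (sym p))) (ladder-above ss)

    ladder-unique : ∀ {x y} a → element a ≡ x → (ss : Star Next x y) → Unique (a ∷ ladder ss)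
    ladder-unique a eq ε = [] ∷ []
    ladder-unique a refl (s@(_ , _ , d , p) ◅ ss) =
      All.map (λ { lt refl → ℕₚ.<-irrefl refl lt }) (ladder-above (s ◅ ss)) ∷ ladder-unique (idx d) (element-idx d) ss

    ladder-complete : ∀ {x y} a → element a ≡ x → (ss : Star Next x y) →
                      ∀ b → Star Next x (element b) → Star Next (element b) y → b ∈ a ∷ ladder ss
    ladder-complete a eq ss b ε _ = here (element-injective (sym eq))
    ladder-complete a eq ε b (s ◅ us) vs = contradiction (next-pos-< s (us ◅◅ vs)) (ℕₚ.<-irrefl refl)
    ladder-complete a eq (s@(_ , _ , d , _) ◅ ss) b (s′ ◅ us) vs with next-functional s s′
    ... | refl = there (ladder-complete (idx d) (element-idx d) ss b us vs)

    one-neighbour : ∀ a → dep (element a) ≢ 0 → ¬ 1 ℕ.< degree K a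
    one-neighbour a d lt with neighbours K a | neighbours-unique K a | neighbours-adj K a
    one-neighbour a d (s≤s ()) | _ ∷ [] | _ | _
    ... | b ∷ b′ ∷ _ | (b≢b′ ∷ _) ∷ _ | l ∷ l′ ∷ _ = b≢b′ (element-injective (trans (sym (only l)) (only l′)))
      where
      only : ∀ {y} → Link (element a) y → base (element a) ≡ y
      only (inj₁ (_ , d′ , _))      = contradiction d′ d
      only (inj₂ (inj₁ t))          = contradiction (tail-dep t) d
      only (inj₂ (inj₂ (b , _)))    = b

    K-caterpillar : IsCaterpillar K
    K-caterpillar = K-tree , idx lowest-dep , ladder rungs ,
      (ladder-linked _ (element-idx lowest-dep) rungs , ladder-unique _ (element-idx lowest-dep) rungs) , on-spine
      where
      rungs = from-lowest highest-dep
      on-spine : ∀ a → 1 ℕ.< degree K a → a ∈ idx lowest-dep ∷ ladder rungs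
      on-spine a lt = ladder-complete _ (element-idx lowest-dep) rungs a (from-lowest d) (to-highest d)
        where d = decidable-stable (dep (element a) ℕₚ.≟ 0) (λ ¬d → one-neighbour a ¬d lt)

    inside : Fin n → Fin n → List (Fin n)
    inside x y with dep x | dep y
    ... | zero  | suc k = reverse (lows k y)
    ... | suc k | zero  = lows k x
    -- Spine edges stay undivided, and two vertices off the spine are never linked.
    ... | _     | _     = []

    inside-spine : ∀ {x y} → dep x ≡ 0 → dep y ≡ 0 → inside x y ≡ []
    inside-spine d d′ rewrite d | d′ = refl

    inside-up : ∀ {x y k} → dep x ≡ 0 → dep y ≡ suc k → inside x y ≡ reverse (lows k y)
    inside-up d d′ rewrite d | d′ = refl

    inside-down : ∀ {x y k} → dep x ≡ suc k → dep y ≡ 0 → inside x y ≡ lows k x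
    inside-down d d′ rewrite d | d′ = refl

    inside-reverse : ∀ x y → inside y x ≡ reverse (inside x y)
    inside-reverse x y with dep x | dep y
    ... | zero  | zero   = refl
    ... | zero  | suc k  = sym (Listₚ.reverse-involutive (lows k y))
    ... | suc k | zero   = refl
    ... | suc _ | suc _  = refl

    InTail : Rel (Fin n) 0ℓ
    InTail a y = base a ≡ base y × dep a ≢ 0 × dep a ℕ.< dep y

    ∈-inside⁻ : ∀ {x y a} → Link x y → a ∈ inside x y → (Tail x y × InTail a y) ⊎ (Tail y x × InTail a x)
    ∈-inside⁻ {x} {y} (inj₁ (_ , d , d′)) a∈ with inside x y | inside-spine {x} {y} d d′
    ∈-inside⁻ (inj₁ (_ , d , d′)) () | _ | refl
    ∈-inside⁻ {x} {y} {a} (inj₂ (inj₁ t@(_ , p))) a∈ with positive p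
    ... | k , d = inj₁ (t , ∈-lows⁻ k d (Any.reverse⁻ (subst (a ∈_) (inside-up {x} (tail-dep t) d) a∈)))
    ∈-inside⁻ {x} {y} {a} (inj₂ (inj₂ t@(_ , p))) a∈ with positive p
    ... | k , d = inj₂ (t , ∈-lows⁻ k d (subst (a ∈_) (inside-down {x} {y} d (tail-dep t)) a∈))

    ∈-inside⁺ : ∀ {x y a} → Tail x y → InTail a y → a ∈ inside x y
    ∈-inside⁺ {x} {y} {a} t@(_ , p) (b , q , lt) with positive p
    ... | k , d = subst (a ∈_) (sym (inside-up {x} (tail-dep t) d)) (Any.reverse⁺ (∈-lows⁺ k d b q lt))

    inside-unique : ∀ {x y} → Link x y → Unique (inside x y)
    inside-unique {x} {y} (inj₁ (_ , d , d′)) = subst Unique (sym (inside-spine {x} {y} d d′)) []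
    inside-unique {x} {y} (inj₂ (inj₁ t@(_ , p))) with positive p
    ... | k , d = subst Unique (sym (inside-up {x} (tail-dep t) d)) (unique-reverse (lows-unique k d))
    inside-unique {x} {y} (inj₂ (inj₂ t@(_ , p))) with positive p
    ... | k , d = subst Unique (sym (inside-down {x} {y} d (tail-dep t))) (lows-unique k d)

    inside-new : ∀ {x y} c → Link x y → element c ∉ inside x y
    inside-new c l c∈ with ∈-inside⁻ l c∈ | element-holds c
    ... | inj₁ (_ , _ , p , _) | inj₁ d = p d
    ... | inj₂ (_ , _ , p , _) | inj₁ d = p d
    ... | inj₁ (_ , b , _ , lt) | inj₂ top = ℕₚ.<⇒≱ lt (topmost-max top (sym b))
    ... | inj₂ (_ , b , _ , lt) | inj₂ top = ℕₚ.<⇒≱ lt (topmost-max top (sym b))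

    common-end : ∀ {a} u v x y → Tail (element u) (element v) → Tail (element x) (element y) →
                 InTail a (element v) → InTail a (element y) → u ≡ x × v ≡ y
    common-end u v x y t@(b , _) t′@(b′ , _) (c , _) (c′ , _)
      with element-injective (topmost-unique (tail-topmost v t) (tail-topmost y t′) (trans (sym c) c′))
    ... | refl = element-injective (trans (sym b) b′) , refl

    inside-disjoint : ∀ {a} u v x y → Link (element u) (element v) → Link (element x) (element y) →
                      a ∈ inside (element u) (element v) → a ∈ inside (element x) (element y) →
                      (u ≡ x × v ≡ y) ⊎ (u ≡ y × v ≡ x)
    inside-disjoint u v x y l l′ a∈ a∈′ with ∈-inside⁻ l a∈ | ∈-inside⁻ l′ a∈′
    ... | inj₁ (t , i) | inj₁ (t′ , i′) = inj₁ (common-end u v x y t t′ i i′)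
    ... | inj₁ (t , i) | inj₂ (t′ , i′) = inj₂ (common-end u v y x t t′ i i′)
    ... | inj₂ (t , i) | inj₁ (t′ , i′) = inj₂ (swap (common-end v u x y t t′ i i′))
    ... | inj₂ (t , i) | inj₂ (t′ , i′) = inj₁ (swap (common-end v u y x t t′ i i′))

    -- The subdivided edge, read from the spine to the end of the tail, is the reverse of a descending list.
    segment-up : ∀ {x y k} → Tail x y → dep y ≡ suc k → x ∷ inside x y ++ [ y ] ≡ reverse (y ∷ lows k y ++ [ base y ])
    segment-up {x} {y} {k} t@(b , _) d = trans (cong (λ zs → x ∷ zs ++ [ y ]) (inside-up {x} (tail-dep t) d))
      (trans (cong (_∷ reverse (lows k y) ++ [ y ]) (sym b)) (sym (reverse-ends y (lows k y) (base y))))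

    segment-down : ∀ {x y k} → Tail y x → dep x ≡ suc k → x ∷ inside x y ++ [ y ] ≡ x ∷ lows k x ++ [ base x ]
    segment-down {x} {y} {k} t@(b , _) d = cong (x ∷_) (cong₂ (λ zs z → zs ++ [ z ]) (inside-down {x} {y} d (tail-dep t)) (sym b))

    consecutive⇒adj : ∀ {x y a b} → Link x y → Consecutive a b (x ∷ inside x y ++ [ y ]) → Adj G a b
    consecutive⇒adj {x} {y} {a} {b} (inj₁ (e , d , d′)) c = linked-consecutive (e ∷ [-])
      (subst (λ zs → Consecutive a b (x ∷ zs ++ [ y ])) (inside-spine {x} {y} d d′) c)
    consecutive⇒adj {x} {y} {a} {b} (inj₂ (inj₁ t@(_ , p))) c with positive p
    ... | k , d = symmetric G (linked-consecutive (tail-linked k d)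
      (subst (Consecutive b a) (Listₚ.reverse-involutive (y ∷ lows k y ++ [ base y ]))
        (consecutive-reverse (subst (Consecutive a b) (segment-up t d) c))))
    consecutive⇒adj {x} {y} {a} {b} (inj₂ (inj₂ t@(_ , p))) c with positive p
    ... | k , d = linked-consecutive (tail-linked k d) (subst (Consecutive a b) (segment-down t d) c)

    OnSegment : Rel (Fin n) 0ℓ
    OnSegment a b = ∃[ u ] ∃[ v ] (Adj K u v ×
                      Consecutive a b (element u ∷ inside (element u) (element v) ++ [ element v ]))

    tail-edge : ∀ v → dep v ≢ 0 →
                ∃[ x ] ∃[ y ] (Tail (element x) (element y) × base (element y) ≡ base v × dep v ℕ.≤ dep (element y))
    tail-edge v p with topmost-exists D v (ℕₚ.m≤m+n D (dep v))
    ... | y , b , le , top with index (inj₂ top)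
    ...   | i , refl = idx (dep-base v) , i , (trans b (sym (element-idx _)) , (λ z → p (ℕₚ.n≤0⇒n≡0 (subst (dep v ℕ.≤_) z le)))) , b , le

    up-edge : ∀ {a b} → Up a b → OnSegment a b × OnSegment b a
    up-edge {a} {b} up@(_ , _ , db) with tail-edge b (λ z → 0≢suc z db)
    ... | x , y , t@(_ , p) , eq , le with positive p
    ...   | k , d with tail-consecutive k d up (sym eq) le
    ...     | c = (x , y , inj₂ (inj₁ t) , subst (Consecutive a b) (sym (segment-up t d)) (consecutive-reverse c)) ,
                  (y , x , inj₂ (inj₂ t) , subst (Consecutive b a) (sym (segment-down t d)) c)

    spine-edge : ∀ {a b} → Adj G a b → dep a ≡ 0 → dep b ≡ 0 → OnSegment a b
    spine-edge {a} {b} e d d′ with index (inj₁ d) | index (inj₁ d′)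
    ... | u , refl | v , refl = u , v , inj₁ (e , d , d′) , [] , [] ,
          cong (λ zs → element u ∷ zs ++ [ element v ]) (inside-spine {element u} {element v} d d′)

    adj⇒consecutive : ∀ {a b} → Adj G a b → OnSegment a b
    adj⇒consecutive e with step e
    ... | forth d d′ _ = spine-edge e d d′
    ... | back d d′ _  = spine-edge e d d′
    ... | rise p d     = proj₁ (up-edge (e , p , d))
    ... | fall p d     = proj₂ (up-edge (symmetric G e , sym p , d))

    all-vertices : ∀ a → (∃[ u ] a ≡ element u) ⊎ (∃[ u ] ∃[ v ] (Adj K u v × a ∈ inside (element u) (element v)))
    all-vertices a with dep a ℕₚ.≟ 0
    ... | yes d = inj₁ (idx d , sym (element-idx d))
    ... | no p with tail-edge a p
    ...   | x , y , t , b , le with dep a ℕₚ.≟ dep (element y)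
    ...     | yes eq = inj₁ (y , same-base-dep (sym b) eq)
    ...     | no neq = inj₂ (x , y , inj₂ (inj₁ t) , ∈-inside⁺ t (sym b , p , ℕₚ.≤∧≢⇒< le neq))

  comb⇒subdivided-caterpillar : IsSubdividedCaterpillar G
  comb⇒subdivided-caterpillar = tree , size , K , K-caterpillar , record
    { branch = element
    ; inner = λ u v → inside (element u) (element v)
    ; branch-injective = element-injective
    ; inner-reverse = λ {u} {v} _ → inside-reverse (element u) (element v)
    ; inner-unique = inside-unique
    ; inner-new = λ l c → inside-new c l
    ; inner-disjoint = λ {u} {v} {x} {y} → λ l l′ → inside-disjoint u v x y l l′
    ; vertices = all-vertices
    ; edges = λ a b → mk⇔ adj⇒consecutive (λ (u , v , l , c) → consecutive⇒adj l c) }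

forest-subgraph : ∀ {k n} {F : Graph k} {G : Graph n} → Subgraph F G → IsForest G → IsForest F
forest-subgraph {F = F} {G} S forest u v vs w (es , un) wu =
  forest (embed S u) (embed S v) (List.map (embed S) vs) (embed S w)
    (subst (IsPath G) (cong (λ xs → embed S u ∷ embed S v ∷ xs) (Listₚ.map-++ (embed S) vs [ w ]))
      (Linkedₚ.map⁺ (linked-map (embed-adj S) es) , Unique.map⁺ (embed-injective S) un))
    (embed-adj S wu)

-- The comb restricts to each component: the vertex supplied by `lower` is a neighbour and so stays
-- in the component.
comb⇒subdivided-caterpillar-forest : ∀ {n} {G : Graph n} → IsForest G → Representatives G → Comb G →
                                     IsSubdividedCaterpillarForest G
comb⇒subdivided-caterpillar-forest {n} {G} forest reps C = forest , component
  where
  open Representatives reps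
  module C = Comb C

  component : ∀ v → ∃[ k ] Σ[ H ∈ Graph k ] (IsComponent H G v × IsSubdividedCaterpillar H)
  component v = size , H , record { subgraph = S ; induced = id ; vertices = reached } ,
    ContractedComb.comb⇒subdivided-caterpillar H-comb
      (ℕₚ.≤-<-trans z≤n (toℕ<n (proj₁ (index refl))) , H-connected , forest-subgraph S forest)
    where
    open Enumeration (enumerate λ w → rep w ≟ rep v)

    H : Graph size
    H = record { Adj = λ i j → Adj G (element i) (element j) ; adj? = λ i j → adj? G (element i) (element j)
               ; symmetric = symmetric G ; loopless = loopless G }

    S : Subgraph H G
    S = record { embed = element ; embed-injective = element-injective ; embed-adj = id }

    reached : ∀ w → (∃[ i ] element i ≡ w) ⇔ Star (Adj G) v w
    reached w = mk⇔ (λ { (i , refl) → same-rep⇒walk (sym (element-holds i)) }) (λ es → index (sym (rep-star es)))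

    lift : ∀ {i j x y} → element i ≡ x → element j ≡ y → Star (Adj G) x y → Star (Adj H) i j
    lift p q ε with element-injective (trans p (sym q))
    ... | refl = ε
    lift {i} refl q (e ◅ es) with index (trans (sym (rep-adj e)) (element-holds i))
    ... | k , eq = subst (Adj G (element i)) (sym eq) e ◅ lift eq q es

    H-connected : Connected H
    H-connected i j = lift refl refl (same-rep⇒walk (trans (element-holds i) (sym (element-holds j))))

    H-comb : Comb H
    H-comb = record
      { pos = C.pos ∘ element ; dep = C.dep ∘ element
      ; step = λ e → transfer (C.step e)
      ; locally-injective = λ e e′ p d → element-injective (C.locally-injective e e′ p d)
      ; lower = H-lower }
      where
      transfer : ∀ {i j} → Step C.pos C.dep (element i) (element j) → Step (C.pos ∘ element) (C.dep ∘ element) i j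
      transfer (forth d d′ p) = forth d d′ p
      transfer (back d d′ p)  = back d d′ p
      transfer (rise p d)     = rise p d
      transfer (fall p d)     = fall p d
      H-lower : ∀ {i e} → C.dep (element i) ≡ suc e →
                ∃[ j ] (Adj H i j × C.pos (element j) ≡ C.pos (element i) × C.dep (element j) ≡ e)
      H-lower {i} d with C.lower d
      ... | w , a , p , d′ with index (trans (sym (rep-adj a)) (element-holds i))
      ...   | j , refl = j , a , p , d′

-- Subdivided caterpillars of maximum degree three

cert-⊑ : ∀ {n} {G H : Graph n} {Bare} → H ⊑ G → Cert G Bare → Cert H Bare
cert-⊑ sub cert = record
  { no-four = λ a b c d → no-four (sub a) (sub b) (sub c) (sub d)
  ; bare-branch = λ a b c → bare-branch (sub a) (sub b) (sub c)
  ; bare-next = λ B e → bare-next B (sub e)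
  ; bare-unique = λ B e e′ → bare-unique B (sub e) (sub e′) }
  where open Cert cert

module _ {n : ℕ} (G : Graph n) where

  -- The directed edges reached by walks that start with `v`, `w` and never turn back; in a forest
  -- they make up the branch at `v` through `w`.
  data Beyond (v w : Fin n) : Fin n → Fin n → Set where
    start  : Beyond v w v w
    onward : ∀ {a b c} → Beyond v w a b → Adj G b c → c ≢ a → Beyond v w b c

  BareBranch : Rel (Fin n) 0ℓ
  BareBranch v w = ∀ {a b} → Beyond v w a b → ∀ {c c′} → Adj G b c → Adj G b c′ → c ≢ a → c′ ≢ a → c ≡ c′

  beyond-next : ∀ {v w z a b} → Adj G w z → z ≢ v → Beyond w z a b → Beyond v w a b
  beyond-next e z≢v start           = onward start e z≢v
  beyond-next e z≢v (onward B f c≢) = onward (beyond-next e z≢v B) f c≢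

module _ {A : Set} where

  unique-⊆⇒length≤ : ∀ {xs ys : List A} → Unique xs → All (_∈ ys) xs → length xs ℕ.≤ length ys
  unique-⊆⇒length≤ [] _ = z≤n
  unique-⊆⇒length≤ {x ∷ xs} (x∉ ∷ u) (x∈ ∷ ⊆ys) with Mem.∈-∃++ x∈
  ... | as , bs , refl = ℕₚ.≤-trans (s≤s (unique-⊆⇒length≤ u (All.zipWith (λ { {z} (z∈ , x≢z) → elsewhere z∈ x≢z }) (⊆ys , x∉))))
        (ℕₚ.≤-reflexive (trans (cong suc (Listₚ.length-++ as)) (sym (trans (Listₚ.length-++ as) (ℕₚ.+-suc (length as) (length bs))))))
    where
    elsewhere : ∀ {z} → z ∈ as ++ x ∷ bs → x ≢ z → z ∈ as ++ bs
    elsewhere z∈ x≢z with Mem.∈-++⁻ as z∈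
    ... | inj₁ z∈as          = Mem.∈-++⁺ˡ z∈as
    ... | inj₂ (here eq)     = contradiction (sym eq) x≢z
    ... | inj₂ (there z∈bs)  = Mem.∈-++⁺ʳ as z∈bs

  consecutive-∈ˡ : ∀ {a b : A} {xs} → Consecutive a b xs → a ∈ xs
  consecutive-∈ˡ (ys , zs , refl) = Mem.∈-++⁺ʳ ys (here refl)

  consecutive-∈ʳ : ∀ {a b : A} {xs} → Consecutive a b xs → b ∈ xs
  consecutive-∈ʳ (ys , zs , refl) = Mem.∈-++⁺ʳ ys (there (here refl))

  consecutive-uncons : ∀ {a b x : A} {xs} → Consecutive a b (x ∷ xs) →
                       (a ≡ x × ∃[ zs ] xs ≡ b ∷ zs) ⊎ Consecutive a b xs
  consecutive-uncons ([] , zs , refl)     = inj₁ (refl , zs , refl)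
  consecutive-uncons (_ ∷ ys , zs , refl) = inj₂ (ys , zs , refl)

  successor-unique : ∀ {a b c : A} {xs} → Unique xs → Consecutive a b xs → Consecutive a c xs → b ≡ c
  successor-unique {xs = []} _ ([] , _ , ()) _
  successor-unique {xs = []} _ (_ ∷ _ , _ , ()) _
  successor-unique {xs = x ∷ xs} (x∉ ∷ u) p q with consecutive-uncons p | consecutive-uncons q
  ... | inj₁ (refl , _ , refl) | inj₁ (_ , _ , refl) = refl
  ... | inj₂ p′ | inj₂ q′ = successor-unique u p′ q′
  ... | inj₁ (refl , _) | inj₂ q′ = contradiction refl (All.lookup x∉ (consecutive-∈ˡ q′))
  ... | inj₂ p′ | inj₁ (refl , _) = contradiction refl (All.lookup x∉ (consecutive-∈ˡ p′))

  head-has-no-predecessor : ∀ {a b : A} {xs} → Unique (b ∷ xs) → ¬ Consecutive a b (b ∷ xs)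
  head-has-no-predecessor (b∉ ∷ _) c with consecutive-uncons c
  ... | inj₁ (_ , _ , refl) = All.lookup b∉ (here refl) refl
  ... | inj₂ c′             = All.lookup b∉ (consecutive-∈ʳ c′) refl

  predecessor-unique : ∀ {a b c : A} {xs} → Unique xs → Consecutive a c xs → Consecutive b c xs → a ≡ b
  predecessor-unique u p q = successor-unique (unique-reverse u) (consecutive-reverse p) (consecutive-reverse q)

  pigeonhole : ∀ {P Q : A → Set} {a b c} → (∀ {x y} → P x → P y → x ≡ y) → (∀ {x y} → Q x → Q y → x ≡ y) →
               a ≢ b → a ≢ c → b ≢ c → P a ⊎ Q a → P b ⊎ Q b → P c ⊎ Q c → ⊥
  pigeonhole P! Q! ab ac bc (inj₁ p) (inj₁ q) _        = ab (P! p q)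
  pigeonhole P! Q! ab ac bc (inj₂ p) (inj₂ q) _        = ab (Q! p q)
  pigeonhole P! Q! ab ac bc (inj₁ p) (inj₂ q) (inj₁ r) = ac (P! p r)
  pigeonhole P! Q! ab ac bc (inj₁ p) (inj₂ q) (inj₂ r) = bc (Q! q r)
  pigeonhole P! Q! ab ac bc (inj₂ p) (inj₁ q) (inj₁ r) = bc (P! q r)
  pigeonhole P! Q! ab ac bc (inj₂ p) (inj₁ q) (inj₂ r) = ac (Q! p r)

  linked-prefix : ∀ {R : Rel A 0ℓ} xs {ys} → Linked R (xs ++ ys) → Linked R xs
  linked-prefix [] _ = []
  linked-prefix (x ∷ []) _ = [-]
  linked-prefix (x ∷ y ∷ xs) (e ∷ es) = e ∷ linked-prefix (y ∷ xs) es

  unique-prefix : ∀ (xs : List A) {ys} → Unique (xs ++ ys) → Unique xs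
  unique-prefix [] _ = []
  unique-prefix (x ∷ xs) (x∉ ∷ u) = All.++⁻ˡ xs x∉ ∷ unique-prefix xs u

degree-≥ : ∀ {n} (G : Graph n) {v} xs → Unique xs → All (Adj G v) xs → length xs ℕ.≤ degree G v
degree-≥ G xs u es = unique-⊆⇒length≤ u (All.map (∈-neighbours G) es)

linked-tail : ∀ {A : Set} {R : Rel A 0ℓ} {x xs} → Linked R (x ∷ xs) → Linked R xs
linked-tail [-]      = []
linked-tail (_ ∷ es) = es

-- The part of the path between the ends of a chord would close to a cycle with it.
path-chordless : ∀ {n} {G : Graph n} → IsForest G → ∀ {u x xs} → IsPath G xs → u ∈ xs → x ∈ xs → Adj G u x →
                 Consecutive u x xs ⊎ Consecutive x u xs
path-chordless {n} {G} forest = go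
  where
  from-head : ∀ {u x xs} → IsPath G (u ∷ xs) → x ∈ xs → Adj G x u → Consecutive u x (u ∷ xs)
  from-head _ (here refl) _ = [] , _ , refl
  from-head {u} {x} {y ∷ _} (l , un) (there x∈) e with Mem.∈-∃++ x∈
  ... | ms , bs , refl = contradiction e (forest u y ms x
    (linked-prefix (u ∷ y ∷ ms ++ [ x ]) (subst (Linked (Adj G)) eq l) ,
     unique-prefix (u ∷ y ∷ ms ++ [ x ]) (subst Unique eq un)))
    where eq = cong (λ zs → u ∷ y ∷ zs) (sym (Listₚ.++-assoc ms [ x ] bs))

  go : ∀ {u x xs} → IsPath G xs → u ∈ xs → x ∈ xs → Adj G u x → Consecutive u x xs ⊎ Consecutive x u xs
  go p (here refl) (here refl) e = contradiction e (loopless G)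
  go p (here refl) (there x∈)  e = inj₁ (from-head p x∈ (symmetric G e))
  go p (there u∈)  (here refl) e = inj₂ (from-head p u∈ e)
  go (l , _ ∷ u) (there u∈) (there x∈) e with go (linked-tail l , u) u∈ x∈ e
  ... | inj₁ c = inj₁ (consecutive-∷ c)
  ... | inj₂ c = inj₂ (consecutive-∷ c)

module _ {n m : ℕ} {G : Graph n} {C : Graph m} (caterpillar : IsCaterpillar C) (subdivision : IsSubdivision C G) where

  open IsSubdivision subdivision

  private
    C-forest : IsForest C
    C-forest = proj₂ (proj₂ (proj₁ caterpillar))

    spine : List (Fin m)
    spine = proj₁ (proj₂ caterpillar) ∷ proj₁ (proj₂ (proj₂ caterpillar))

    spine-path : IsPath C spine
    spine-path = proj₁ (proj₂ (proj₂ (proj₂ caterpillar)))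

    spine-covers : ∀ u → 1 ℕ.< degree C u → u ∈ spine
    spine-covers = proj₂ (proj₂ (proj₂ (proj₂ caterpillar)))

    segment : Fin m → Fin m → List (Fin n)
    segment u w = branch u ∷ inner u w ++ [ branch w ]

    segment-reverse : ∀ {u w} → Adj C u w → segment w u ≡ reverse (segment u w)
    segment-reverse {u} {w} e = trans (cong (λ zs → branch w ∷ zs ++ [ branch u ]) (inner-reverse e))
      (sym (reverse-ends (branch u) (inner u w) (branch w)))

    segment-unique : ∀ {u w} → Adj C u w → Unique (segment u w)
    segment-unique {u} {w} e = All.¬Any⇒All¬ _ not-later ∷
      Unique.++⁺ (inner-unique e) ([] ∷ []) λ { (w∈ , here refl) → inner-new e w w∈ }
      where
      not-later : branch u ∉ inner u w ++ [ branch w ]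
      not-later u∈ with Mem.∈-++⁻ (inner u w) u∈
      ... | inj₁ u∈i       = inner-new e u u∈i
      ... | inj₂ (here eq) = adj⇒≢ C e (branch-injective eq)

    segment-flip : ∀ {u w a b} → Adj C u w → Consecutive a b (segment w u) → Consecutive b a (segment u w)
    segment-flip {u} {w} {a} {b} e c = subst (Consecutive b a) (sym (segment-reverse (symmetric C e))) (consecutive-reverse c)

    segment-∈ : ∀ {u w a} → a ∈ segment u w → a ≡ branch u ⊎ a ∈ inner u w ⊎ a ≡ branch w
    segment-∈ (here eq) = inj₁ eq
    segment-∈ {u} {w} (there a∈) with Mem.∈-++⁻ (inner u w) a∈
    ... | inj₁ a∈i       = inj₂ (inj₁ a∈i)
    ... | inj₂ (here eq) = inj₂ (inj₂ eq)

    edge-segment : ∀ {a b} → Adj G a b → ∃[ u ] ∃[ w ] (Adj C u w × Consecutive a b (segment u w))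
    edge-segment {a} {b} = Equivalence.to (edges a b)

    branch-edge : ∀ {u x} → Adj G (branch u) x → ∃[ w ] (Adj C u w × Consecutive (branch u) x (segment u w))
    branch-edge e with edge-segment e
    ... | u′ , w′ , e′ , c with segment-∈ {u′} {w′} (consecutive-∈ˡ c)
    ...   | inj₂ (inj₁ u∈) = contradiction u∈ (inner-new e′ _)
    ...   | inj₁ eq with branch-injective eq
    ...     | refl = w′ , e′ , c
    branch-edge e | u′ , w′ , e′ , c | inj₂ (inj₂ eq) with branch-injective eq
    ...     | refl = contradiction (segment-flip (symmetric C e′) c)
                       (head-has-no-predecessor (segment-unique (symmetric C e′)))

    inner-edge : ∀ {u w b c} → Adj C u w → b ∈ inner u w → Adj G b c →
                 Consecutive b c (segment u w) ⊎ Consecutive c b (segment u w)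
    inner-edge e b∈ bc with edge-segment bc
    ... | u′ , w′ , e′ , c with segment-∈ {u′} {w′} (consecutive-∈ˡ c)
    ...   | inj₁ refl        = contradiction b∈ (inner-new e _)
    ...   | inj₂ (inj₂ refl) = contradiction b∈ (inner-new e _)
    ...   | inj₂ (inj₁ b∈′) with inner-disjoint e e′ b∈ b∈′
    ...     | inj₁ (refl , refl) = inj₁ c
    ...     | inj₂ (refl , refl) = inj₂ (segment-flip e c)

    beyond-leaf : ∀ {u x v a p q} → Adj C u x → (∀ {w} → Adj C x w → w ≡ u) → Consecutive v a (segment u x) →
                  Beyond G v a p q → Consecutive p q (segment u x)

    -- A walk towards the leaf has nowhere else to go: inner vertices have all their neighbours on
    -- the segment, and the only segment at the leaf is the same one, traversed backwards.
    leaf-continues : ∀ {u x p q c} → Adj C u x → (∀ {w} → Adj C x w → w ≡ u) → Consecutive p q (segment u x) →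
                     Adj G q c → c ≢ p → Consecutive q c (segment u x)
    leaf-continues {u} {x} e leaf pq qc c≢p with segment-∈ {u} {x} (consecutive-∈ʳ pq)
    ... | inj₁ refl = contradiction pq (head-has-no-predecessor (segment-unique e))
    ... | inj₂ (inj₁ q∈) with inner-edge e q∈ qc
    ...   | inj₁ next = next
    ...   | inj₂ prev = contradiction (predecessor-unique (segment-unique e) prev pq) c≢p
    leaf-continues {u} {x} e leaf pq qc c≢p | inj₂ (inj₂ refl) with branch-edge qc
    ... | w , xw , c with leaf xw
    ...   | refl = contradiction (predecessor-unique (segment-unique e) (segment-flip e c) pq) c≢p

    beyond-leaf e leaf va start           = va
    beyond-leaf e leaf va (onward B f c≢) = leaf-continues e leaf (beyond-leaf e leaf va B) f c≢

    -- Off the spine `x` cannot have a second neighbour besides `u`, so the segment leads to a leaf.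
    leaf-bare : ∀ {u x v a} → Adj C u x → x ∉ spine → Consecutive v a (segment u x) → BareBranch G v a
    leaf-bare {u} {x} e x∉ va B bc bc′ c≢ c′≢ = successor-unique (segment-unique e)
      (leaf-continues e leaf (beyond-leaf e leaf va B) bc c≢) (leaf-continues e leaf (beyond-leaf e leaf va B) bc′ c′≢)
      where
      leaf : ∀ {w} → Adj C x w → w ≡ u
      leaf {w} xw with w ≟ u
      ... | yes eq = eq
      ... | no w≢u = contradiction (spine-covers x (degree-≥ C (w ∷ u ∷ []) ((w≢u ∷ []) ∷ [] ∷ []) (xw ∷ symmetric C e ∷ []))) x∉

  -- An inner vertex has at most two neighbours. From a branch vertex three segments lead to
  -- distinct vertices of `C`. At most two of these can lie on the spine, which is chordless; a
  -- remaining one is a leaf.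
  subdivided-caterpillar-bare : ∀ {v a b c} → Adj G v a → Adj G v b → Adj G v c → a ≢ b → a ≢ c → b ≢ c →
                                BareBranch G v a ⊎ BareBranch G v b ⊎ BareBranch G v c
  subdivided-caterpillar-bare {v} va vb vc ab ac bc with vertices v
  ... | inj₂ (u , w , e , v∈) = ⊥-elim (pigeonhole (successor-unique (segment-unique e)) (predecessor-unique (segment-unique e))
          ab ac bc (inner-edge e v∈ va) (inner-edge e v∈ vb) (inner-edge e v∈ vc))
  ... | inj₁ (u , refl) with branch-edge va | branch-edge vb | branch-edge vc
  ...   | x , ux , cx | y , uy , cy | z , uz , cz
        with DecMembership._∈?_ _≟_ x spine | DecMembership._∈?_ _≟_ y spine | DecMembership._∈?_ _≟_ z spine
  ...     | no x∉  | _      | _      = inj₁ (leaf-bare ux x∉ cx)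
  ...     | yes _  | no y∉  | _      = inj₂ (inj₁ (leaf-bare uy y∉ cy))
  ...     | yes _  | yes _  | no z∉  = inj₂ (inj₂ (leaf-bare uz z∉ cz))
  ...     | yes x∈ | yes y∈ | yes z∈ = ⊥-elim (pigeonhole (successor-unique (proj₂ spine-path)) (predecessor-unique (proj₂ spine-path))
              (distinct ux cx cy ab) (distinct ux cx cz ac) (distinct uy cy cz bc)
              (path-chordless {G = C} C-forest spine-path u∈ x∈ ux) (path-chordless {G = C} C-forest spine-path u∈ y∈ uy)
              (path-chordless {G = C} C-forest spine-path u∈ z∈ uz))
    where
    distinct : ∀ {w w′ s t} → Adj C u w → Consecutive (branch u) s (segment u w) →
               Consecutive (branch u) t (segment u w′) → s ≢ t → w ≢ w′
    distinct e p q s≢t refl = s≢t (successor-unique (segment-unique e) p q)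
    u∈ : u ∈ spine
    u∈ = spine-covers u (degree-≥ C (x ∷ y ∷ []) ((distinct ux cx cy ab ∷ []) ∷ [] ∷ []) (ux ∷ uy ∷ []))

module _ {n : ℕ} {F : Graph n} (scf : IsSubdividedCaterpillarForest F) (max-degree : MaxDegree≤ 3 F) where

  private
    module _ {k : ℕ} {H : Graph k} {v : Fin n} (component : IsComponent H F v) where

      open IsComponent component

      e : Fin k → Fin n
      e = embed subgraph

      neighbour-inside : ∀ {i w} → Adj F (e i) w → ∃[ j ] (e j ≡ w × Adj H i j)
      neighbour-inside {i} iw with Equivalence.from (vertices _) (Equivalence.to (vertices _) (i , refl) ▷ iw)
      ... | j , refl = j , refl , induced iw

      beyond-inside : ∀ {i j a b} → Beyond F (e i) (e j) a b → ∃[ p ] ∃[ q ] (e p ≡ a × e q ≡ b × Beyond H i j p q)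
      beyond-inside start = _ , _ , refl , refl , start
      beyond-inside (onward B bc c≢) with beyond-inside B
      ... | p , q , refl , refl , B′ with neighbour-inside bc
      ...   | r , refl , qr = q , r , refl , refl , onward B′ qr (λ { refl → c≢ refl })

      -- Edges of `F` never leave a component, so neither do the walks that test bareness.
      bare-outside : ∀ {i j} → BareBranch H i j → BareBranch F (e i) (e j)
      bare-outside bare B bc bc′ c≢ c′≢ with beyond-inside B
      ... | p , q , refl , refl , B′ with neighbour-inside bc | neighbour-inside bc′
      ...   | r , refl , qr | r′ , refl , qr′ =
        cong e (bare B′ qr qr′ (λ { refl → c≢ refl }) (λ { refl → c′≢ refl }))

      branch-inside : IsSubdividedCaterpillar H → ∀ {i a b c} → Adj F (e i) a → Adj F (e i) b → Adj F (e i) c →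
                      a ≢ b → a ≢ c → b ≢ c → BareBranch F (e i) a ⊎ BareBranch F (e i) b ⊎ BareBranch F (e i) c
      branch-inside (_ , _ , _ , cat , sub) va vb vc ab ac bc
        with neighbour-inside va | neighbour-inside vb | neighbour-inside vc
      ... | a , refl , ia | b , refl , ib | c , refl , ic
          with subdivided-caterpillar-bare cat sub ia ib ic (λ { refl → ab refl }) (λ { refl → ac refl }) (λ { refl → bc refl })
      ...   | inj₁ bare        = inj₁ (bare-outside bare)
      ...   | inj₂ (inj₁ bare) = inj₂ (inj₁ (bare-outside bare))
      ...   | inj₂ (inj₂ bare) = inj₂ (inj₂ (bare-outside bare))

      branch-outside : IsSubdividedCaterpillar H → ∀ {a b c} → Adj F v a → Adj F v b → Adj F v c →
                       a ≢ b → a ≢ c → b ≢ c → BareBranch F v a ⊎ BareBranch F v b ⊎ BareBranch F v c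
      -- The component of `v` contains `v`, which is therefore of the form `e i`.
      branch-outside sc {a} {b} {c} = subst (λ x → Adj F x a → Adj F x b → Adj F x c → a ≢ b → a ≢ c → b ≢ c →
                                             BareBranch F x a ⊎ BareBranch F x b ⊎ BareBranch F x c)
        (proj₂ (Equivalence.from (vertices v) ε)) (branch-inside sc)

  subdivided-caterpillar-forest⇒cert : Cert F (BareBranch F)
  subdivided-caterpillar-forest⇒cert = record
    { no-four = λ {v} {a} {b} {c} {d} va vb vc vd ab ac ad bc bd cd → ℕₚ.<⇒≱ (ℕₚ.n<1+n 3) (ℕₚ.≤-trans
        (degree-≥ F (a ∷ b ∷ c ∷ d ∷ []) ((ab ∷ ac ∷ ad ∷ []) ∷ (bc ∷ bd ∷ []) ∷ (cd ∷ []) ∷ [] ∷ [])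
          (va ∷ vb ∷ vc ∷ vd ∷ [])) (max-degree v))
    ; bare-branch = λ {v} → let (_ , _ , component , sc) = proj₂ scf v in branch-outside component sc
    ; bare-next = λ bare wz z≢v B → bare (beyond-next F wz z≢v B)
    ; bare-unique = λ bare wz wz′ → bare start wz wz′ }

module _ {k n : ℕ} {F : Graph k} {T : Graph n} (S : Subgraph F T) where

  -- On the vertex set of `T`, with the missing vertices isolated, both forests can be handled
  -- together.
  image : Graph n
  image = record
    { Adj = EdgeOf S
    ; adj? = λ v w → any? λ i → any? λ j → (embed S i ≟ v) ×-dec (embed S j ≟ w) ×-dec adj? F i j
    ; symmetric = λ (i , j , p , q , e) → j , i , q , p , symmetric F e
    ; loopless = λ (i , j , p , q , e) → adj⇒≢ F e (embed-injective S (trans p (sym q))) }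

  image-⊑ : image ⊑ T
  image-⊑ (_ , _ , refl , refl , e) = embed-adj S e

  image-cert : ∀ {Bare} → Cert F Bare → Cert image (λ v w → ∃[ i ] ∃[ j ] (embed S i ≡ v × embed S j ≡ w × Bare i j))
  image-cert {Bare} cert = record
    { no-four = image-no-four ; bare-branch = image-branch ; bare-next = image-next ; bare-unique = image-unique }
    where
    open Cert cert
    B′ : Rel (Fin n) 0ℓ
    B′ v w = ∃[ i ] ∃[ j ] (embed S i ≡ v × embed S j ≡ w × Bare i j)

    from : ∀ {i w} → EdgeOf S (embed S i) w → ∃[ j ] (embed S j ≡ w × Adj F i j)
    from (i′ , j , p , q , e) with embed-injective S p
    ... | refl = j , q , e

    image-no-four : ∀ {v a b c d} → EdgeOf S v a → EdgeOf S v b → EdgeOf S v c → EdgeOf S v d →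
                    a ≢ b → a ≢ c → a ≢ d → b ≢ c → b ≢ d → c ≢ d → ⊥
    image-no-four (_ , _ , refl , refl , ea) vb vc vd ab ac ad bc bd cd with from vb | from vc | from vd
    ... | _ , refl , eb | _ , refl , ec | _ , refl , ed = no-four ea eb ec ed
      (λ { refl → ab refl }) (λ { refl → ac refl }) (λ { refl → ad refl })
      (λ { refl → bc refl }) (λ { refl → bd refl }) (λ { refl → cd refl })

    image-branch : ∀ {v a b c} → EdgeOf S v a → EdgeOf S v b → EdgeOf S v c → a ≢ b → a ≢ c → b ≢ c →
                   B′ v a ⊎ B′ v b ⊎ B′ v c
    image-branch (_ , _ , refl , refl , ea) vb vc ab ac bc with from vb | from vc
    ... | _ , refl , eb | _ , refl , ec
        with bare-branch ea eb ec (λ { refl → ab refl }) (λ { refl → ac refl }) (λ { refl → bc refl })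
    ...   | inj₁ bare        = inj₁ (_ , _ , refl , refl , bare)
    ...   | inj₂ (inj₁ bare) = inj₂ (inj₁ (_ , _ , refl , refl , bare))
    ...   | inj₂ (inj₂ bare) = inj₂ (inj₂ (_ , _ , refl , refl , bare))

    image-next : ∀ {v w z} → B′ v w → EdgeOf S w z → z ≢ v → B′ w z
    image-next (_ , _ , refl , refl , bare) wz z≢v with from wz
    ... | _ , refl , e = _ , _ , refl , refl , bare-next bare e (λ { refl → z≢v refl })

    image-unique : ∀ {v w z z′} → B′ v w → EdgeOf S w z → EdgeOf S w z′ → z ≢ v → z′ ≢ v → z ≡ z′
    image-unique (_ , _ , refl , refl , bare) wz wz′ z≢ z′≢ with from wz | from wz′
    ... | _ , refl , e | _ , refl , e′ =
      cong (embed S) (bare-unique bare e e′ (λ { refl → z≢ refl }) (λ { refl → z′≢ refl }))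

-- Horizontal visibility in a forest

-- `L v w` reads: `w` is on the chosen side of `v`; `flip L` is the mirror image. In `walk` the
-- level neighbour `w` has the same heights as `v` and so shares lines with every `w′` that `v`
-- sees. The walk is doubly negated because the obstructing squares are found only classically.
record Sided {n : ℕ} (H : Graph n) (Level L : Rel (Fin n) 0ℓ) : Set where
  field
    irrefl  : ∀ {v} → ¬ L v v
    trans-L : ∀ {u v w} → L u v → L v w → L u w
    side    : ∀ {v w} → Adj H v w → L v w ⊎ L w v
    walk    : ∀ {v w w′} → Level v w → Adj H v w → L v w → Adj H v w′ → L v w′ →
              ¬ ¬ Star (λ a b → Adj H a b × L v a × L v b) w w′
    walk⁻   : ∀ {v w w′} → Level v w → Adj H v w → L w v → Adj H v w′ → L w′ v →
              ¬ ¬ Star (λ a b → Adj H a b × L a v × L b v) w w′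

sided-flip : ∀ {n} {H : Graph n} {Level L} → Sided H Level L → Sided H Level (flip L)
sided-flip {H = H} S = record
  { irrefl = irrefl ; trans-L = flip trans-L ; side = side ∘ symmetric H ; walk = walk⁻ ; walk⁻ = walk }
  where open Sided S

-- `A x u` stands for `u` above, or else below, `x`. The squares `u` and `u′` both cross the line
-- through the upper, or lower, sides of the level squares `x` and `w`, and the squares along that
-- line join them.
record Tall {n : ℕ} (H : Graph n) (Level A : Rel (Fin n) 0ℓ) : Set where
  field
    irrefl    : ∀ {v} → ¬ A v v
    asym      : ∀ {v w} → A v w → ¬ A w v
    not-level : ∀ {v w} → A v w → ¬ Level v w
    walk      : ∀ {x w u u′} → Level x w → Adj H x u → A x u → Adj H w u′ → A w u′ →
                ¬ ¬ Star (λ a b → Adj H a b × A x a × A x b) u u′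

module ForestVisibility {n : ℕ} {H : Graph n} (forest : IsForest H) (Level Left Below : Rel (Fin n) 0ℓ)
  (level-refl : ∀ {v} → Level v v) (level-sym : Symmetric Level)
  (level-trans : ∀ {u v w} → Level u v → Level v w → Level u w)
  (compare : ∀ v w → Level v w ⊎ Below v w ⊎ Below w v)
  (leftward : Sided H Level Left) (above : Tall H Level Below) (below : Tall H Level (flip Below)) where

  LevelAdj : Rel (Fin n) 0ℓ
  LevelAdj v w = Adj H v w × Level v w

  private
    module _ {A : Rel (Fin n) 0ℓ} (tall : Tall H Level A) where

      open Tall tall

      away : ∀ {x u v w} → Star (λ a b → Adj H a b × A x a × A x b) v w → Star (Avoid H x u) v w
      away = Star.map λ (e , xa , xb) → e , (λ { (refl , _) → irrefl xa }) , (λ { (_ , refl) → irrefl xb })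

      one-above : ∀ {x u u′} → Adj H x u → A x u → Adj H x u′ → A x u′ → u ≡ u′
      one-above {x} {u} {u′} e a e′ a′ with u ≟ u′
      ... | yes eq = eq
      ... | no u≢u′ = ⊥-elim (walk level-refl e′ a′ e a λ es → edge-is-bridge H forest e
              ((e′ , (λ { (_ , refl) → u≢u′ refl }) , (λ { (refl , _) → irrefl a })) ◅ away es))

      -- Otherwise the edge from `x` to `u` would be bypassed: along the level walk to `w`, on to
      -- `u′`, and back to `u` through squares on the same vertical side of `x`.
      one-exit : ∀ {x w u u′} → Star LevelAdj x w → x ≢ w → Adj H x u → A x u → Adj H w u′ → ¬ A w u′
      one-exit {x} {w} {u} {u′} es x≢w e a e′ a′ = walk (level es) e a e′ a′ λ us → edge-is-bridge H forest e
        (Star.map (λ (f , l) → f , (λ { (refl , refl) → not-level a l }) , (λ { (refl , refl) → not-level a (level-sym l) })) es ◅◅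
         (e′ , (λ { (refl , _) → x≢w refl }) , (λ { (refl , refl) → asym a a′ })) ◅
         Star.reverse (avoid-sym H) (away us))
        where
        level : ∀ {x w} → Star LevelAdj x w → Level x w
        level ε = level-refl
        level ((_ , l) ◅ es) = level-trans l (level es)

    one-level-side : ∀ {L} → Sided H Level L → ∀ {v w w′} → LevelAdj v w → L v w → Adj H v w′ → L v w′ → w ≡ w′
    one-level-side sided {v} {w} {w′} (e , l) s e′ s′ with w ≟ w′
    ... | yes eq = eq
    ... | no w≢w′ = ⊥-elim (walk l e s e′ s′ λ es → edge-is-bridge H forest e
            ((e′ , (λ { (_ , refl) → w≢w′ refl }) , (λ { (refl , _) → loopless H e })) ◅
             Star.reverse (avoid-sym H) (Star.map
               (λ (f , va , vb) → f , (λ { (refl , _) → irrefl va }) , (λ { (_ , refl) → irrefl vb })) es)))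
      where open Sided sided

    rightward : Sided H Level (flip Left)
    rightward = sided-flip leftward

    -- Two level neighbours exhaust both sides of `v`, as each of them is alone on its side.
    two-level : ∀ {v a b c} → LevelAdj v a → LevelAdj v b → Adj H v c → a ≢ b → a ≢ c → b ≢ c → ⊥
    two-level va vb vc ab ac bc with Sided.side leftward (proj₁ va) | Sided.side leftward (proj₁ vb) | Sided.side leftward vc
    ... | inj₁ a | inj₁ b | _      = ab (one-level-side leftward va a (proj₁ vb) b)
    ... | inj₂ a | inj₂ b | _      = ab (one-level-side rightward va a (proj₁ vb) b)
    ... | inj₁ a | inj₂ b | inj₁ c = ac (one-level-side leftward va a vc c)
    ... | inj₁ a | inj₂ b | inj₂ c = bc (one-level-side rightward vb b vc c)
    ... | inj₂ a | inj₁ b | inj₁ c = bc (one-level-side leftward vb b vc c)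
    ... | inj₂ a | inj₁ b | inj₂ c = ac (one-level-side rightward va a vc c)

    Exit : Rel (Fin n) 0ℓ
    Exit v w = (Adj H v w × Below v w) ⊎ (Adj H v w × Below w v)

    three-exits : ∀ {v a b c} → Exit v a → Exit v b → Exit v c → a ≢ b → a ≢ c → b ≢ c → ⊥
    three-exits a b c ab ac bc = pigeonhole
      (λ (e , p) (e′ , p′) → one-above above e p e′ p′) (λ (e , p) (e′ , p′) → one-above below e p e′ p′) ab ac bc a b c

    classify : ∀ {v w} → Adj H v w → LevelAdj v w ⊎ Exit v w
    classify {v} {w} e with compare v w
    ... | inj₁ l        = inj₁ (e , l)
    ... | inj₂ (inj₁ p) = inj₂ (inj₁ (e , p))
    ... | inj₂ (inj₂ p) = inj₂ (inj₂ (e , p))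

    ThroughExits : Fin n → Set
    ThroughExits x = ∃[ u ] ∃[ d ] (Adj H x u × Below x u × Adj H x d × Below d x)

  -- At a vertex of degree three, with exits above and below, the third branch is level.
  data Bare : Rel (Fin n) 0ℓ where
    base : ∀ {x w} → ThroughExits x → LevelAdj x w → Bare x w
    next : ∀ {v w z} → Bare v w → Adj H w z → z ≢ v → Bare w z

  private
    -- The invariant of a bare branch: it stays level and moves always to one side of a vertex with
    -- exits above and below. Lying strictly beyond this origin makes `w` distinct from it, as
    -- `one-exit` requires.
    record Run (L : Rel (Fin n) 0ℓ) (v w : Fin n) : Set where
      constructor run
      field
        {origin} : Fin n
        exits    : ThroughExits origin
        path     : Star LevelAdj origin w
        step     : LevelAdj v w
        beyond   : L v w
        away-from-origin : L origin w

    -- An exit at `w` would repeat an exit of the origin on the same level; a step to the other side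
    -- could only be the return to `v`, which is alone there.
    run-continues : ∀ {L} → Sided H Level L → ∀ {v w z} → Run L v w → Adj H w z → z ≢ v → LevelAdj w z × L w z
    run-continues sided {v} {w} {z} (run (u , d , xu , u↑ , xd , d↓) path (vw , l) beyond away) wz z≢v with classify wz
    ... | inj₂ (inj₁ (_ , p)) = ⊥-elim (one-exit above path (λ { refl → Sided.irrefl sided away }) xu u↑ wz p)
    ... | inj₂ (inj₂ (_ , p)) = ⊥-elim (one-exit below path (λ { refl → Sided.irrefl sided away }) xd d↓ wz p)
    ... | inj₁ wz′ with Sided.side sided wz
    ...   | inj₁ s = wz′ , s
    ...   | inj₂ s = contradiction (sym (one-level-side (sided-flip sided) (symmetric H vw , level-sym l) beyond wz s)) z≢v

    run-next : ∀ {L} → Sided H Level L → ∀ {v w z} → Run L v w → Adj H w z → z ≢ v → Run L w z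
    run-next sided r wz z≢v with run-continues sided r wz z≢v
    ... | step , s = run (Run.exits r) (Run.path r ▷ step) step s (Sided.trans-L sided (Run.away-from-origin r) s)

    run-unique : ∀ {L} → Sided H Level L → ∀ {v w z z′} → Run L v w → Adj H w z → Adj H w z′ → z ≢ v → z′ ≢ v → z ≡ z′
    run-unique sided r wz wz′ z≢ z′≢ with run-continues sided r wz z≢ | run-continues sided r wz′ z′≢
    ... | step , s | _ , s′ = one-level-side sided step s wz′ s′

    bare-run : ∀ {v w} → Bare v w → Run Left v w ⊎ Run (flip Left) v w
    bare-run (base exits step) with Sided.side leftward (proj₁ step)
    ... | inj₁ s = inj₁ (run exits (step ◅ ε) step s s)
    ... | inj₂ s = inj₂ (run exits (step ◅ ε) step s s)
    bare-run (next B wz z≢v) with bare-run B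
    ... | inj₁ r = inj₁ (run-next leftward r wz z≢v)
    ... | inj₂ r = inj₂ (run-next rightward r wz z≢v)

    bare-unique′ : ∀ {v w z z′} → Bare v w → Adj H w z → Adj H w z′ → z ≢ v → z′ ≢ v → z ≡ z′
    bare-unique′ B with bare-run B
    ... | inj₁ r = run-unique leftward r
    ... | inj₂ r = run-unique rightward r

    level-branch : ∀ {v a b c} → LevelAdj v a → Adj H v b → Adj H v c → a ≢ b → a ≢ c → b ≢ c → Bare v a
    level-branch va vb vc ab ac bc with classify vb | classify vc
    ... | inj₁ vb′ | _        = ⊥-elim (two-level va vb′ vc ab ac bc)
    ... | inj₂ _   | inj₁ vc′ = ⊥-elim (two-level va vc′ vb ac ab (≢-sym bc))
    ... | inj₂ (inj₁ (e , p)) | inj₂ (inj₁ (e′ , p′)) = contradiction (one-above above e p e′ p′) bc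
    ... | inj₂ (inj₂ (e , p)) | inj₂ (inj₂ (e′ , p′)) = contradiction (one-above below e p e′ p′) bc
    ... | inj₂ (inj₁ (e , p)) | inj₂ (inj₂ (e′ , p′)) = base (_ , _ , e , p , e′ , p′) va
    ... | inj₂ (inj₂ (e , p)) | inj₂ (inj₁ (e′ , p′)) = base (_ , _ , e′ , p′ , e , p) va

    bare-branch′ : ∀ {v a b c} → Adj H v a → Adj H v b → Adj H v c → a ≢ b → a ≢ c → b ≢ c →
                   Bare v a ⊎ Bare v b ⊎ Bare v c
    bare-branch′ va vb vc ab ac bc with classify va | classify vb | classify vc
    ... | inj₁ l | _      | _      = inj₁ (level-branch l vb vc ab ac bc)
    ... | inj₂ _ | inj₁ l | _      = inj₂ (inj₁ (level-branch l va vc (≢-sym ab) bc ac))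
    ... | inj₂ _ | inj₂ _ | inj₁ l = inj₂ (inj₂ (level-branch l va vb (≢-sym ac) (≢-sym bc) ab))
    ... | inj₂ x | inj₂ y | inj₂ z = ⊥-elim (three-exits x y z ab ac bc)

    no-four′ : ∀ {v a b c d} → Adj H v a → Adj H v b → Adj H v c → Adj H v d →
               a ≢ b → a ≢ c → a ≢ d → b ≢ c → b ≢ d → c ≢ d → ⊥
    no-four′ va vb vc vd ab ac ad bc bd cd with classify va | classify vb | classify vc | classify vd
    ... | inj₁ a | inj₁ b | _      | _      = two-level a b vc ab ac bc
    ... | inj₁ a | _      | inj₁ c | _      = two-level a c vb ac ab (≢-sym bc)
    ... | inj₁ a | _      | _      | inj₁ d = two-level a d vb ad ab (≢-sym bd)
    ... | _      | inj₁ b | inj₁ c | _      = two-level b c va bc (≢-sym ab) (≢-sym ac)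
    ... | _      | inj₁ b | _      | inj₁ d = two-level b d va bd (≢-sym ab) (≢-sym ad)
    ... | _      | _      | inj₁ c | inj₁ d = two-level c d va cd (≢-sym ac) (≢-sym ad)
    ... | inj₂ a | inj₂ b | inj₂ c | _      = three-exits a b c ab ac bc
    ... | inj₂ a | inj₂ b | _      | inj₂ d = three-exits a b d ab ad bd
    ... | inj₂ a | _      | inj₂ c | inj₂ d = three-exits a c d ac ad cd
    ... | _      | inj₂ b | inj₂ c | inj₂ d = three-exits b c d bc bd cd

  visibility-cert : Cert H Bare
  visibility-cert = record
    { no-four = no-four′ ; bare-branch = bare-branch′ ; bare-next = next ; bare-unique = bare-unique′ }

-- Visibility among real squares

<-transʳ : ∀ {x y z : ℝ} → x < y → y < z → x < z
<-transʳ {x} {y} {z} (q , xq , yq) (r , yr , zr) = r , upper-closed x (lower-<-upper y yq yr) xq , zr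

-- `x ≤ y` is a bare negation and carries no rational; locating `x` between two lower rationals of
-- `z` yields the witness.
≤-<-transʳ : ∀ {x y z : ℝ} → x ≤ y → y < z → x < z
≤-<-transʳ {x} {y} {z} x≤y (q , yq , zq) with lower-open z zq
... | r , q<r , zr with located x q<r
...   | inj₁ xq = contradiction (q , yq , xq) x≤y
...   | inj₂ xr = r , xr , zr

<-≤-transʳ : ∀ {x y z : ℝ} → x < y → y ≤ z → x < z
<-≤-transʳ {x} {y} {z} (q , xq , yq) y≤z with upper-open x xq
... | r , r<q , xr with located z r<q
...   | inj₁ zr = r , xr , zr
...   | inj₂ zq = contradiction (q , zq , yq) y≤z

<-irreflʳ : ∀ {x : ℝ} → ¬ x < x
<-irreflʳ {x} (q , u , l) = disjoint x l u

<-asymʳ : ∀ {x y : ℝ} → x < y → ¬ y < x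
<-asymʳ {x} {y} xy yx = <-irreflʳ {x} (<-transʳ {x} {y} {x} xy yx)

+1-mono-< : ∀ {x y : ℝ} → x < y → x +ℚ 1ℚ < y +ℚ 1ℚ
+1-mono-< {x} {y} (q , u , l) = q ℚ.+ 1ℚ , subst (Upper x) (sym eq) u , subst (Lower y) (sym eq) l
  where
  eq : (q ℚ.+ 1ℚ) ℚ.- 1ℚ ≡ q
  eq = trans (ℚₚ.+-assoc q 1ℚ (ℚ.- 1ℚ)) (trans (cong (q ℚ.+_) (ℚₚ.+-inverseʳ 1ℚ)) (ℚₚ.+-identityʳ q))

+1-cancel-< : ∀ {x y : ℝ} → x +ℚ 1ℚ < y +ℚ 1ℚ → x < y
+1-cancel-< (q , u , l) = q ℚ.- 1ℚ , u , l

lower-≤ : ∀ (x : ℝ) {q r} → q ℚ.≤ r → Lower x r → Lower x q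
lower-≤ x {q} {r} q≤r l with ℚₚ.<-cmp q r
... | tri< lt _ _   = lower-closed x lt l
... | tri≈ _ refl _ = l
... | tri> _ _ gt   = contradiction (ℚₚ.<-≤-trans gt q≤r) (ℚₚ.<-irrefl refl)

upper-≤ : ∀ (x : ℝ) {q r} → q ℚ.≤ r → Upper x q → Upper x r
upper-≤ x {q} {r} q≤r u with ℚₚ.<-cmp q r
... | tri< lt _ _   = upper-closed x lt u
... | tri≈ _ refl _ = u
... | tri> _ _ gt   = contradiction (ℚₚ.<-≤-trans gt q≤r) (ℚₚ.<-irrefl refl)

<⇒upper : ∀ {x y : ℝ} {q} → x < y → Upper y q → Upper x q
<⇒upper {x} {y} (r , u , l) u′ = upper-closed x (lower-<-upper y l u′) u

<⇒lower : ∀ {x y : ℝ} {q} → x < y → Lower x q → Lower y q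
<⇒lower {x} {y} (r , u , l) l′ = lower-closed y (lower-<-upper x l′ u) l

-- This replaces the maximum of `a` and `b` and the minimum of `c` and `d`: only the rational
-- witnesses are compared, never the reals.
common-rational : ∀ (a b c d : ℝ) → a < c → a < d → b < c → b < d →
                  ∃[ q ] (Upper a q × Upper b q × Lower c q × Lower d q)
common-rational a b c d (q₁ , u₁ , l₁) (q₂ , u₂ , l₂) (q₃ , u₃ , l₃) (q₄ , u₄ , l₄) =
  join (meet a u₁ l₁ u₂ l₂) (meet b u₃ l₃ u₄ l₄)
  where
  meet : ∀ (x : ℝ) {q r} → Upper x q → Lower c q → Upper x r → Lower d r → ∃[ s ] (Upper x s × Lower c s × Lower d s)
  meet x {q} {r} u l u′ l′ with ℚₚ.≤-total q r
  ... | inj₁ q≤r = q , u , l , lower-≤ d q≤r l′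
  ... | inj₂ r≤q = r , u′ , lower-≤ c r≤q l , l′
  join : ∃[ s ] (Upper a s × Lower c s × Lower d s) → ∃[ s ] (Upper b s × Lower c s × Lower d s) →
         ∃[ s ] (Upper a s × Upper b s × Lower c s × Lower d s)
  join (q , u , l , m) (r , u′ , l′ , m′) with ℚₚ.≤-total q r
  ... | inj₁ q≤r = r , upper-≤ a q≤r u , u′ , l′ , m′
  ... | inj₂ r≤q = q , u , upper-≤ b r≤q u′ , l , m

common-open : ∀ (a b c : ℝ) {p} → Lower a p → Lower b p → Lower c p →
              ∃[ q ] (p ℚ.< q × Lower a q × Lower b q × Lower c q)
common-open a b c {p} la lb lc with common-rational (ι p) (ι p) a b (lower⇒ι< a la) (lower⇒ι< b lb) (lower⇒ι< a la) (lower⇒ι< b lb)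
... | q , p<q , _ , aq , bq with common-rational (ι p) (ι p) (ι q) c (lower⇒ι< (ι q) p<q) (lower⇒ι< c lc)
                                   (lower⇒ι< (ι q) p<q) (lower⇒ι< c lc)
...   | r , p<r , _ , r<q , cr = r , p<r , lower-closed a r<q aq , lower-closed b r<q bq , cr

rational-inside : ∀ (a t y : ℝ) {p q} → p ℚ.< q → a < y → y < t → Lower y p → Upper y q →
                  a < t → ∃[ r ] (p ℚ.< r × r ℚ.< q × Upper a r × Lower t r)
rational-inside a t y {p} {q} p<q a<y y<t l u a<t
  with common-rational a (ι p) t (ι q) a<t (<-transʳ {a} {y} {ι q} a<y (upper⇒<ι y u))
         (<-transʳ {ι p} {y} {t} (lower⇒ι< y l) y<t) (lower⇒ι< (ι q) p<q)
... | r , ar , p<r , tr , r<q = r , p<r , r<q , ar , tr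

Band : ℝ → ℝ → ℚ → ℚ → Set
Band a b p q = (Upper a p × Lower b p) × (Upper a q × Lower b q)

-- A strip just above `t` inside two intervals around `t`. It is used with `t` the top of a square,
-- since any square that meets the strip then has a higher top, hence a higher bottom.
band-above : ∀ (t a b c d : ℝ) → t < b → t < d → a < t → c < t →
             ∃[ p ] ∃[ q ] (p ℚ.< q × Upper t p × Band a b p q × Band c d p q)
band-above t a b c d tb td at ct = step₁ (common-rational t t b d tb td tb td)
  where
  step₂ : ∀ p → Upper t p → Lower b p → Lower d p → ∃[ q ] (p ℚ.< q × Lower b q × Lower b q × Lower d q) →
          ∃[ p ] ∃[ q ] (p ℚ.< q × Upper t p × Band a b p q × Band c d p q)
  step₂ p tp bp dp (q , p<q , bq , _ , dq) = p , q , p<q , tp ,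
    ((<⇒upper {a} {t} at tp , bp) , (<⇒upper {a} {t} at tq , bq)) ,
    ((<⇒upper {c} {t} ct tp , dp) , (<⇒upper {c} {t} ct tq , dq))
    where
    tq : Upper t q
    tq = upper-closed t p<q tp
  step₁ : ∃[ p ] (Upper t p × Upper t p × Lower b p × Lower d p) →
          ∃[ p ] ∃[ q ] (p ℚ.< q × Upper t p × Band a b p q × Band c d p q)
  step₁ (p , tp , _ , bp , dp) = step₂ p tp bp dp (common-open b b d bp bp dp)

band-below : ∀ (t a b c d : ℝ) → a < t → c < t → t < b → t < d →
             ∃[ p ] ∃[ q ] (p ℚ.< q × Lower t q × Band a b p q × Band c d p q)
band-below t a b c d at ct tb td = step₁ (common-rational a c t t at at ct ct)
  where
  step₂ : ∀ p → Upper a p → Upper c p → Lower t p → ∃[ q ] (p ℚ.< q × Lower t q) →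
          ∃[ p ] ∃[ q ] (p ℚ.< q × Lower t q × Band a b p q × Band c d p q)
  step₂ p ap cp tp (q , p<q , tq) = p , q , p<q , tq ,
    ((ap , <⇒lower {t} {b} tb tp) , (upper-closed a p<q ap , <⇒lower {t} {b} tb tq)) ,
    ((cp , <⇒lower {t} {d} td tp) , (upper-closed c p<q cp , <⇒lower {t} {d} td tq))
  step₁ : ∃[ p ] (Upper a p × Upper c p × Lower t p × Lower t p) →
          ∃[ p ] ∃[ q ] (p ℚ.< q × Lower t q × Band a b p q × Band c d p q)
  step₁ (p , ap , cp , tp , _) = step₂ p ap cp tp (lower-open t tp)

band-within : ∀ (a b c d : ℝ) → a < b → a < d → c < b → c < d → ∃[ p ] ∃[ q ] (p ℚ.< q × Band a b p q × Band c d p q)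
band-within a b c d ab ad cb cd = step₁ (common-rational a c b d ab ad cb cd)
  where
  step₂ : ∀ p → Upper a p → Upper c p → Lower b p → Lower d p → ∃[ q ] (p ℚ.< q × Lower b q × Lower b q × Lower d q) →
          ∃[ p ] ∃[ q ] (p ℚ.< q × Band a b p q × Band c d p q)
  step₂ p ap cp bp dp (q , p<q , bq , _ , dq) =
    p , q , p<q , ((ap , bp) , (upper-closed a p<q ap , bq)) , ((cp , dp) , (upper-closed c p<q cp , dq))
  step₁ : ∃[ p ] (Upper a p × Upper c p × Lower b p × Lower d p) → ∃[ p ] ∃[ q ] (p ℚ.< q × Band a b p q × Band c d p q)
  step₁ (p , ap , cp , bp , dp) = step₂ p ap cp bp dp (common-open b b d bp bp dp)

module RealVisibility {n : ℕ} (S : Squares n) (disjoint-interiors : DisjointInteriors S)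
  {H : Graph n} (adj⇒band : ∀ {v w} → Adj H v w → HorizontalBand S v w)
  (band⇒adj : ∀ {v w} → v ≢ w → HorizontalBand S v w → Adj H v w)
  (left-dec : ∀ v w → Dec (left S v < left S w)) where

  private
    Left Below Level : Rel (Fin n) 0ℓ
    Left v w  = left S v < left S w
    Below v w = bottom S v < bottom S w
    Level v w = ¬ Below v w × ¬ Below w v

    -- For a cut this takes an approximation argument; a square that takes part in a band contains a
    -- point, from which it can be read off.
    Wide : Fin n → Set
    Wide v = left S v < right S v

    Meets : Fin n → ℚ → Set
    Meets v q = Upper (bottom S v) q × Lower (top S v) q

    left-irrefl : ∀ {v} → ¬ Left v v
    left-irrefl {v} = <-irreflʳ {left S v}

    left-trans : ∀ {u v w} → Left u v → Left v w → Left u w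
    left-trans {u} {v} {w} = <-transʳ {left S u} {left S v} {left S w}

    left⇒≢ : ∀ {v w} → Left v w → v ≢ w
    left⇒≢ {v} lt refl = left-irrefl {v} lt

    interior-wide : ∀ {v x y} → Interior S v (x , y) → Wide v
    interior-wide {v} {x} ((l , r) , _) = <-transʳ {left S v} {x} {right S v} l r

    not-overlapping : ∀ {v w q} → v ≢ w → Meets v q → Meets w q → Wide v → Wide w →
                      left S v < right S w → ¬ left S w < right S v
    not-overlapping {v} {w} {q} v≢w (vb , vt) (wb , wt) nv nw vw wv =
      case common-rational (left S v) (left S w) (right S v) (right S w) nv vw wv nw of λ (r , vl , wl , vr , wr) →
        disjoint-interiors v w v≢w (ι r , ι q)
          ((upper⇒<ι (left S v) vl , lower⇒ι< (right S v) vr) , (upper⇒<ι (bottom S v) vb , lower⇒ι< (top S v) vt))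
          ((upper⇒<ι (left S w) wl , lower⇒ι< (right S w) wr) , (upper⇒<ι (bottom S w) wb , lower⇒ι< (top S w) wt))

    left-total : ∀ {v w q} → v ≢ w → Meets v q → Meets w q → Wide v → Wide w → Left v w ⊎ Left w v
    left-total {v} {w} v≢w mv mw nv nw with left-dec v w | left-dec w v
    ... | yes vw | _      = inj₁ vw
    ... | no _   | yes wv = inj₂ wv
    ... | no ¬vw | no ¬wv = ⊥-elim (not-overlapping v≢w mv mw nv nw
            (≤-<-transʳ {left S v} {left S w} {right S w} ¬wv nw) (≤-<-transʳ {left S w} {left S v} {right S v} ¬vw nv))

    band-meets : ∀ {v w} → HorizontalBand S v w → Wide v × Wide w × ∃[ q ] (Meets v q × Meets w q)
    band-meets {v} {w} (a , b , (q , aq , bq) , free) = go (free (ι q) (upper⇒<ι a aq) (lower⇒ι< b bq))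
      where
      Free = ∀ u → u ≢ v → u ≢ w → ∀ x → Between S v w x → ¬ Interior S u (x , ι q)
      go : (∃[ x ] Interior S v (x , ι q)) × (∃[ x ] Interior S w (x , ι q)) × Free →
           Wide v × Wide w × ∃[ q ] (Meets v q × Meets w q)
      go ((x , in-v@(_ , vb , vt)) , (x′ , in-w@(_ , wb , wt)) , _) =
        interior-wide {v} {x} {ι q} in-v , interior-wide {w} {x′} {ι q} in-w , q ,
        (<ι⇒upper (bottom S v) vb , ι<⇒lower (top S v) vt) , (<ι⇒upper (bottom S w) wb , ι<⇒lower (top S w) wt)

    meets-between : ∀ {v p q r} → Meets v p → Meets v q → p ℚ.≤ r → r ℚ.≤ q → Meets v r
    meets-between {v} (b , _) (_ , t) p≤r r≤q = upper-≤ (bottom S v) p≤r b , lower-≤ (top S v) r≤q t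

    On : Fin n → Fin n → ℚ → ℚ → Fin n → Set
    On v w p q z = (∃[ r ] (p ℚ.≤ r × r ℚ.≤ q × Meets z r)) × (z ≡ v ⊎ Left v z) × (z ≡ w ⊎ Left z w)

    Obstacle : Fin n → Fin n → ℚ → ℚ → Set
    Obstacle v w p q = ∃[ u ] ∃[ r ] (p ℚ.< r × r ℚ.< q × Meets u r × Wide u × Left v u × Left u w)

    unobstructed⇒band : ∀ {v w p q} → p ℚ.< q → Meets v p → Meets v q → Meets w p → Meets w q → Wide v → Wide w →
                        Left v w → ¬ Obstacle v w p q → HorizontalBand S v w
    unobstructed⇒band {v} {w} {p} {q} p<q vp vq wp wq nv nw vw free =
      ι p , ι q , lower⇒ι< (ι q) p<q , λ y p<y y<q → let l = ι<⇒lower y p<y ; u = <ι⇒upper y y<q in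
        seen y l u vp vq nv , seen y l u wp wq nw , λ z _ _ x between in-z → obstructed z x y l u between in-z
      where
      seen : ∀ {v} y → Lower y p → Upper y q → Meets v p → Meets v q → Wide v → ∃[ x ] Interior S v (x , y)
      seen {v} y l u (b , _) (_ , t) (r , rl , rr) =
        ι r , (upper⇒<ι (left S v) rl , lower⇒ι< (right S v) rr) , (p , b , l) , (q , u , t)

      obstructed : ∀ z x y → Lower y p → Upper y q → Between S v w x → ¬ Interior S z (x , y)
      obstructed z x y l u between in-z@((zl , zr) , (zb , zt)) =
        -- The height `y` is real, but obstacles are recorded by rationals; one is extracted inside
        -- the strip at which `z` is still met.
        case rational-inside (bottom S z) (top S z) y p<q zb zt l u (<-transʳ {bottom S z} {y} {top S z} zb zt) of
          λ (r , p<r , r<q , zbr , ztr) → go r p<r r<q zbr ztr between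
        where
        go : ∀ r → p ℚ.< r → r ℚ.< q → Upper (bottom S z) r → Lower (top S z) r → Between S v w x → ⊥
        go r p<r r<q zbr ztr (inj₁ (v≤x , x≤w)) = free (z , r , p<r , r<q , (zbr , ztr) , interior-wide {z} {x} {y} in-z ,
          +1-cancel-< {left S v} {left S z} (≤-<-transʳ {right S v} {x} {right S z} v≤x zr) ,
          <-≤-transʳ {left S z} {x} {left S w} zl x≤w)
        go _ _ _ _ _ (inj₂ (w≤x , x≤v)) = x≤v (<-transʳ {left S v} {left S w} {x} vw (<-≤-transʳ {left S w} {right S w} {x} nw w≤x))

    -- If `v` does not see `w` within the strip, some `u` between them obstructs it. A thinner strip
    -- lies within the heights of `u` too, and the walks from `v` to `u` and from `u` to `w` involve
    -- fewer squares, as `u` is dropped from `xs`; `N` bounds their number.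
    line-walk : ∀ N xs → length xs ℕ.≤ N → ∀ {v w p q} → (∀ z → Left v z → Left z w → z ∈ xs) →
                p ℚ.< q → Meets v p → Meets v q → Meets w p → Meets w q → Wide v → Wide w → Left v w →
                ¬ ¬ Star (λ a b → Adj H a b × On v w p q a × On v w p q b) v w
    line-walk N xs len {v} {w} {p} {q} within p<q vp vq wp wq nv nw vw k with adj? H v w
    ... | yes e = k ((e , ((p , ℚₚ.≤-refl , ℚₚ.<⇒≤ p<q , vp) , inj₁ refl , inj₂ vw) ,
                          ((p , ℚₚ.≤-refl , ℚₚ.<⇒≤ p<q , wp) , inj₂ vw , inj₁ refl)) ◅ ε)
    ... | no ¬e = ¬e (band⇒adj (left⇒≢ vw) (unobstructed⇒band p<q vp vq wp wq nv nw vw (split N xs len within)))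
      where
      split : ∀ N xs → length xs ℕ.≤ N → (∀ z → Left v z → Left z w → z ∈ xs) → ¬ Obstacle v w p q
      split zero [] _ within (u , _ , _ , _ , _ , _ , vu , uw) with within u vu uw
      ... | ()
      split (suc N) xs len within (u , r , p<r , r<q , (ub , ut) , nu , vu , uw) =
        case common-open (ι q) (ι q) (top S u) r<q r<q ut of λ (s , r<s , s<q , _ , ut′) → go s r<s s<q ut′
        where
        go : ∀ s → r ℚ.< s → s ℚ.< q → Lower (top S u) s → ⊥
        go s r<s s<q ut′ =
          line-walk N xs′ len′ (λ z vz zu → within′ z vz (left-trans {z} {u} {w} zu uw) (left⇒≢ zu))
            r<s (meets-between {v} vp vq p≤r r≤q) (meets-between {v} vp vq p≤s s≤q) ur us nv nu vu λ es →
          line-walk N xs′ len′ (λ z uz zw → within′ z (left-trans {v} {u} {z} vu uz) zw (≢-sym (left⇒≢ uz)))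
            r<s ur us (meets-between {w} wp wq p≤r r≤q) (meets-between {w} wp wq p≤s s≤q) nu nw uw λ es′ →
          k (Star.map (λ (e , a , b) → e , widenˡ a , widenˡ b) es ◅◅ Star.map (λ (e , a , b) → e , widenʳ a , widenʳ b) es′)
          where
          p≤r = ℚₚ.<⇒≤ p<r
          r≤q = ℚₚ.<⇒≤ r<q
          s≤q = ℚₚ.<⇒≤ s<q
          p≤s = ℚₚ.<⇒≤ (ℚₚ.<-trans p<r r<s)
          ur = ub , ut
          us = upper-closed (bottom S u) r<s ub , ut′
          xs′ = filter (λ z → ¬? (z ≟ u)) xs
          len′ : length xs′ ℕ.≤ N
          len′ = ℕₚ.≤-pred (ℕₚ.<-≤-trans (Listₚ.filter-notAll (λ z → ¬? (z ≟ u)) xs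
                   (Any.map (λ { refl z≢z → z≢z refl }) (within u vu uw))) len)
          within′ : ∀ z → Left v z → Left z w → z ≢ u → z ∈ xs′
          within′ z vz zw z≢u = Mem.∈-filter⁺ (λ z → ¬? (z ≟ u)) (within z vz zw) z≢u
          widen : ∀ {z} → ∃[ t ] (r ℚ.≤ t × t ℚ.≤ s × Meets z t) → ∃[ t ] (p ℚ.≤ t × t ℚ.≤ q × Meets z t)
          widen (t , r≤t , t≤s , m) = t , ℚₚ.≤-trans p≤r r≤t , ℚₚ.≤-trans t≤s s≤q , m
          widenˡ : ∀ {z} → On v u r s z → On v w p q z
          widenˡ {z} (m , l , inj₁ refl) = widen m , l , inj₂ uw
          widenˡ {z} (m , l , inj₂ zu)   = widen m , l , inj₂ (left-trans {z} {u} {w} zu uw)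
          widenʳ : ∀ {z} → On u w r s z → On v w p q z
          widenʳ {z} (m , inj₁ refl , l) = widen m , inj₂ vu , l
          widenʳ {z} (m , inj₂ uz , l)   = widen m , inj₂ (left-trans {v} {u} {z} vu uz) , l

    -- `On` is weakened to a form symmetric in `v` and `w`, so that a walk can be used without
    -- knowing which of the two is on the left.
    Fine : Fin n → Fin n → ℚ → ℚ → Fin n → Set
    Fine v w p q z = (∃[ r ] (p ℚ.≤ r × r ℚ.≤ q × Meets z r)) ×
                     (∀ u → Left u v → Left u w → Left u z) × (∀ u → Left v u → Left w u → Left z u)

    on⇒fine : ∀ {v w p q z} → On v w p q z → Fine v w p q z
    on⇒fine {v} {w} {z = z} (m , l , r) = m , (λ u uv _ → after u uv l) , (λ u _ wu → before u wu r)
      where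
      after : ∀ u → Left u v → z ≡ v ⊎ Left v z → Left u z
      after u uv (inj₁ refl) = uv
      after u uv (inj₂ vz)   = left-trans {u} {v} {z} uv vz
      before : ∀ u → Left w u → z ≡ w ⊎ Left z w → Left z u
      before u wu (inj₁ refl) = wu
      before u wu (inj₂ zw)   = left-trans {z} {w} {u} zw wu

    connect : ∀ {v w p q} → p ℚ.< q → Meets v p → Meets v q → Meets w p → Meets w q → Wide v → Wide w →
              ¬ ¬ Star (λ a b → Adj H a b × Fine v w p q a × Fine v w p q b) v w
    connect {v} {w} {p} {q} p<q vp vq wp wq nv nw k with v ≟ w
    ... | yes refl = k ε
    ... | no v≢w with left-total v≢w vp wp nv nw
    ...   | inj₁ vw = line-walk _ (allFin n) ℕₚ.≤-refl (λ z _ _ → Mem.∈-allFin z) p<q vp vq wp wq nv nw vw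
            λ es → k (Star.map (λ (e , a , b) → e , on⇒fine a , on⇒fine b) es)
    ...   | inj₂ wv = line-walk _ (allFin n) ℕₚ.≤-refl (λ z _ _ → Mem.∈-allFin z) p<q wp wq vp vq nw nv wv
            λ es → k (Star.reverse (λ (e , a , b) → symmetric H e , b , a) (Star.map turned es))
      where
      turn : ∀ {z} → Fine w v p q z → Fine v w p q z
      turn (m , l , r) = m , (λ u uv uw → l u uw uv) , (λ u vu wu → r u wu vu)

      turned : ∀ {a b} → Adj H a b × On w v p q a × On w v p q b → Adj H a b × Fine v w p q a × Fine v w p q b
      turned (e , a , b) = e , turn (on⇒fine a) , turn (on⇒fine b)

    adj-meets : ∀ {v w} → Adj H v w → Wide v × Wide w × ∃[ q ] (Meets v q × Meets w q)
    adj-meets e = band-meets (adj⇒band e)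

    bottom<top : ∀ {v q w} → Meets v q → Meets w q → bottom S v < top S w
    bottom<top (b , _) (_ , t) = _ , b , t

    level-sym : Symmetric Level
    level-sym (a , b) = b , a

    level-bottom : ∀ {v w z} → Level v w → Below v z → Below w z
    level-bottom {v} {w} {z} (vw , _) vz = ≤-<-transʳ {bottom S w} {bottom S v} {bottom S z} vw vz

    level-top : ∀ {v w y} → Level v w → y < top S v → y < top S w
    level-top {v} {w} {y} (_ , wv) yv =
      <-≤-transʳ {y} {top S v} {top S w} yv (λ tw → wv (+1-cancel-< {bottom S w} {bottom S v} tw))

    level-bottom-< : ∀ {v w y} → Level v w → bottom S v < y → bottom S w < y
    level-bottom-< {v} {w} {y} (vw , _) vy = ≤-<-transʳ {bottom S w} {bottom S v} {y} vw vy

    walk-above : ∀ {x w u u′} → Level x w → Adj H x u → Below x u → Adj H w u′ → Below w u′ →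
                 ¬ ¬ Star (λ a b → Adj H a b × Below x a × Below x b) u u′
    walk-above {x} {w} {u} {u′} xw e xu e′ wu′ k = go (adj-meets e) (adj-meets e′)
      where
      xu′ : Below x u′
      xu′ = level-bottom {w} {x} {u′} (level-sym {x} {w} xw) wu′

      is-above : ∀ {z p q} → Upper (top S x) p → Fine u u′ p q z → Below x z
      is-above {z} xp ((r , p≤r , _ , _ , zt) , _) =
        +1-cancel-< {bottom S x} {bottom S z} (r , upper-≤ (top S x) p≤r xp , zt)

      go : Wide x × Wide u × ∃[ q ] (Meets x q × Meets u q) → Wide w × Wide u′ × ∃[ q ] (Meets w q × Meets u′ q) → ⊥
      go (_ , nu , q₁ , xq , uq) (_ , nu′ , q₂ , wq , u′q) =
        case band-above (top S x) (bottom S u) (top S u) (bottom S u′) (top S u′)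
               (+1-mono-< {bottom S x} {bottom S u} xu) (+1-mono-< {bottom S x} {bottom S u′} xu′)
               (bottom<top {u} {q₁} {x} uq xq)
               (level-top {w} {x} {bottom S u′} (level-sym {x} {w} xw) (bottom<top {u′} {q₂} {w} u′q wq)) of
          λ (p , q , p<q , xp , (up , uq) , (u′p , u′q)) → connect p<q up uq u′p u′q nu nu′
            λ es → k (Star.map (λ (f , a , b) → f , is-above xp a , is-above xp b) es)

    walk-below : ∀ {x w u u′} → Level x w → Adj H x u → Below u x → Adj H w u′ → Below u′ w →
                 ¬ ¬ Star (λ a b → Adj H a b × Below a x × Below b x) u u′
    walk-below {x} {w} {u} {u′} xw e ux e′ u′w k = go (adj-meets e) (adj-meets e′)
      where
      u′x : Below u′ x
      u′x = <-≤-transʳ {bottom S u′} {bottom S w} {bottom S x} u′w (proj₁ xw)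

      is-below : ∀ {z p q} → Lower (bottom S x) q → Fine u u′ p q z → Below z x
      is-below {z} xq ((r , _ , r≤q , zb , _) , _) = r , zb , lower-≤ (bottom S x) r≤q xq

      go : Wide x × Wide u × ∃[ q ] (Meets x q × Meets u q) → Wide w × Wide u′ × ∃[ q ] (Meets w q × Meets u′ q) → ⊥
      go (_ , nu , q₁ , xq , uq) (_ , nu′ , q₂ , wq , u′q) =
        case band-below (bottom S x) (bottom S u) (top S u) (bottom S u′) (top S u′) ux u′x
               (bottom<top {x} {q₁} {u} xq uq)
               (level-bottom-< {w} {x} {top S u′} (level-sym {x} {w} xw) (bottom<top {w} {q₂} {u′} wq u′q)) of
          λ (p , q , p<q , xq′ , (up , uq) , (u′p , u′q)) → connect p<q up uq u′p u′q nu nu′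
            λ es → k (Star.map (λ (f , a , b) → f , is-below xq′ a , is-below xq′ b) es)

    walk-beside : ∀ {v w w′} → Level v w → Adj H v w → Adj H v w′ →
                  ¬ ¬ (∃[ p ] ∃[ q ] Star (λ a b → Adj H a b × Fine w w′ p q a × Fine w w′ p q b) w w′)
    walk-beside {v} {w} {w′} vw e e′ k = go (adj-meets e) (adj-meets e′)
      where
      go : Wide v × Wide w × ∃[ q ] (Meets v q × Meets w q) → Wide v × Wide w′ × ∃[ q ] (Meets v q × Meets w′ q) → ⊥
      go (_ , nw , q₁ , _ , wq) (_ , nw′ , q₂ , vq , w′q) =
        case band-within (bottom S w) (top S w) (bottom S w′) (top S w′) (bottom<top {w} {q₁} {w} wq wq)
               (level-bottom-< {v} {w} {top S w′} vw (bottom<top {v} {q₂} {w′} vq w′q))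
               (level-top {v} {w} {bottom S w′} vw (bottom<top {w′} {q₂} {v} w′q vq))
               (bottom<top {w′} {q₂} {w′} w′q w′q) of
          λ (p , q , p<q , (wp , wq) , (w′p , w′q)) → connect p<q wp wq w′p w′q nw nw′ λ es → k (p , q , es)

  horizontal-cert : (∀ v w → Dec (bottom S v < bottom S w)) → IsForest H → ∃[ B ] Cert H B
  horizontal-cert below-dec forest = _ , ForestVisibility.visibility-cert forest Level Left Below
    (λ {v} → <-irreflʳ {bottom S v} , <-irreflʳ {bottom S v}) (λ {v} {w} → level-sym {v} {w})
    (λ {u} {v} {w} → level-trans {u} {v} {w}) compare
    (record
      { irrefl = λ {v} → left-irrefl {v} ; trans-L = λ {u} {v} {w} → left-trans {u} {v} {w}
      ; side = λ e → let (nv , nw , _ , mv , mw) = adj-meets e in left-total (adj⇒≢ H e) mv mw nv nw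
      ; walk = λ {v} l e s e′ s′ k → walk-beside l e e′ λ (_ , _ , es) →
          k (Star.map (λ (f , (_ , a , _) , (_ , b , _)) → f , a v s s′ , b v s s′) es)
      ; walk⁻ = λ {v} l e s e′ s′ k → walk-beside l e e′ λ (_ , _ , es) →
          k (Star.map (λ (f , (_ , _ , a) , (_ , _ , b)) → f , a v s s′ , b v s s′) es) })
    (record
      { irrefl = λ {v} → <-irreflʳ {bottom S v} ; asym = λ {v} {w} → <-asymʳ {bottom S v} {bottom S w}
      ; not-level = λ b l → proj₁ l b ; walk = walk-above })
    (record
      { irrefl = λ {v} → <-irreflʳ {bottom S v} ; asym = λ {v} {w} → <-asymʳ {bottom S w} {bottom S v}
      ; not-level = λ b l → proj₂ l b ; walk = walk-below })
    where
    level-trans : ∀ {u v w} → Level u v → Level v w → Level u w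
    level-trans {u} {v} {w} uv (vw , wv) =
      (λ lt → vw (level-bottom {u} {v} {w} uv lt)) ,
      (λ lt → wv (<-≤-transʳ {bottom S w} {bottom S u} {bottom S v} lt (proj₂ uv)))
    compare : ∀ v w → Level v w ⊎ Below v w ⊎ Below w v
    compare v w with below-dec v w | below-dec w v
    ... | yes vw | _      = inj₂ (inj₁ vw)
    ... | no _   | yes wv = inj₂ (inj₂ wv)
    ... | no ¬vw | no ¬wv = inj₁ (¬vw , ¬wv)

-- Splitting a tree

-- The middle term of the equivalence. Edges may lie in both graphs here; the overlap is removed
-- only for the drawing.
record Split {n : ℕ} (T : Graph n) : Set₁ where
  field
    {G₁ G₂}       : Graph n
    {Bare₁ Bare₂} : Rel (Fin n) 0ℓ
    G₁⊑T          : G₁ ⊑ T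
    G₂⊑T          : G₂ ⊑ T
    cover         : ∀ {v w} → Adj T v w → Adj G₁ v w ⊎ Adj G₂ v w
    cert₁         : Cert G₁ Bare₁
    cert₂         : Cert G₂ Bare₂

⊑-subgraph : ∀ {n} {G T : Graph n} → G ⊑ T → Subgraph G T
⊑-subgraph sub = record { embed = id ; embed-injective = id ; embed-adj = sub }

⊑-forest : ∀ {n} {G T : Graph n} → G ⊑ T → IsForest T → IsForest G
⊑-forest {G = G} {T} sub = forest-subgraph {F = G} {T} (⊑-subgraph sub)

_∖_ : ∀ {n} → Graph n → Graph n → Graph n
G ∖ H = record
  { Adj = λ v w → Adj G v w × ¬ Adj H v w
  ; adj? = λ v w → adj? G v w ×-dec ¬? (adj? H v w)
  ; symmetric = λ (e , ¬e) → symmetric G e , ¬e ∘ symmetric H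
  ; loopless = loopless G ∘ proj₁ }

module _ {n : ℕ} {T : Graph n} (tree : IsTree T) where

  private
    T-forest : IsForest T
    T-forest = proj₂ (proj₂ tree)

  tree-rooting : Rooting T
  tree-rooting = rooting T-forest (record
    { rep = λ _ → fromℕ< (proj₁ tree) ; rep-adj = λ _ → refl ; rep-walk = λ v → proj₁ (proj₂ tree) v _ })

  sub-comb : ∀ {G : Graph n} {Bare} → G ⊑ T → Cert G Bare → Comb G
  sub-comb {G} sub = comb (⊑-forest {G = G} {T} sub T-forest) (SubRooting.sub-representatives tree-rooting sub)

  split⇒URVG : Split T → IsURVG T
  split⇒URVG split = visible⇒URVG {T = T} {G₁} {G₂ ∖ G₁} G₁⊑T (G₂⊑T ∘ proj₁) disjoint-cover (proj₁ visible) (proj₂ visible)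
    where
    open Split split
    disjoint-cover : ∀ {v w} → Adj T v w → Adj G₁ v w ⊎ Adj (G₂ ∖ G₁) v w
    disjoint-cover {v} {w} e with cover e | adj? G₁ v w
    ... | inj₁ e₁ | _      = inj₁ e₁
    ... | inj₂ _  | yes e₁ = inj₁ e₁
    ... | inj₂ e₂ | no ¬e₁ = inj₂ (e₂ , ¬e₁)
    visible = proj₂ (proj₂ (layout {G₁ = G₁} {G₂ ∖ G₁} tree-rooting G₁⊑T (G₂⊑T ∘ proj₁) (λ e (_ , ¬e) → ¬e e)
      (sub-comb G₁⊑T cert₁) (sub-comb (G₂⊑T ∘ proj₁) (cert-⊑ {G = G₂} {G₂ ∖ G₁} proj₁ cert₂))))

  split⇒union : Split T → IsUnionOfTwo (λ F → IsSubdividedCaterpillarForest F × MaxDegree≤ 3 F) T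
  split⇒union split = _ , G₁ , _ , G₂ , ⊑-subgraph G₁⊑T , ⊑-subgraph G₂⊑T ,
    (forests G₁⊑T cert₁ , cert⇒degree≤3 cert₁) , (forests G₂⊑T cert₂ , cert⇒degree≤3 cert₂) , covered
    where
    open Split split
    forests : ∀ {G : Graph n} {Bare} → G ⊑ T → Cert G Bare → IsSubdividedCaterpillarForest G
    forests {G} sub cert = comb⇒subdivided-caterpillar-forest (⊑-forest {G = G} {T} sub T-forest)
      (SubRooting.sub-representatives tree-rooting sub) (sub-comb sub cert)
    covered : ∀ v w → Adj T v w → EdgeOf (⊑-subgraph {G = G₁} {T} G₁⊑T) v w ⊎ EdgeOf (⊑-subgraph {G = G₂} {T} G₂⊑T) v w
    covered v w e with cover e
    ... | inj₁ e₁ = inj₁ (v , w , refl , refl , e₁)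
    ... | inj₂ e₂ = inj₂ (v , w , refl , refl , e₂)

union⇒split : ∀ {n} {T : Graph n} → IsUnionOfTwo (λ F → IsSubdividedCaterpillarForest F × MaxDegree≤ 3 F) T → Split T
union⇒split (_ , F₁ , _ , F₂ , S₁ , S₂ , (scf₁ , deg₁) , (scf₂ , deg₂) , cover) = record
  { G₁⊑T = image-⊑ S₁ ; G₂⊑T = image-⊑ S₂ ; cover = cover _ _
  ; cert₁ = image-cert S₁ (subdivided-caterpillar-forest⇒cert scf₁ deg₁)
  ; cert₂ = image-cert S₂ (subdivided-caterpillar-forest⇒cert scf₂ deg₂) }

-- Orders between reals are undecidable, so a splitting of the visibilities is obtained classically first;
-- encoded by Boolean matrices, it is then found by search.

¬¬-finite : ∀ {a n} {P : Fin n → Set a} → (∀ i → ¬ ¬ P i) → ¬ ¬ (∀ i → P i)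
¬¬-finite {n = zero}  _ k = k λ ()
¬¬-finite {n = suc n} f k = f zero λ p → ¬¬-finite (f ∘ suc) λ ps → k λ { zero → p ; (suc i) → ps i }

¬¬-decidable : ∀ {a n} (R : Fin n → Fin n → Set a) → ¬ ¬ (∀ v w → Dec (R v w))
¬¬-decidable R = ¬¬-finite λ v → ¬¬-finite λ w → ¬¬-excluded-middle

cert? : ∀ {n} (G : Graph n) {Bare : Rel (Fin n) 0ℓ} → Decidable Bare → Dec (Cert G Bare)
cert? G {Bare} bare? = map′
  (λ (f , b , x , u) → record
    { no-four = λ {v} {a′} {b′} {c} {d} → f v a′ b′ c d ; bare-branch = λ {v} {a′} {b′} {c} → b v a′ b′ c
    ; bare-next = λ {v} {w} {z} → x v w z ; bare-unique = λ {v} {w} {z} {z′} → u v w z z′ })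
  (λ cert → let open Cert cert in
    (λ _ _ _ _ _ → no-four) , (λ _ _ _ _ → bare-branch) , (λ _ _ _ → bare-next) , (λ _ _ _ _ → bare-unique))
  ((all? λ v → all? λ a → all? λ b → all? λ c → all? λ d →
      adj? G v a →-dec adj? G v b →-dec adj? G v c →-dec adj? G v d →-dec
      ¬? (a ≟ b) →-dec ¬? (a ≟ c) →-dec ¬? (a ≟ d) →-dec ¬? (b ≟ c) →-dec ¬? (b ≟ d) →-dec ¬? (c ≟ d) →-dec no id)
   ×-dec
   (all? λ v → all? λ a → all? λ b → all? λ c →
      adj? G v a →-dec adj? G v b →-dec adj? G v c →-dec ¬? (a ≟ b) →-dec ¬? (a ≟ c) →-dec ¬? (b ≟ c) →-dec
      (bare? v a ⊎-dec bare? v b ⊎-dec bare? v c))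
   ×-dec
   (all? λ v → all? λ w → all? λ z → bare? v w →-dec adj? G w z →-dec ¬? (z ≟ v) →-dec bare? w z)
   ×-dec
   (all? λ v → all? λ w → all? λ z → all? λ z′ →
      bare? v w →-dec adj? G w z →-dec adj? G w z′ →-dec ¬? (z ≟ v) →-dec ¬? (z′ ≟ v) →-dec (z ≟ z′)))

-- Subsets of the set of pairs are the form of relation over which `anySubset?` can search.
Matrix : ℕ → Set
Matrix n = Subset (n ℕ.* n)

Entry : ∀ {n} → Matrix n → Rel (Fin n) 0ℓ
Entry m v w = T (lookup m (combine v w))

entry? : ∀ {n} (m : Matrix n) → Decidable (Entry {n} m)
entry? m v w = T? (lookup m (combine v w))

module _ {n : ℕ} {R : Rel (Fin n) 0ℓ} (R? : Decidable R) where

  private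
    value : Fin n × Fin n → Bool
    value (v , w) = does (R? v w)

  matrix : Matrix n
  matrix = tabulate (value ∘ remQuot n)

  private
    matrix-value : ∀ v w → lookup matrix (combine v w) ≡ does (R? v w)
    matrix-value v w = trans (lookup∘tabulate (value ∘ remQuot n) (combine v w)) (cong value (remQuot-combine v w))

  matrix⁺ : ∀ {v w} → R v w → Entry {n} matrix v w
  matrix⁺ {v} {w} r = subst T (sym (trans (matrix-value v w) (dec-true (R? v w) r))) tt

  matrix⁻ : ∀ {v w} → Entry {n} matrix v w → R v w
  matrix⁻ {v} {w} t with R? v w | subst T (matrix-value v w) t
  ... | yes r | _ = r

module _ {n : ℕ} (T : Graph n) where

  -- Intersecting with `T` and symmetrising makes a subgraph of `T` out of every matrix, so that the
  -- search can range over all matrices.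
  select : Matrix n → Graph n
  select m = record
    { Adj = λ v w → Adj T v w × (Entry {n} m v w ⊎ Entry {n} m w v)
    ; adj? = λ v w → adj? T v w ×-dec (entry? {n} m v w ⊎-dec entry? {n} m w v)
    ; symmetric = λ { (e , inj₁ m) → symmetric T e , inj₂ m ; (e , inj₂ m) → symmetric T e , inj₁ m }
    ; loopless = loopless T ∘ proj₁ }

  SplitBy : Matrix n → Matrix n → Matrix n → Matrix n → Set
  SplitBy m₁ m₂ b₁ b₂ = (∀ v w → Adj T v w → Adj (select m₁) v w ⊎ Adj (select m₂) v w) ×
                        Cert (select m₁) (Entry {n} b₁) × Cert (select m₂) (Entry {n} b₂)

  splitBy? : ∀ m₁ m₂ b₁ b₂ → Dec (SplitBy m₁ m₂ b₁ b₂)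
  splitBy? m₁ m₂ b₁ b₂ =
    (all? λ v → all? λ w → adj? T v w →-dec (adj? (select m₁) v w ⊎-dec adj? (select m₂) v w)) ×-dec
    cert? (select m₁) (entry? {n} b₁) ×-dec cert? (select m₂) (entry? {n} b₂)

  select-cert : ∀ {H : Graph n} {Bare : Rel (Fin n) 0ℓ} (bare? : Decidable Bare) →
                Cert H Bare → Cert (select (matrix (adj? H))) (Entry {n} (matrix bare?))
  select-cert {H} {Bare} bare? cert = record
    { no-four = λ a b c d → no-four (sub a) (sub b) (sub c) (sub d)
    ; bare-branch = branch
    ; bare-next = λ B e z≢v → matrix⁺ bare? (bare-next (matrix⁻ bare? B) (sub e) z≢v)
    ; bare-unique = λ B e e′ → bare-unique (matrix⁻ bare? B) (sub e) (sub e′) }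
    where
    open Cert cert
    sub : select (matrix (adj? H)) ⊑ H
    sub (_ , inj₁ m) = matrix⁻ (adj? H) m
    sub (_ , inj₂ m) = symmetric H (matrix⁻ (adj? H) m)
    branch : ∀ {v a b c} → Adj (select (matrix (adj? H))) v a → Adj (select (matrix (adj? H))) v b →
             Adj (select (matrix (adj? H))) v c → a ≢ b → a ≢ c → b ≢ c →
             Entry {n} (matrix bare?) v a ⊎ Entry {n} (matrix bare?) v b ⊎ Entry {n} (matrix bare?) v c
    branch a b c ab ac bc with bare-branch (sub a) (sub b) (sub c) ab ac bc
    ... | inj₁ B        = inj₁ (matrix⁺ bare? B)
    ... | inj₂ (inj₁ B) = inj₂ (inj₁ (matrix⁺ bare? B))
    ... | inj₂ (inj₂ B) = inj₂ (inj₂ (matrix⁺ bare? B))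

  split-from-matrices : (∃[ m₁ ] ∃[ m₂ ] ∃[ b₁ ] ∃[ b₂ ] SplitBy m₁ m₂ b₁ b₂) → Split T
  split-from-matrices (m₁ , m₂ , _ , _ , cover , cert₁ , cert₂) = record
    { G₁ = select m₁ ; G₂ = select m₂ ; G₁⊑T = proj₁ ; G₂⊑T = proj₁ ; cover = cover _ _ ; cert₁ = cert₁ ; cert₂ = cert₂ }

  stable-split : ¬ ¬ (∃[ m₁ ] ∃[ m₂ ] ∃[ b₁ ] ∃[ b₂ ] SplitBy m₁ m₂ b₁ b₂) → Split T
  stable-split ¬¬split = split-from-matrices (decidable-stable
    (anySubset? λ m₁ → anySubset? λ m₂ → anySubset? λ b₁ → anySubset? λ b₂ → splitBy? m₁ m₂ b₁ b₂) ¬¬split)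

band-sym : ∀ {n} {S : Squares n} {v w} → HorizontalBand S v w → HorizontalBand S w v
band-sym (a , b , a<b , free) = a , b , a<b , λ y a<y y<b →
  let (in-v , in-w , unobstructed) = free y a<y y<b in
  in-w , in-v , λ u u≢w u≢v x → λ { (inj₁ p) → unobstructed u u≢v u≢w x (inj₂ p) ; (inj₂ p) → unobstructed u u≢v u≢w x (inj₁ p) }

module _ {n : ℕ} {S : Squares n} (band? : ∀ v w → Dec (HorizontalBand S v w)) where

  band-graph : Graph n
  band-graph = record
    -- Bands live in `Set₁` while `Adj` takes values in `Set`; passing to the Boolean of the
    -- decision lowers the level.
    { Adj = λ v w → v ≢ w × True (band? v w)
    ; adj? = λ v w → ¬? (v ≟ w) ×-dec T? (isYes (band? v w))
    ; symmetric = λ {v} {w} (v≢w , t) → ≢-sym v≢w , fromWitness {a? = band? w v} (band-sym {S = S} (toWitness {a? = band? v w} t))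
    ; loopless = λ (v≢v , _) → v≢v refl }

  band-graph-cert : ∀ {T : Graph n} → DisjointInteriors S → band-graph ⊑ T → IsForest T →
                    ¬ ¬ (∃[ B ] (Cert band-graph B × Decidable B))
  band-graph-cert {T} disjoint-interiors sub forest k =
    ¬¬-decidable (λ v w → left S v < left S w) λ left-dec →
    ¬¬-decidable (λ v w → bottom S v < bottom S w) λ below-dec →
    let (B , cert) = RealVisibility.horizontal-cert S disjoint-interiors {band-graph}
                       (λ {v} {w} (_ , t) → toWitness {a? = band? v w} t)
                       (λ {v} {w} v≢w band → v≢w , fromWitness {a? = band? v w} band)
                       left-dec below-dec (⊑-forest {G = band-graph} {T} sub forest)
    in ¬¬-decidable B λ B? → k (B , cert , B?)

URVG⇒split : ∀ {n} {T : Graph n} → IsForest T → IsURVG T → Split T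
URVG⇒split {n} {T} forest (S , disjoint-interiors , visible) = stable-split T λ k →
  ¬¬-decidable (HorizontalBand S) λ h? → ¬¬-decidable (VerticalBand S) λ v? →
  let H = band-graph {S = S} h?
      V = band-graph {S = swap ∘ S} v?
      H⊑T : H ⊑ T
      H⊑T = λ {v} {w} (v≢w , t) → Equivalence.from (visible v w v≢w) (inj₁ (toWitness {a? = h? v w} t))
      V⊑T : V ⊑ T
      V⊑T = λ {v} {w} (v≢w , t) → Equivalence.from (visible v w v≢w) (inj₂ (toWitness {a? = v? v w} t))
      cover : ∀ v w → Adj T v w → Adj (select T (matrix (adj? H))) v w ⊎ Adj (select T (matrix (adj? V))) v w
      cover v w e = [ (λ h → inj₁ (e , inj₁ (matrix⁺ (adj? H) (adj⇒≢ T e , fromWitness {a? = h? v w} h))))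
                    , (λ h → inj₂ (e , inj₁ (matrix⁺ (adj? V) (adj⇒≢ T e , fromWitness {a? = v? v w} h)))) ]′
                    (Equivalence.to (visible v w (adj⇒≢ T e)) e)
  in band-graph-cert {S = S} h? {T} disjoint-interiors H⊑T forest λ (_ , certH , BH?) →
     band-graph-cert {S = swap ∘ S} v? {T} disjoint-swapped V⊑T forest λ (_ , certV , BV?) →
     k (matrix (adj? H) , matrix (adj? V) , matrix BH? , matrix BV? , cover ,
        select-cert T {H} BH? certH , select-cert T {V} BV? certV)
  where
  disjoint-swapped : DisjointInteriors (swap ∘ S)
  disjoint-swapped v w v≢w p in-v in-w = disjoint-interiors v w v≢w (swap p) (swap in-v) (swap in-w)

theorem4p5 : ∀ {n : ℕ} (T : Graph n) → IsTree T →
    IsURVG T ⇔ IsUnionOfTwo (λ F → IsSubdividedCaterpillarForest F × MaxDegree≤ 3 F) T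
theorem4p5 T tree = mk⇔
  (λ urvg → split⇒union tree (URVG⇒split (proj₂ (proj₂ tree)) urvg))
  (λ union → split⇒URVG tree (union⇒split union))
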